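{- Let $a$ be a nonzero natural number. Assume that for every $k\in \mathbb{N}$ there exists an $r\in \mathcal{R}_a$ such that $ak+r \neq 4^s(8t+7)$ for all $s, t \in \mathbb{N}$. Then every $N\in \mathbb{N}$ can be written as $N=\left\lfloor \frac{A^2}{a}\right\rfloor+\left\lfloor \frac{B^2}{a}\right\rfloor+\left\lfloor \frac{C^2}{a}\right\rfloor$ for some $A,B,C\in\mathbb{N}$, i.e. as the sum of three terms of the sequence $\left( \left\lfloor\frac{n^2}{a}\right\rfloor \right)_{n\in \mathbb{N}}$.
   Context: $\mathbb{N}$ denotes the set of non-negative integers and $\lfloor\cdot\rfloor$ the integer part. For nonzero $a\in\mathbb{N}$: $\mathcal{Q}_a=\{\varphi\in\mathbb{Z} : 0<\varphi<a,\ \exists x\in\mathbb{Z},\ \varphi\equiv x^2 \pmod a\}$ (the nonzero quadratic residues modulo $a$, as integers in $(0,a)$); $\mathcal{A}_a=\{\varphi\in\mathbb{N} : \exists x,y,z\in \mathcal{Q}_a\cup\{0\},\ \varphi=x+y+z\}$; and $\mathcal{R}_a=\{\varphi\in\mathcal{A}_a : \forall \psi\in\mathcal{A}_a,\ \varphi\equiv\psi \pmod a \Rightarrow \varphi=\psi\}$, i.e. the elements of $\mathcal{A}_a$ that are the unique element of $\mathcal{A}_a$ in their residue class modulo $a$. -}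

module Defs where

open import Data.Nat using (ℕ; zero; suc; _+_; _*_; _^_; _<_; NonZero)
open import Data.Nat.DivMod using (_%_; _/_)
open import Data.Product using (Σ; _×_; ∃-syntax)
open import Data.Sum using (_⊎_)
open import Relation.Binary.PropositionalEquality using (_≡_)

-- φ ∈ 𝒬_a : 0 < φ < a and φ ≡ x² (mod a) for some integer x.
-- (Since x² = (-x)², quantifying over x ∈ ℕ is the same as over x ∈ ℤ.)
QR : (a : ℕ) → .{{_ : NonZero a}} → ℕ → Set
QR a φ = 0 < φ × φ < a × ∃[ x ] (φ % a ≡ (x * x) % a)

QR₀ : (a : ℕ) → .{{_ : NonZero a}} → ℕ → Set
QR₀ a φ = φ ≡ 0 ⊎ QR a φ

InA : (a : ℕ) → .{{_ : NonZero a}} → ℕ → Set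
InA a φ = ∃[ x ] ∃[ y ] ∃[ z ] (QR₀ a x × QR₀ a y × QR₀ a z × φ ≡ x + y + z)

InR : (a : ℕ) → .{{_ : NonZero a}} → ℕ → Set
InR a φ = InA a φ × (∀ ψ → InA a ψ → φ % a ≡ ψ % a → φ ≡ ψ)

{-# OPTIONS --safe #-}
-- The theorem reduces to Legendre's three-square theorem: if aN + r = x² + y² + z², the residues of x², y², z²
-- modulo a add up to r, because r is alone in its class, and the quotients then add up to N.
--
-- The three-square theorem is proved by counting, without primes in progressions. Let R(n) be the number of
-- representations of n by three squares, in one of the classes n ≡ 3 mod 8, n ≡ 1 mod 4 and n ≡ 2 mod 4. Summing
-- R(N − k²) over k gives the number of representations of N by four squares, which is a sum σ of odd divisors
-- (Jacobi; from the recursion Σ (5k² − N) f(N − k²) = 0, which both sides satisfy). Kronecker's counting functions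
-- such as G(n) = #{xy + yz + zx = n}, with x, y, z odd and positive, satisfy the same relation Σ G(N − k²) = σ, by
-- Liouville's elementary method: the range of summation is cut into cells that are matched by linear substitutions.
-- So R = G by descent, and G(n) > 0 is obvious.
module Submission where

-- The bridge from ternary forms to Liouville's method is the identity `p² + xy + yz + zx = (x +
-- z)(y + z) + (p − z)(p + z)`. For `p > z` it turns a square plus Kronecker's form into a bilinear
-- form `ac + uw` in positive variables; for `p < z` the rewriting `(x + p)(y + p) + (z − p)(x + y)`
-- does the same; where `p = z` can occur, a product is left, which counts divisors. The regions
-- that arise are cut by linear inequalities, and a substitution has to carry one region exactly
-- onto another. Subtraction would obscure this, so each region is parametrised by natural numbers,
-- the gaps in its inequalities. That a substitution respects the regions is then built into the
-- coordinates, and what remains to check is a polynomial identity over ℕ. Boundary regions are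
-- empty by parity or modulo 4, or are kept as cells of their own.

module ThreeSquares where

  open import Data.Bool using (Bool; T; true; false; if_then_else_; not; _∧_; _xor_)
  open import Data.Bool.Properties using (not-involutive; ∧-zeroʳ)
  open import Data.Nat using (ℕ; zero; suc; _≤_; _<_; z≤n; s≤s; s≤s⁻¹; _≟_)
  open import Data.Nat.Properties using (≤-trans; ≤-refl; ≤-reflexive; m≤m+n; m≤n+m; <-irrefl; <-≤-trans; n≤1+n; m≤n⇒m≤1+n; +-suc)
  import Data.Nat as ℕ
  import Data.Nat.Properties as ℕₚ
  open import Data.Nat.Induction using (<-rec)
  open import Data.Nat.DivMod using (_divMod_; result)
  open import Data.Fin.Patterns using (0F; 1F; 2F; 3F; 4F; 5F; 6F; 7F)
  open import Data.Nat.Tactic.RingSolver using (solve-∀; solve)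
  open import Data.Integer using (ℤ; +_; 0ℤ; 1ℤ; _+_; _*_; -_; _-_)
  import Data.Integer as ℤ
  import Data.Integer.Properties as ℤₚ
  import Data.Integer.Tactic.RingSolver as ℤ-Solver
  open import Data.List using (List; []; _∷_)
  open import Data.Product using (_×_; _,_; ∃; proj₁; proj₂)
  open import Data.Sum using (inj₁; inj₂; [_,_]′)
  open import Data.Unit using (tt)
  open import Data.Empty using (⊥-elim)
  open import Relation.Nullary using (yes; no)
  open import Relation.Binary.PropositionalEquality using (_≡_; _≢_; refl; sym; trans; cong; cong₂; subst; module ≡-Reasoning)
  open ≡-Reasoning

  -- Indicator terms and parity.

  abstract

    at : ℕ → ℕ → ℤ → ℤ
    at N n x = if n ℕ.≡ᵇ N then x else 0ℤ

    at-≢ : ∀ {N n} x → n ≢ N → at N n x ≡ 0ℤ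
    at-≢ {N} {n} x ne with n ℕ.≡ᵇ N in eq
    ... | true  = ⊥-elim (ne (ℕₚ.≡ᵇ⇒≡ n N (subst T (sym eq) tt)))
    ... | false = refl

    at-≡ : ∀ N x → at N N x ≡ x
    at-≡ N x with N ℕ.≡ᵇ N in eq
    ... | true  = refl
    ... | false = ⊥-elim (subst T eq (ℕₚ.≡⇒≡ᵇ N N refl))

    at-scale : ∀ N n c x → at N n (c * x) ≡ c * at N n x
    at-scale N n c x with n ℕ.≡ᵇ N
    ... | true  = refl
    ... | false = sym (ℤₚ.*-zeroʳ c)

    at-mul : ∀ k N n x → at (suc k ℕ.* N) (suc k ℕ.* n) x ≡ at N n x
    at-mul k N n x with n ≟ N
    ... | yes refl = trans (at-≡ (suc k ℕ.* N) x) (sym (at-≡ N x))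
    ... | no ne    = trans (at-≢ x λ e → ne (ℕₚ.*-cancelˡ-≡ n N (suc k) e)) (sym (at-≢ x ne))

  at-const : ∀ N n c → at N n c ≡ c * at N n 1ℤ
  at-const N n c = trans (cong (at N n) (sym (ℤₚ.*-identityʳ c))) (at-scale N n c 1ℤ)

  at-const-0 : ∀ N n → at N n 0ℤ ≡ 0ℤ
  at-const-0 N n = trans (at-const N n 0ℤ) (ℤₚ.*-zeroˡ (at N n 1ℤ))

  -- The values are compared only under `n ≡ N`: parity facts that hold just for solutions of the
  -- equation enter the matching of cells through this premise.
  at-cong : ∀ {N n n′ x y} → n ≡ n′ → (n ≡ N → x ≡ y) → at N n x ≡ at N n′ y
  at-cong {N} {n} {.n} {x} {y} refl e with n ≟ N
  ... | yes p = cong (at N n) (e p)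
  ... | no ¬p = trans (at-≢ x ¬p) (sym (at-≢ y ¬p))

  par : ℕ → Bool
  par zero    = false
  par (suc n) = not (par n)

  par-+ : ∀ a b → par (a ℕ.+ b) ≡ par a xor par b
  par-+ zero    b = refl
  par-+ (suc a) b = trans (cong not (par-+ a b)) (not-xor (par a) (par b))
    where not-xor : ∀ x y → not (x xor y) ≡ not x xor y
          not-xor true  y = not-involutive y
          not-xor false y = refl

  par-* : ∀ a b → par (a ℕ.* b) ≡ par a ∧ par b
  par-* zero    b = refl
  par-* (suc a) b = trans (par-+ b (a ℕ.* b)) (trans (cong (par b xor_) (par-* a b)) (e (par a) (par b)))
    where e : ∀ x y → y xor (x ∧ y) ≡ not x ∧ y
          e true  true  = refl
          e true  false = refl
          e false true  = refl
          e false false = refl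

  par-2* : ∀ k → par (2 ℕ.* k) ≡ false
  par-2* k = par-* 2 k

  par-odd : ∀ k → par (suc (2 ℕ.* k)) ≡ true
  par-odd k = cong not (par-2* k)

  par-2*+ : ∀ k n → par (2 ℕ.* k ℕ.+ n) ≡ par n
  par-2*+ k n = trans (par-+ (2 ℕ.* k) n) (cong (_xor par n) (par-2* k))

  -- Even summands on both sides replace a subtraction, so the ring solver over ℕ can certify any
  -- congruence modulo 2.
  par-≡ : ∀ k l {a b} → 2 ℕ.* k ℕ.+ a ≡ 2 ℕ.* l ℕ.+ b → par a ≡ par b
  par-≡ k l {a} {b} e = trans (sym (par-2*+ k a)) (trans (cong par e) (par-2*+ l b))

  2*suc : ∀ n → 2 ℕ.* suc n ≡ suc (suc (2 ℕ.* n))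
  2*suc = solve-∀

  odd-half : ∀ n → par n ≡ true → ∃ λ k → n ≡ suc (2 ℕ.* k)
  odd-half (suc zero)    _ = 0 , refl
  odd-half (suc (suc n)) p with odd-half n (trans (sym (not-involutive (par n))) p)
  ... | k , refl = suc k , cong suc (sym (2*suc k))

  grow : ∀ {n a b} → n ≤ a → ∀ k → a ℕ.+ k ≡ b → n ≤ b
  grow {a = a} p k e = ≤-trans p (≤-trans (m≤m+n a k) (≤-reflexive e))

  -- Finite sums of integers

  sumTo : ℕ → (ℕ → ℤ) → ℤ
  sumTo zero    f = 0ℤ
  sumTo (suc n) f = sumTo n f + f n

  sumTo-cong : ∀ n {f g : ℕ → ℤ} → (∀ i → f i ≡ g i) → sumTo n f ≡ sumTo n g
  sumTo-cong zero    e = refl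
  sumTo-cong (suc n) e = cong₂ _+_ (sumTo-cong n e) (e n)

  sumTo-0 : ∀ n {f : ℕ → ℤ} → (∀ i → f i ≡ 0ℤ) → sumTo n f ≡ 0ℤ
  sumTo-0 zero    e = refl
  sumTo-0 (suc n) e = cong₂ _+_ (sumTo-0 n e) (e n)

  interchange : ∀ (a b c d : ℤ) → (a + b) + (c + d) ≡ (a + c) + (b + d)
  interchange = ℤ-Solver.solve-∀

  cancelʳ : ∀ {a b} (c : ℤ) → a + c ≡ b + c → a ≡ b
  cancelʳ {a} {b} c p = trans (sym (undo a c)) (trans (cong (_- c) p) (undo b c))
    where undo : ∀ (a c : ℤ) → a + c - c ≡ a
          undo = ℤ-Solver.solve-∀

  sumTo-+ : ∀ n (f g : ℕ → ℤ) → sumTo n (λ i → f i + g i) ≡ sumTo n f + sumTo n g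
  sumTo-+ zero    f g = refl
  sumTo-+ (suc n) f g = trans (cong (_+ (f n + g n)) (sumTo-+ n f g)) (interchange (sumTo n f) (sumTo n g) (f n) (g n))

  sumTo-*ˡ : ∀ n (c : ℤ) (f : ℕ → ℤ) → sumTo n (λ i → c * f i) ≡ c * sumTo n f
  sumTo-*ˡ zero    c f = sym (ℤₚ.*-zeroʳ c)
  sumTo-*ˡ (suc n) c f = trans (cong (_+ c * f n) (sumTo-*ˡ n c f)) (sym (ℤₚ.*-distribˡ-+ c (sumTo n f) (f n)))

  sumTo-swap : ∀ n k (f : ℕ → ℕ → ℤ) →
               sumTo n (λ i → sumTo k (f i)) ≡ sumTo k (λ j → sumTo n (λ i → f i j))
  sumTo-swap zero    k f = sym (sumTo-0 k (λ _ → refl))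
  sumTo-swap (suc n) k f =
    trans (cong (_+ sumTo k (f n)) (sumTo-swap n k f)) (sym (sumTo-+ k (λ j → sumTo n (λ i → f i j)) (f n)))

  sumTo-suc : ∀ n (f : ℕ → ℤ) → sumTo (suc n) f ≡ f 0 + sumTo n (λ i → f (suc i))
  sumTo-suc zero    f = ℤₚ.+-comm 0ℤ (f 0)
  sumTo-suc (suc n) f = trans (cong (_+ f (suc n)) (sumTo-suc n f)) (ℤₚ.+-assoc (f 0) _ _)

  sumTo-tail : ∀ n k {f : ℕ → ℤ} → (∀ i → n ≤ i → f i ≡ 0ℤ) → sumTo (k ℕ.+ n) f ≡ sumTo n f
  sumTo-tail n zero    v = refl
  sumTo-tail n (suc k) v = trans (cong₂ _+_ (sumTo-tail n k v) (v (k ℕ.+ n) (m≤n+m n k))) (ℤₚ.+-identityʳ _)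

  sumTo-parity : ∀ n (f : ℕ → ℤ) →
    sumTo (2 ℕ.* n) f ≡ sumTo n (λ i → f (2 ℕ.* i)) + sumTo n (λ i → f (suc (2 ℕ.* i)))
  sumTo-parity zero    f = refl
  sumTo-parity (suc n) f = begin
    sumTo (2 ℕ.* suc n) f
      ≡⟨ cong (λ k → sumTo k f) (2*suc n) ⟩
    sumTo (2 ℕ.* n) f + f (2 ℕ.* n) + f (suc (2 ℕ.* n))
      ≡⟨ cong (λ s → s + f (2 ℕ.* n) + f (suc (2 ℕ.* n))) (sumTo-parity n f) ⟩
    (E + O) + f (2 ℕ.* n) + f (suc (2 ℕ.* n))
      ≡⟨ ℤₚ.+-assoc (E + O) _ _ ⟩
    (E + O) + (f (2 ℕ.* n) + f (suc (2 ℕ.* n)))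
      ≡⟨ interchange E O _ _ ⟩
    (E + f (2 ℕ.* n)) + (O + f (suc (2 ℕ.* n))) ∎
    where
    E = sumTo n (λ i → f (2 ℕ.* i))
    O = sumTo n (λ i → f (suc (2 ℕ.* i)))

  -- Recursion on both arguments makes a common `suc` cancel by computation, which drives the
  -- inductions in `Σ-shift` and `⟦≤⟧-total`.
  ⟦_≤_⟧_ : ℕ → ℕ → ℤ → ℤ
  ⟦ zero  ≤ i ⟧     x = x
  ⟦ suc n ≤ zero ⟧  x = 0ℤ
  ⟦ suc n ≤ suc i ⟧ x = ⟦ n ≤ i ⟧ x

  ⟦≤⟧-0 : ∀ n i → ⟦ n ≤ i ⟧ 0ℤ ≡ 0ℤ
  ⟦≤⟧-0 zero    i       = refl
  ⟦≤⟧-0 (suc n) zero    = refl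
  ⟦≤⟧-0 (suc n) (suc i) = ⟦≤⟧-0 n i

  ⟦≤⟧-total : ∀ i j x → x ≡ ⟦ j ≤ i ⟧ x + ⟦ suc i ≤ j ⟧ x
  ⟦≤⟧-total i       zero    x = sym (ℤₚ.+-identityʳ x)
  ⟦≤⟧-total zero    (suc j) x = sym (ℤₚ.+-identityˡ x)
  ⟦≤⟧-total (suc i) (suc j) x = ⟦≤⟧-total i j x

  ⟦=0⟧ : ℕ → ℤ → ℤ
  ⟦=0⟧ zero    x = x
  ⟦=0⟧ (suc _) x = 0ℤ

  data Swap : Set where
    ₁ ₂ ₃ : Swap

  -- Sums over the finitely supported functions on ℕ and ℕ⁴

  sumTo-⟦=0⟧ : ∀ {n} → 0 < n → (f : ℕ → ℤ) → sumTo n (λ i → ⟦=0⟧ i (f 0)) ≡ f 0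
  sumTo-⟦=0⟧ {suc n} _ f = begin
    sumTo (suc n) (λ i → ⟦=0⟧ i (f 0)) ≡⟨ sumTo-suc n _ ⟩
    f 0 + sumTo n (λ _ → 0ℤ)           ≡⟨ cong (λ s → f 0 + s) (sumTo-0 n λ _ → refl) ⟩
    f 0 + 0ℤ                           ≡⟨ ℤₚ.+-identityʳ (f 0) ⟩
    f 0                                ∎

  module Sums (B : ℕ) (0<B : 0 < B) where

    Σ : (ℕ → ℤ) → ℤ
    Σ = sumTo B

    Vanish : (ℕ → ℤ) → Set
    Vanish f = ∀ i → B ≤ i → f i ≡ 0ℤ

    Σ-suc : ∀ {f} → Vanish f → Σ f ≡ f 0 + Σ (λ i → f (suc i))
    Σ-suc {f} v = begin
      Σ f                            ≡⟨ sym (sumTo-tail B 1 v) ⟩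
      sumTo (suc B) f                ≡⟨ sumTo-suc B f ⟩
      f 0 + Σ (λ i → f (suc i))      ∎

    Σ-parity : ∀ {f} → Vanish f → Σ f ≡ Σ (λ i → f (2 ℕ.* i)) + Σ (λ i → f (suc (2 ℕ.* i)))
    Σ-parity {f} v = begin
      Σ f                  ≡⟨ sym (sumTo-tail B (B ℕ.+ 0) v) ⟩
      sumTo ((B ℕ.+ 0) ℕ.+ B) f ≡⟨ cong (λ k → sumTo k f) (ℕₚ.+-comm (B ℕ.+ 0) B) ⟩
      sumTo (2 ℕ.* B) f    ≡⟨ sumTo-parity B f ⟩
      _                    ∎

    Σ-shift : ∀ j {f} → Vanish f → Σ (λ i → ⟦ j ≤ i ⟧ f i) ≡ Σ (λ i → f (j ℕ.+ i))
    Σ-shift zero        v = refl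
    Σ-shift (suc j) {f} v = begin
      Σ (λ i → ⟦ suc j ≤ i ⟧ f i)
        ≡⟨ Σ-suc (λ i p → trans (cong (⟦ suc j ≤ i ⟧_) (v i p)) (⟦≤⟧-0 (suc j) i)) ⟩
      0ℤ + Σ (λ i → ⟦ j ≤ i ⟧ f (suc i))
        ≡⟨ ℤₚ.+-identityˡ _ ⟩
      Σ (λ i → ⟦ j ≤ i ⟧ f (suc i))
        ≡⟨ Σ-shift j (λ i p → v (suc i) (m≤n⇒m≤1+n p)) ⟩
      Σ (λ i → f (suc (j ℕ.+ i))) ∎

    -- The quadrant is cut along its diagonal. Each half is described by the gap, `x − y` or
    -- `y − x − 1`, and so becomes a full quadrant again.
    Σ-split : (g : ℕ → ℕ → ℤ) → (∀ y → Vanish (λ x → g x y)) → (∀ x → Vanish (g x)) →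
              Σ (λ x → Σ (g x)) ≡ Σ (λ x → Σ (λ y → g (y ℕ.+ x) y)) + Σ (λ x → Σ (λ y → g x (suc x ℕ.+ y)))
    Σ-split g v₁ v₂ = begin
      Σ (λ x → Σ (g x))
        ≡⟨ sumTo-cong B (λ x → trans (sumTo-cong B (λ y → ⟦≤⟧-total x y (g x y))) (sumTo-+ B _ _)) ⟩
      Σ (λ x → Σ (λ y → ⟦ y ≤ x ⟧ g x y) + Σ (λ y → ⟦ suc x ≤ y ⟧ g x y))
        ≡⟨ sumTo-+ B _ _ ⟩
      Σ (λ x → Σ (λ y → ⟦ y ≤ x ⟧ g x y)) + Σ (λ x → Σ (λ y → ⟦ suc x ≤ y ⟧ g x y))
        ≡⟨ cong₂ _+_ (sumTo-swap B B _) (sumTo-cong B (λ x → Σ-shift (suc x) (v₂ x))) ⟩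
      Σ (λ y → Σ (λ x → ⟦ y ≤ x ⟧ g x y)) + Σ (λ x → Σ (λ y → g x (suc x ℕ.+ y)))
        ≡⟨ cong₂ _+_ (sumTo-cong B (λ y → Σ-shift y (v₁ y))) refl ⟩
      Σ (λ y → Σ (λ x → g (y ℕ.+ x) y)) + Σ (λ x → Σ (λ y → g x (suc x ℕ.+ y)))
        ≡⟨ cong₂ _+_ (sumTo-swap B B _) refl ⟩
      Σ (λ x → Σ (λ y → g (y ℕ.+ x) y)) + Σ (λ x → Σ (λ y → g x (suc x ℕ.+ y))) ∎

    Fun : Set
    Fun = ℕ → ℕ → ℕ → ℕ → ℤ

    -- The support is bounded through the sum of the coordinates because this sum never decreases
    -- under the substitutions below; every piece of a cell is therefore again a cell.
    record Cell : Set where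
      constructor _,_
      field
        fn  : Fun
        sup : ∀ x y z t → B ≤ x ℕ.+ y ℕ.+ z ℕ.+ t → fn x y z t ≡ 0ℤ
    open Cell public

    ΣΣ : Fun → ℤ
    ΣΣ f = Σ (λ x → Σ (λ y → Σ (λ z → Σ (λ t → f x y z t))))

    S : Cell → ℤ
    S C = ΣΣ (fn C)

    S-cong : ∀ C D → (∀ x y z t → fn C x y z t ≡ fn D x y z t) → S C ≡ S D
    S-cong C D e = sumTo-cong B λ x → sumTo-cong B λ y → sumTo-cong B λ z → sumTo-cong B λ t → e x y z t

    S-cong′ : ∀ C {f} → (∀ x y z t → fn C x y z t ≡ f x y z t) → S C ≡ ΣΣ f
    S-cong′ C e = sumTo-cong B λ x → sumTo-cong B λ y → sumTo-cong B λ z → sumTo-cong B λ t → e x y z t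

    S-0 : ∀ C → (∀ x y z t → fn C x y z t ≡ 0ℤ) → S C ≡ 0ℤ
    S-0 C e = sumTo-0 B λ x → sumTo-0 B λ y → sumTo-0 B λ z → sumTo-0 B λ t → e x y z t

    -- The pieces of a cell, in fresh coordinates: `ge` is the half `x ≥ y` with `x − y` as first
    -- coordinate, `lt` the half `x < y` with `y − x − 1` as second one. `ze` keeps a coordinate
    -- pinned at 0, so that all cells have four variables and can be cut further by the same
    -- operations.
    s₁ s₂ s₃ ge lt ze su ev od : Cell → Cell
    s₁ (f , v) = (λ x y z t → f y x z t) , λ x y z t p → v y x z t (subst (B ≤_) (e x y z t) p)
      where e : ∀ x y z t → x ℕ.+ y ℕ.+ z ℕ.+ t ≡ y ℕ.+ x ℕ.+ z ℕ.+ t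
            e = solve-∀
    s₂ (f , v) = (λ x y z t → f x z y t) , λ x y z t p → v x z y t (subst (B ≤_) (e x y z t) p)
      where e : ∀ x y z t → x ℕ.+ y ℕ.+ z ℕ.+ t ≡ x ℕ.+ z ℕ.+ y ℕ.+ t
            e = solve-∀
    s₃ (f , v) = (λ x y z t → f x y t z) , λ x y z t p → v x y t z (subst (B ≤_) (e x y z t) p)
      where e : ∀ x y z t → x ℕ.+ y ℕ.+ z ℕ.+ t ≡ x ℕ.+ y ℕ.+ t ℕ.+ z
            e = solve-∀
    ge (f , v) = (λ x y z t → f (y ℕ.+ x) y z t) ,
                 λ x y z t p → v (y ℕ.+ x) y z t (subst (B ≤_) (e x y z t) (≤-trans p (m≤n+m _ y)))
      where e : ∀ x y z t → y ℕ.+ (x ℕ.+ y ℕ.+ z ℕ.+ t) ≡ (y ℕ.+ x) ℕ.+ y ℕ.+ z ℕ.+ t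
            e = solve-∀
    lt (f , v) = (λ x y z t → f x (suc x ℕ.+ y) z t) ,
                 λ x y z t p → v x (suc x ℕ.+ y) z t (subst (B ≤_) (e x y z t) (≤-trans p (m≤n+m _ (suc x))))
      where e : ∀ x y z t → suc x ℕ.+ (x ℕ.+ y ℕ.+ z ℕ.+ t) ≡ x ℕ.+ (suc x ℕ.+ y) ℕ.+ z ℕ.+ t
            e = solve-∀
    ze (f , v) = (λ x y z t → ⟦=0⟧ x (f 0 y z t)) , λ { zero y z t p → v 0 y z t p ; (suc x) y z t p → refl }
    su (f , v) = (λ x y z t → f (suc x) y z t) , λ x y z t p → v (suc x) y z t (m≤n⇒m≤1+n p)
    ev (f , v) = (λ x y z t → f (2 ℕ.* x) y z t) ,
                 λ x y z t p → v (2 ℕ.* x) y z t (subst (B ≤_) (e x y z t) (≤-trans p (m≤n+m _ x)))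
      where e : ∀ x y z t → x ℕ.+ (x ℕ.+ y ℕ.+ z ℕ.+ t) ≡ 2 ℕ.* x ℕ.+ y ℕ.+ z ℕ.+ t
            e = solve-∀
    od (f , v) = (λ x y z t → f (suc (2 ℕ.* x)) y z t) ,
                 λ x y z t p → v (suc (2 ℕ.* x)) y z t (subst (B ≤_) (e x y z t) (≤-trans p (m≤n+m _ (suc x))))
      where e : ∀ x y z t → suc x ℕ.+ (x ℕ.+ y ℕ.+ z ℕ.+ t) ≡ suc (2 ℕ.* x) ℕ.+ y ℕ.+ z ℕ.+ t
            e = solve-∀

    S-s₁ : ∀ C → S (s₁ C) ≡ S C
    S-s₁ C = sumTo-swap B B _

    S-s₂ : ∀ C → S (s₂ C) ≡ S C
    S-s₂ C = sumTo-cong B λ x → sumTo-swap B B _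

    S-s₃ : ∀ C → S (s₃ C) ≡ S C
    S-s₃ C = sumTo-cong B λ x → sumTo-cong B λ y → sumTo-swap B B _

    private
      v₁ : ∀ C y z t → Vanish (λ x → fn C x y z t)
      v₁ C y z t x p = sup C x y z t (≤-trans p (≤-trans (m≤m+n x (y ℕ.+ z ℕ.+ t)) (≤-reflexive (e x y z t))))
        where e : ∀ x y z t → x ℕ.+ (y ℕ.+ z ℕ.+ t) ≡ x ℕ.+ y ℕ.+ z ℕ.+ t
              e = solve-∀
      v₂ : ∀ C x z t → Vanish (λ y → fn C x y z t)
      v₂ C x z t y p = sup C x y z t (≤-trans p (≤-trans (m≤m+n y (x ℕ.+ z ℕ.+ t)) (≤-reflexive (e x y z t))))
        where e : ∀ x y z t → y ℕ.+ (x ℕ.+ z ℕ.+ t) ≡ x ℕ.+ y ℕ.+ z ℕ.+ t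
              e = solve-∀
      inner-0 : ∀ {g : ℕ → ℕ → ℤ} → (∀ z t → g z t ≡ 0ℤ) → Σ (λ z → Σ (λ t → g z t)) ≡ 0ℤ
      inner-0 e = sumTo-0 B λ z → sumTo-0 B λ t → e z t

    S-≥< : ∀ C → S C ≡ S (ge C) + S (lt C)
    S-≥< C = Σ-split (λ x y → Σ (λ z → Σ (λ t → fn C x y z t)))
               (λ y x p → inner-0 λ z t → v₁ C y z t x p) (λ x y p → inner-0 λ z t → v₂ C x z t y p)

    S-zs : ∀ C → S C ≡ S (ze C) + S (su C)
    S-zs C = begin
      S C ≡⟨ Σ-suc (λ x p → sumTo-0 B λ y → inner-0 λ z t → v₁ C y z t x p) ⟩
      g 0 + S (su C) ≡⟨ cong (_+ S (su C)) (sym S-ze) ⟩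
      S (ze C) + S (su C) ∎
      where
      g : ℕ → ℤ
      g x = Σ (λ y → Σ (λ z → Σ (λ t → fn C x y z t)))
      inside : ∀ x → Σ (λ y → Σ (λ z → Σ (λ t → ⟦=0⟧ x (fn C 0 y z t)))) ≡ ⟦=0⟧ x (g 0)
      inside zero    = refl
      inside (suc x) = sumTo-0 B λ y → inner-0 λ z t → refl
      S-ze : S (ze C) ≡ g 0
      S-ze = trans (sumTo-cong B inside) (sumTo-⟦=0⟧ 0<B g)

    S-eo : ∀ C → S C ≡ S (ev C) + S (od C)
    S-eo C = Σ-parity (λ x p → sumTo-0 B λ y → inner-0 λ z t → v₁ C y z t x p)

    swap : List Swap → Fun → Fun
    swap []       f         = f
    swap (₁ ∷ ks) f x y z t = swap ks f y x z t
    swap (₂ ∷ ks) f x y z t = swap ks f x z y t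
    swap (₃ ∷ ks) f x y z t = swap ks f x y t z

    ΣΣ-swap : ∀ ks f → ΣΣ (swap ks f) ≡ ΣΣ f
    ΣΣ-swap []       f = refl
    ΣΣ-swap (₁ ∷ ks) f = trans (sumTo-swap B B _) (ΣΣ-swap ks f)
    ΣΣ-swap (₂ ∷ ks) f = trans (sumTo-cong B λ x → sumTo-swap B B _) (ΣΣ-swap ks f)
    ΣΣ-swap (₃ ∷ ks) f = trans (sumTo-cong B λ x → sumTo-cong B λ y → sumTo-swap B B _) (ΣΣ-swap ks f)

    perm : List Swap → Cell → Cell
    perm []       C = C
    perm (₁ ∷ ks) C = s₁ (perm ks C)
    perm (₂ ∷ ks) C = s₂ (perm ks C)
    perm (₃ ∷ ks) C = s₃ (perm ks C)

    S-perm : ∀ ks C → S (perm ks C) ≡ S C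
    S-perm []       C = refl
    S-perm (₁ ∷ ks) C = trans (S-s₁ (perm ks C)) (S-perm ks C)
    S-perm (₂ ∷ ks) C = trans (S-s₂ (perm ks C)) (S-perm ks C)
    S-perm (₃ ∷ ks) C = trans (S-s₃ (perm ks C)) (S-perm ks C)

    split : ∀ ks C → S C ≡ S (ge (perm ks C)) + S (lt (perm ks C))
    split ks C = trans (sym (S-perm ks C)) (S-≥< (perm ks C))

    zero-suc : ∀ ks C → S C ≡ S (ze (perm ks C)) + S (su (perm ks C))
    zero-suc ks C = trans (sym (S-perm ks C)) (S-zs (perm ks C))

    even-odd : ∀ ks C → S C ≡ S (ev (perm ks C)) + S (od (perm ks C))
    even-odd ks C = trans (sym (S-perm ks C)) (S-eo (perm ks C))

    only-even : ∀ ks C → (∀ x y z t → fn (od (perm ks C)) x y z t ≡ 0ℤ) → S C ≡ S (ev (perm ks C))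
    only-even ks C e = trans (even-odd ks C)
      (trans (cong (λ s → S (ev (perm ks C)) + s) (S-0 (od (perm ks C)) e)) (ℤₚ.+-identityʳ _))

    only-odd : ∀ ks C → (∀ x y z t → fn (ev (perm ks C)) x y z t ≡ 0ℤ) → S C ≡ S (od (perm ks C))
    only-odd ks C e = trans (even-odd ks C)
      (trans (cong (_+ S (od (perm ks C))) (S-0 (ev (perm ks C)) e)) (ℤₚ.+-identityˡ _))

    match : ∀ ks C D → (∀ x y z t → fn C x y z t ≡ fn (perm ks D) x y z t) → S C ≡ S D
    match ks C D e = trans (S-cong C (perm ks D) e) (S-perm ks D)

    ΣΣ-match : ∀ ks f g → (∀ x y z t → f x y z t ≡ swap ks g x y z t) → ΣΣ f ≡ ΣΣ g
    ΣΣ-match ks f g e =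
      trans (sumTo-cong B λ x → sumTo-cong B λ y → sumTo-cong B λ z → sumTo-cong B λ t → e x y z t) (ΣΣ-swap ks g)

    fit : ∀ ks C f → (∀ x y z t → fn C x y z t ≡ swap ks f x y z t) → S C ≡ ΣΣ f
    fit ks C f = ΣΣ-match ks (fn C) f

    S-scale : ∀ ks C D c → (∀ x y z t → fn C x y z t ≡ c * fn (perm ks D) x y z t) → S C ≡ c * S D
    S-scale ks C D c e = trans
      (trans (sumTo-cong B λ x → trans (sumTo-cong B λ y → trans (sumTo-cong B λ z → trans (sumTo-cong B λ t → e x y z t)
        (sumTo-*ˡ B c _)) (sumTo-*ˡ B c _)) (sumTo-*ˡ B c _)) (sumTo-*ˡ B c _))
      (cong (c *_) (S-perm ks D))

    -- A sum in three variables becomes a sum in four with one of them held at 0, and is then open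
    -- to the same cutting and matching.
    S-dummy : ∀ (f : ℕ → ℕ → ℕ → ℤ) → ΣΣ (λ d x y z → ⟦=0⟧ d (f x y z)) ≡ Σ (λ x → Σ (λ y → Σ (λ z → f x y z)))
    S-dummy f = trans (sumTo-cong B inside) (sumTo-⟦=0⟧ 0<B λ _ → Σ (λ x → Σ (λ y → Σ (λ z → f x y z))))
      where
      inside : ∀ d → Σ (λ x → Σ (λ y → Σ (λ z → ⟦=0⟧ d (f x y z)))) ≡ ⟦=0⟧ d (Σ (λ x → Σ (λ y → Σ (λ z → f x y z))))
      inside zero    = refl
      inside (suc d) = sumTo-0 B λ x → sumTo-0 B λ y → sumTo-0 B λ z → refl

    S-dummy₂ : ∀ (f : ℕ → ℕ → ℤ) → ΣΣ (λ d d′ y z → ⟦=0⟧ d (⟦=0⟧ d′ (f y z))) ≡ Σ (λ y → Σ (λ z → f y z))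
    S-dummy₂ f = trans (S-dummy λ d y z → ⟦=0⟧ d (f y z))
      (trans (sumTo-cong B inside) (sumTo-⟦=0⟧ 0<B λ _ → Σ (λ y → Σ (λ z → f y z))))
      where
      inside : ∀ d → Σ (λ y → Σ (λ z → ⟦=0⟧ d (f y z))) ≡ ⟦=0⟧ d (Σ (λ y → Σ (λ z → f y z)))
      inside zero    = refl
      inside (suc d) = sumTo-0 B λ y → sumTo-0 B λ z → refl

    private
      count : ∀ n e c → e ≤ n → sumTo n (λ x → ⟦ suc x ≤ e ⟧ c) ≡ + e * c
      count n       zero    c p       = trans (sumTo-0 n λ _ → refl) (sym (ℤₚ.*-zeroˡ c))
      count (suc n) (suc e) c (s≤s p) = begin
        sumTo (suc n) (λ x → ⟦ suc x ≤ suc e ⟧ c)     ≡⟨ sumTo-suc n _ ⟩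
        c + sumTo n (λ x → ⟦ suc x ≤ e ⟧ c)           ≡⟨ cong (λ s → c + s) (count n e c p) ⟩
        c + + e * c                                   ≡⟨ sym (ℤₚ.suc-* (+ e) c) ⟩
        + suc e * c                                   ∎

    -- The factor `e` is the number of `x` with `suc x ≤ e`. Spending it on an extra variable turns
    -- a weighted sum into a plain count, which can be cut into cells.
    Σ-weight : ∀ {f} → Vanish f → Σ (λ e → + e * f e) ≡ Σ (λ v → Σ (λ x → f (v ℕ.+ suc x)))
    Σ-weight {f} v = begin
      Σ (λ e → + e * f e)                       ≡⟨ sumTo-cong B pointwise ⟩
      Σ (λ e → Σ (λ x → ⟦ suc x ≤ e ⟧ f e))     ≡⟨ sumTo-swap B B _ ⟩
      Σ (λ x → Σ (λ e → ⟦ suc x ≤ e ⟧ f e))     ≡⟨ sumTo-cong B (λ x → Σ-shift (suc x) v) ⟩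
      Σ (λ x → Σ (λ e → f (suc x ℕ.+ e)))       ≡⟨ sumTo-swap B B _ ⟩
      Σ (λ e → Σ (λ x → f (suc x ℕ.+ e)))       ≡⟨ sumTo-cong B (λ e → sumTo-cong B λ x → cong f (ℕₚ.+-comm (suc x) e)) ⟩
      Σ (λ e → Σ (λ x → f (e ℕ.+ suc x)))       ∎
      where
      pointwise : ∀ e → + e * f e ≡ Σ (λ x → ⟦ suc x ≤ e ⟧ f e)
      pointwise e with ℕₚ.≤-total e B
      ... | inj₁ e≤B = sym (count B e (f e) e≤B)
      ... | inj₂ B≤e = trans (cong (λ y → + e * y) (v e B≤e)) (trans (ℤₚ.*-zeroʳ (+ e))
        (sym (sumTo-0 B λ x → trans (cong (⟦ suc x ≤ e ⟧_) (v e B≤e)) (⟦≤⟧-0 (suc x) e))))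

    Σ-weight⁺ : ∀ {f} → Vanish f → Σ (λ e → + suc e * f e) ≡ Σ (λ l → Σ (λ j → f (l ℕ.+ j)))
    Σ-weight⁺ {f} v = begin
      Σ (λ e → + suc e * f e)                                        ≡⟨ sumTo-cong B (λ e → ℤₚ.suc-* (+ e) (f e)) ⟩
      Σ (λ e → f e + + e * f e)                                      ≡⟨ sumTo-+ B _ _ ⟩
      Σ f + Σ (λ e → + e * f e)                                      ≡⟨ cong (λ s → Σ f + s) (Σ-weight v) ⟩
      Σ f + Σ (λ l → Σ (λ j → f (l ℕ.+ suc j)))                      ≡⟨ sym (sumTo-+ B _ _) ⟩
      Σ (λ l → f l + Σ (λ j → f (l ℕ.+ suc j)))                      ≡⟨ sumTo-cong B (λ l → sym (first l)) ⟩
      Σ (λ l → Σ (λ j → f (l ℕ.+ j)))                                ∎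
      where
      first : ∀ l → Σ (λ j → f (l ℕ.+ j)) ≡ f l + Σ (λ j → f (l ℕ.+ suc j))
      first l = trans (Σ-suc λ j p → v (l ℕ.+ j) (≤-trans p (m≤n+m j l))) (cong (λ n → f n + Σ (λ j → f (l ℕ.+ suc j))) (ℕₚ.+-identityʳ l))

  -- Terms restricted to odd arguments.

  true≢false : true ≢ false
  true≢false ()

  ∧-true : ∀ x y → x ∧ y ≡ true → x ≡ true × y ≡ true
  ∧-true true true e = refl , refl

  abstract
    odd-only : ℕ → ℤ → ℤ
    odd-only n x = if par n then x else 0ℤ

    odd-only-0 : ∀ n {x} → x ≡ 0ℤ → odd-only n x ≡ 0ℤ
    odd-only-0 n refl with par n
    ... | true  = refl
    ... | false = refl

    odd-only-even : ∀ n k {x} → n ≡ 2 ℕ.* k → odd-only n x ≡ 0ℤ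
    odd-only-even n k e rewrite e | par-2* k = refl

    odd-only-odd : ∀ k {x} → odd-only (suc (2 ℕ.* k)) x ≡ x
    odd-only-odd k rewrite par-2* k = refl

    odd-only-odd′ : ∀ {n} k {x} → n ≡ suc (2 ℕ.* k) → odd-only n x ≡ x
    odd-only-odd′ k refl = odd-only-odd k

    odd-only-true : ∀ n {x} → (par n ≡ true → x ≡ 0ℤ) → odd-only n x ≡ 0ℤ
    odd-only-true n e with par n
    ... | true  = e refl
    ... | false = refl

    odd-only-twice : ∀ n n′ k {x} → n′ ≡ 2 ℕ.* k ℕ.+ n → odd-only n (odd-only n′ x) ≡ odd-only n x
    odd-only-twice n n′ k e rewrite e | par-2*+ k n with par n
    ... | true  = refl
    ... | false = refl

    odd-only-clash : ∀ n n′ k {x} → n′ ≡ 2 ℕ.* k ℕ.+ suc n → odd-only n (odd-only n′ x) ≡ 0ℤ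
    odd-only-clash n n′ k e rewrite e | par-2*+ k (suc n) with par n
    ... | true  = refl
    ... | false = refl

    odd-only-comm : ∀ n n′ {x} → odd-only n (odd-only n′ x) ≡ odd-only n′ (odd-only n x)
    odd-only-comm n n′ with par n | par n′
    ... | true  | true  = refl
    ... | true  | false = refl
    ... | false | true  = refl
    ... | false | false = refl

  -- The equations 2XY + VW = m and ac + uw = 2m, weighted by a parity class.

  module QForm (m : ℕ) (m-odd : par m ≡ true) (B : ℕ) (0<B : 0 < B) (2m<B : 2 ℕ.* m < B) where

    open Sums B 0<B

    m<B : m < B
    m<B = ℕₚ.≤-<-trans (m≤m+n m _) 2m<B

    private
      VW-odd : ∀ X Y V W → 2 ℕ.* X ℕ.* Y ℕ.+ V ℕ.* W ≡ m → par V ≡ true × par W ≡ true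
      VW-odd X Y V W e = ∧-true (par V) (par W) (trans (sym (par-* V W)) (trans (sym even-part) (trans (cong par e) m-odd)))
        where
        even-part : par (2 ℕ.* X ℕ.* Y ℕ.+ V ℕ.* W) ≡ par (V ℕ.* W)
        even-part = par-≡ 0 (X ℕ.* Y) {2 ℕ.* X ℕ.* Y ℕ.+ V ℕ.* W} {V ℕ.* W} (solve (X ∷ Y ∷ V ∷ W ∷ []))

    abstract
      -- The weight `h` stays free because some substitutions flip the parity of `X + Y`; in the end
      -- it is specialised to the indicators of the two classes.
      q : (Bool → ℤ) → ℕ → ℕ → ℕ → ℕ → ℤ
      q h X Y V W = at m (2 ℕ.* X ℕ.* Y ℕ.+ V ℕ.* W) (h (par (X ℕ.+ Y)))

      q-even : ∀ h X Y V W k → V ≡ 2 ℕ.* k → q h X Y V W ≡ 0ℤ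
      q-even h X Y V W k v = at-≢ _ λ e →
        true≢false (trans (sym (proj₁ (VW-odd X Y V W e))) (trans (cong par v) (par-2* k)))

      q-large : ∀ h x y v w → m < x ℕ.+ y ℕ.+ v ℕ.+ w → q h (suc x) (suc y) (suc v) (suc w) ≡ 0ℤ
      q-large h x y v w p = at-≢ _ λ e →
        <-irrefl (sym e) (<-≤-trans p (≤-trans (m≤m+n _ _) (≤-reflexive (bound x y v w))))
        where
        bound : ∀ x y v w → (x ℕ.+ y ℕ.+ v ℕ.+ w) ℕ.+ (3 ℕ.+ x ℕ.+ y ℕ.+ 2 ℕ.* x ℕ.* y ℕ.+ v ℕ.* w)
                          ≡ 2 ℕ.* suc x ℕ.* suc y ℕ.+ suc v ℕ.* suc w
        bound = solve-∀

      q-cong : ∀ {h h′ X Y V W X′ Y′ V′ W′} →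
               2 ℕ.* X ℕ.* Y ℕ.+ V ℕ.* W ≡ 2 ℕ.* X′ ℕ.* Y′ ℕ.+ V′ ℕ.* W′ →
               (par V ≡ true → par W ≡ true → h (par (X ℕ.+ Y)) ≡ h′ (par (X′ ℕ.+ Y′))) →
               q h X Y V W ≡ q h′ X′ Y′ V′ W′
      q-cong {X = X} {Y} {V} {W} e c = at-cong e λ e′ → c (proj₁ (VW-odd X Y V W e′)) (proj₂ (VW-odd X Y V W e′))

    q-same : ∀ {h X Y V W X′ Y′ V′ W′} k l →
             2 ℕ.* X ℕ.* Y ℕ.+ V ℕ.* W ≡ 2 ℕ.* X′ ℕ.* Y′ ℕ.+ V′ ℕ.* W′ →
             2 ℕ.* k ℕ.+ (X ℕ.+ Y) ≡ 2 ℕ.* l ℕ.+ (X′ ℕ.+ Y′) →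
             q h X Y V W ≡ q h X′ Y′ V′ W′
    q-same {h} {X} {Y} {X′ = X′} {Y′} k l e p = q-cong e λ _ _ → cong h (par-≡ k l {X ℕ.+ Y} {X′ ℕ.+ Y′} p)

    abstract
      -- The class is passed as a separate argument `k`, since it is the parity of `(u − w)/2`,
      -- which is no polynomial in the other arguments.
      o : (Bool → ℤ) → ℕ → ℕ → ℕ → ℕ → ℕ → ℤ
      o h a c u w k = at (2 ℕ.* m) (a ℕ.* c ℕ.+ u ℕ.* w) (h (par k))

      o-large : ∀ h a c u w k n → n ≤ a ℕ.* c ℕ.+ u ℕ.* w → B ≤ n → o h a c u w k ≡ 0ℤ
      o-large h a c u w k n p p′ = at-≢ _ λ e → <-irrefl (sym e) (<-≤-trans 2m<B (≤-trans p′ p))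

      -- This empties boundary cells: on `u = a + c + w`, for instance, `ac + uw = (a + w)(c + w)`
      -- is a product of two even numbers, while `2m` is 2 modulo 4.
      o-4 : ∀ h a c u w k n → a ℕ.* c ℕ.+ u ℕ.* w ≡ 4 ℕ.* n → o h a c u w k ≡ 0ℤ
      o-4 h a c u w k n e = at-≢ _ λ e′ → true≢false (trans (sym m-odd) (trans (cong par
        (ℕₚ.*-cancelˡ-≡ m (2 ℕ.* n) 2 (trans (sym e′) (trans e (ℕₚ.*-assoc 2 2 n))))) (par-2* n)))

      o-cong : ∀ {h a c u w k a′ c′ u′ w′ k′} i j → a ℕ.* c ℕ.+ u ℕ.* w ≡ a′ ℕ.* c′ ℕ.+ u′ ℕ.* w′ →
               2 ℕ.* i ℕ.+ k ≡ 2 ℕ.* j ℕ.+ k′ → o h a c u w k ≡ o h a′ c′ u′ w′ k′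
      o-cong {h} {k = k} {k′ = k′} i j e p = at-cong e λ _ → cong h (par-≡ i j {k} {k′} p)

      -- Half of `ac + uw` is `2(αγ + μω) + α + γ + μ + ω + 1`. It equals the odd `m`, so `α + γ`
      -- and `μ + ω` have the same parity and exchanging the two products preserves the class.
      o-pair : ∀ h α γ μ ω → o h (suc (2 ℕ.* α)) (suc (2 ℕ.* γ)) (suc (2 ℕ.* μ)) (suc (2 ℕ.* ω)) (μ ℕ.+ ω)
                           ≡ o h (suc (2 ℕ.* μ)) (suc (2 ℕ.* ω)) (suc (2 ℕ.* α)) (suc (2 ℕ.* γ)) (α ℕ.+ γ)
      o-pair h α γ μ ω = at-cong (ℕₚ.+-comm (suc (2 ℕ.* α) ℕ.* suc (2 ℕ.* γ)) _) λ e → cong h (same (par (α ℕ.+ γ)) (par (μ ℕ.+ ω)) (begin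
          not (par (α ℕ.+ γ) xor par (μ ℕ.+ ω))     ≡⟨ cong not (sym (par-+ (α ℕ.+ γ) (μ ℕ.+ ω))) ⟩
          par (suc ((α ℕ.+ γ) ℕ.+ (μ ℕ.+ ω)))       ≡⟨ sym (par-2*+ (α ℕ.* γ ℕ.+ μ ℕ.* ω) _) ⟩
          par (2 ℕ.* (α ℕ.* γ ℕ.+ μ ℕ.* ω) ℕ.+ suc ((α ℕ.+ γ) ℕ.+ (μ ℕ.+ ω)))
            ≡⟨ cong par (ℕₚ.*-cancelˡ-≡ (2 ℕ.* (α ℕ.* γ ℕ.+ μ ℕ.* ω) ℕ.+ suc ((α ℕ.+ γ) ℕ.+ (μ ℕ.+ ω))) m 2 (trans (expand α γ μ ω) e)) ⟩
          par m                                     ≡⟨ m-odd ⟩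
          true                                      ∎))
        where
        expand : ∀ α γ μ ω → 2 ℕ.* (2 ℕ.* (α ℕ.* γ ℕ.+ μ ℕ.* ω) ℕ.+ suc ((α ℕ.+ γ) ℕ.+ (μ ℕ.+ ω)))
                           ≡ suc (2 ℕ.* α) ℕ.* suc (2 ℕ.* γ) ℕ.+ suc (2 ℕ.* μ) ℕ.* suc (2 ℕ.* ω)
        expand = solve-∀
        same : ∀ x y → not (x xor y) ≡ true → y ≡ x
        same true  true  _ = refl
        same false false _ = refl

      o≡q : ∀ {h h′ a c u w k X Y V W} → a ℕ.* c ℕ.+ u ℕ.* w ≡ 2 ℕ.* (2 ℕ.* X ℕ.* Y ℕ.+ V ℕ.* W) →
            (par W ≡ true → h (par k) ≡ h′ (par (X ℕ.+ Y))) → o h a c u w k ≡ q h′ X Y V W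
      o≡q {h} {h′} {a} {c} {u} {w} {k} {X} {Y} {V} {W} e p with 2 ℕ.* X ℕ.* Y ℕ.+ V ℕ.* W ≟ m
      ... | yes e′ = begin
        at (2 ℕ.* m) (a ℕ.* c ℕ.+ u ℕ.* w) (h (par k)) ≡⟨ cong (λ n → at (2 ℕ.* m) n (h (par k))) (trans e (cong (2 ℕ.*_) e′)) ⟩
        at (2 ℕ.* m) (2 ℕ.* m) (h (par k))             ≡⟨ at-≡ (2 ℕ.* m) _ ⟩
        h (par k)                                      ≡⟨ p (proj₂ (VW-odd X Y V W e′)) ⟩
        h′ (par (X ℕ.+ Y))                             ≡⟨ sym (at-≡ m _) ⟩
        at m m (h′ (par (X ℕ.+ Y)))                    ≡⟨ cong (λ n → at m n (h′ (par (X ℕ.+ Y)))) (sym e′) ⟩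
        at m (2 ℕ.* X ℕ.* Y ℕ.+ V ℕ.* W) (h′ (par (X ℕ.+ Y))) ∎
      ... | no ne = trans (at-≢ _ λ e′ → ne (ℕₚ.*-cancelˡ-≡ _ m 2 (trans (sym e) e′))) (sym (at-≢ _ ne))

      o≡at : ∀ {h a c u w k} n → a ℕ.* c ℕ.+ u ℕ.* w ≡ 2 ℕ.* n → o h a c u w k ≡ at m n (h (par k))
      o≡at {h} {k = k} n e = trans (cong (λ i → at (2 ℕ.* m) i (h (par k))) e) (at-mul 1 m n _)

      q≡at : ∀ {h X Y V W} n → 2 ℕ.* X ℕ.* Y ℕ.+ V ℕ.* W ≡ n → q h X Y V W ≡ at m n (h (par (X ℕ.+ Y)))
      q≡at {h} {X} {Y} n e = cong (λ i → at m i (h (par (X ℕ.+ Y)))) e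

      o≡at₂ : ∀ {h a c u w k} n → a ℕ.* c ℕ.+ u ℕ.* w ≡ n → o h a c u w k ≡ at (2 ℕ.* m) n (h (par k))
      o≡at₂ {h} {k = k} n e = cong (λ i → at (2 ℕ.* m) i (h (par k))) e

      q≡at-odd : ∀ {h X Y V W} n c → 2 ℕ.* X ℕ.* Y ℕ.+ V ℕ.* W ≡ n →
                 (par V ≡ true → par W ≡ true → h (par (X ℕ.+ Y)) ≡ c) → q h X Y V W ≡ at m n c
      q≡at-odd {h} {X} {Y} {V} {W} n c e p = at-cong e λ e′ → p (proj₁ (VW-odd X Y V W e′)) (proj₂ (VW-odd X Y V W e′))

      q-even-W : ∀ h X Y V W k → W ≡ 2 ℕ.* k → q h X Y V W ≡ 0ℤ
      q-even-W h X Y V W k w = at-≢ _ λ e →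
        true≢false (trans (sym (proj₂ (VW-odd X Y V W e))) (trans (cong par w) (par-2* k)))

    o≡q-not : ∀ {h a c u w k X Y V W} i j → a ℕ.* c ℕ.+ u ℕ.* w ≡ 2 ℕ.* (2 ℕ.* X ℕ.* Y ℕ.+ V ℕ.* W) →
              2 ℕ.* i ℕ.+ suc k ≡ 2 ℕ.* j ℕ.+ (X ℕ.+ Y) → o h a c u w k ≡ q (λ b → h (not b)) X Y V W
    o≡q-not {h} {k = k} {X} {Y} i j e p = o≡q e λ _ → cong h
      (trans (sym (not-involutive (par k))) (cong not (par-≡ i j {suc k} {X ℕ.+ Y} p)))

    private
      xor-true : ∀ r {x y} → x ≡ true → y ≡ true → r xor x ≡ r xor y
      xor-true r refl refl = refl

    -- For substitutions that preserve the class only because `V` and `W` are both odd on solutions: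
    -- one parity is expressed through `V`, the other through `W`.
    q-odd : ∀ {h X Y V W X′ Y′ V′ W′} k n i j r →
            2 ℕ.* X ℕ.* Y ℕ.+ V ℕ.* W ≡ 2 ℕ.* X′ ℕ.* Y′ ℕ.+ V′ ℕ.* W′ →
            V ≡ 2 ℕ.* k ℕ.+ n → X ℕ.+ Y ≡ 2 ℕ.* i ℕ.+ (r ℕ.+ n) → X′ ℕ.+ Y′ ≡ 2 ℕ.* j ℕ.+ (r ℕ.+ W) →
            q h X Y V W ≡ q h X′ Y′ V′ W′
    q-odd {h} {X} {Y} {V} {W} {X′} {Y′} k n i j r e v p p′ = q-cong e λ oV oW → cong h (begin
      par (X ℕ.+ Y)               ≡⟨ trans (cong par p) (par-2*+ i (r ℕ.+ n)) ⟩
      par (r ℕ.+ n)               ≡⟨ par-+ r n ⟩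
      par r xor par n             ≡⟨ xor-true (par r) (trans (sym (par-2*+ k n)) (trans (cong par (sym v)) oV)) oW ⟩
      par r xor par W             ≡⟨ sym (par-+ r W) ⟩
      par (r ℕ.+ W)               ≡⟨ sym (trans (cong par p′) (par-2*+ j (r ℕ.+ W))) ⟩
      par (X′ ℕ.+ Y′)             ∎)

    -- `W` is odd on every solution, so adding it to `X + Y` changes the class; hence the negated
    -- weight.
    q-flip : ∀ {h X Y V W X′ Y′ V′ W′} →
             2 ℕ.* X ℕ.* Y ℕ.+ V ℕ.* W ≡ 2 ℕ.* X′ ℕ.* Y′ ℕ.+ V′ ℕ.* W′ →
             X′ ℕ.+ Y′ ≡ W ℕ.+ (X ℕ.+ Y) →
             q (λ b → h (not b)) X Y V W ≡ q h X′ Y′ V′ W′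
    q-flip {h} {X} {Y} {V} {W} {X′} {Y′} e p = q-cong e λ oV oW →
      cong h (sym (trans (cong par p) (trans (par-+ W (X ℕ.+ Y)) (cong (_xor par (X ℕ.+ Y)) oW))))

    Q : (Bool → ℤ) → Cell
    Q h = (λ x y v w → q h (suc x) (suc y) (suc v) (suc w)) , λ x y v w p → q-large h x y v w (<-≤-trans m<B p)

    -- In gap coordinates, with `V` odd: `M` is the region `V < 2(Y − X − W)` and `L` the region
    -- `2X < V < 2Y`. They are what does not cancel within a single class.
    M L : (Bool → ℤ) → Fun
    M h x w α y = q h (suc x) (suc x ℕ.+ suc w ℕ.+ suc (α ℕ.+ y)) (suc (2 ℕ.* α)) (suc w)
    L h x α y w = q h (suc x) (suc x ℕ.+ suc (α ℕ.+ y)) (2 ℕ.* suc x ℕ.+ suc (2 ℕ.* α)) (suc w)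

    -- From `2XY + VW = 2X(Y + W) + (V − 2X)W`: replacing `(Y , V)` by `(Y + W , V − 2X)` carries
    -- the region `L` onto `M` and changes the class.
    L-flip : ∀ h → ΣΣ (L (λ b → h (not b))) ≡ ΣΣ (M h)
    L-flip h = ΣΣ-match (₃ ∷ ₂ ∷ []) (L (λ b → h (not b))) (M h) λ x α y w →
      q-flip (solve (x ∷ α ∷ y ∷ w ∷ [])) (solve (x ∷ α ∷ y ∷ w ∷ []))

    -- Cells of 2XY + VW = m.

    module Regions (h : Bool → ℤ) where
      c₁ QL c₂ c₃ c₄ c₅ d₁ d₂ e₁ f₁ g₁ g₂ P p₁ p₂ p₃ p₄ p₅ : Cell
      c₁ = perm (₂ ∷ ₁ ∷ ₃ ∷ []) (Q h)
      QL = ge c₁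
      c₂ = perm (₂ ∷ []) (su QL)
      c₃ = perm (₁ ∷ ₂ ∷ ₃ ∷ []) (su (ge c₂))
      c₄ = perm (₁ ∷ []) (ev c₃)
      c₅ = perm (₁ ∷ ₂ ∷ ₃ ∷ []) (lt c₂)
      d₁ = perm (₂ ∷ ₁ ∷ []) (Q h)
      d₂ = perm (₂ ∷ ₁ ∷ []) (lt d₁)
      e₁ = perm (₂ ∷ []) (lt d₂)
      f₁ = perm (₂ ∷ ₁ ∷ []) (ze (ge d₂))
      g₁ = perm (₁ ∷ []) (lt d₁)
      g₂ = perm (₂ ∷ ₁ ∷ []) (su (ge g₁))
      P  = lt g₂
      p₁ = perm (₂ ∷ ₁ ∷ ₂ ∷ []) P
      p₂ = su (ge p₁)
      p₃ = perm (₂ ∷ ₁ ∷ ₂ ∷ []) P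
      p₄ = perm (₁ ∷ []) (ev p₃)
      p₅ = su (ge p₂)

      -- The regions: `H₀` is `Y = W`, `H₁` is `W < Y < X + W`, `H₂` is `Y = X + W`, `H₃` is
      -- `Y > X + W`; `G₁` is `V > X + Y`, `G₂` is `V = X + Y`, `G₃` is `Y < V < X + Y`. With
      -- `Y < X` throughout, `La` is `2Y < V < X + Y`, `Lb` is `V = X + Y`, `Lc` is
      -- `X + Y < V < 2X`.
      H₀ H₁ H₂ H₃ G₁ G₂ G₃ Mₛ Lₛ La Lb Lc : ℤ
      H₀ = S (ze QL)
      H₁ = S (lt c₂)
      H₂ = S (ze (ge c₂))
      H₃ = S (su (ge c₂))
      G₁ = S (su (ge d₂))
      G₂ = S (ze (ge d₂))
      G₃ = S (lt d₂)
      Mₛ = ΣΣ (M h)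
      Lₛ = ΣΣ (L h)
      La = S (lt p₁)
      Lb = S (ze (ge p₁))
      Lc = S (lt p₂)

      suc-suc : ∀ k → suc (suc (2 ℕ.* k)) ≡ 2 ℕ.* suc k
      suc-suc = solve-∀

      QL-split : S QL ≡ H₀ + (H₁ + (H₂ + H₃))
      QL-split = begin
        S QL                                ≡⟨ S-zs QL ⟩
        H₀ + S (su QL)                      ≡⟨ cong (λ s → H₀ + s) (split (₂ ∷ []) (su QL)) ⟩
        H₀ + (S (ge c₂) + H₁)               ≡⟨ cong (λ s → H₀ + (s + H₁)) (S-zs (ge c₂)) ⟩
        H₀ + ((H₂ + H₃) + H₁)               ≡⟨ cong (λ s → H₀ + s) (ℤₚ.+-comm (H₂ + H₃) H₁) ⟩
        H₀ + (H₁ + (H₂ + H₃))               ∎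

      H₁-index : H₁ ≡ S (ev c₅)
      H₁-index = only-even (₁ ∷ ₂ ∷ ₃ ∷ []) (lt c₂) λ v y x w → q-even h _ _ _ _ (suc v) (suc-suc v)

      -- The part of `H₃` outside `M` is carried onto `H₁` by `(X , Y , V) ↦ (Y − W , X + W , V −
      -- 2(Y − X − W))` with `W` fixed.
      H₃-split : H₃ ≡ Mₛ + H₁
      H₃-split = begin
        H₃                    ≡⟨ only-even (₁ ∷ ₂ ∷ ₃ ∷ []) (su (ge c₂)) (λ v y x w → q-even h _ _ _ _ (suc v) (suc-suc v)) ⟩
        S (ev c₃)             ≡⟨ split (₁ ∷ []) (ev c₃) ⟩
        S (ge c₄) + S (lt c₄) ≡⟨ cong₂ _+_ M≡ K≡ ⟩
        Mₛ + H₁               ∎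
        where
        M≡ : S (ge c₄) ≡ Mₛ
        M≡ = fit (₂ ∷ ₁ ∷ ₃ ∷ ₂ ∷ ₃ ∷ []) (ge c₄) (M h) λ y v x w →
          q-same 0 0 (solve (y ∷ v ∷ x ∷ w ∷ [])) (solve (y ∷ v ∷ x ∷ w ∷ []))
        K≡ : S (lt c₄) ≡ H₁
        K≡ = trans (match (₁ ∷ ₂ ∷ []) (lt c₄) (ev c₅) λ y v x w →
          q-same 0 0 (solve (y ∷ v ∷ x ∷ w ∷ [])) (solve (y ∷ v ∷ x ∷ w ∷ []))) (sym H₁-index)

      QV≡QL : S (ge d₁) ≡ S QL
      QV≡QL = match [] (ge d₁) QL λ y v x w → q-same 0 0 (solve (y ∷ v ∷ x ∷ w ∷ [])) refl

      Q-split : S (Q h) ≡ S QL + (G₂ + G₁ + G₃)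
      Q-split = begin
        S (Q h)                           ≡⟨ split (₂ ∷ ₁ ∷ []) (Q h) ⟩
        S (ge d₁) + S (lt d₁)             ≡⟨ cong₂ _+_ QV≡QL (split (₂ ∷ ₁ ∷ []) (lt d₁)) ⟩
        S QL + (S (ge d₂) + G₃)           ≡⟨ cong (λ s → S QL + (s + G₃)) (S-zs (ge d₂)) ⟩
        S QL + (G₂ + G₁ + G₃)             ∎

      -- `G₃` is cut at `V = 2Y`, which an odd `V` never meets. The part above is `La`; the part
      -- below goes onto `Lc` by `(X , Y , V , W) ↦ (X + W , V − Y , 2X + W , 2Y −
      -- V)`, which keeps the class because `V + W` is even.
      G₃-split : G₃ ≡ La + Lc
      G₃-split = begin
        G₃                                          ≡⟨ split (₂ ∷ []) (lt d₂) ⟩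
        S (ge e₁) + S (lt e₁)                       ≡⟨ cong₂ _+_ (S-zs (ge e₁)) Lc≡ ⟩
        S (ze (ge e₁)) + S (su (ge e₁)) + Lc        ≡⟨ cong (_+ Lc) (cong₂ _+_ even La≡) ⟩
        0ℤ + La + Lc                                ≡⟨ cong (_+ Lc) (ℤₚ.+-identityˡ La) ⟩
        La + Lc                                     ∎
        where
        even : S (ze (ge e₁)) ≡ 0ℤ
        even = S-0 (ze (ge e₁)) λ { zero y x w → q-even h _ _ _ _ (suc y) (solve (y ∷ [])) ; (suc v) y x w → refl }
        La≡ : S (su (ge e₁)) ≡ La
        La≡ = match (₂ ∷ []) (su (ge e₁)) (lt p₁) λ v y x w →
          q-same 0 0 (solve (v ∷ y ∷ x ∷ w ∷ [])) (solve (v ∷ y ∷ x ∷ w ∷ []))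
        Lc≡ : S (lt e₁) ≡ Lc
        Lc≡ = match (₂ ∷ ₁ ∷ ₃ ∷ ₂ ∷ []) (lt e₁) (lt p₂) λ v y x w →
          q-odd (suc v) (suc y) (suc v) (suc v) (suc x) (solve (v ∷ y ∷ x ∷ w ∷ [])) (solve (v ∷ y ∷ x ∷ w ∷ []))
            (solve (v ∷ y ∷ x ∷ w ∷ [])) (solve (v ∷ y ∷ x ∷ w ∷ []))

      G₂-split : G₂ ≡ Lb + Lb
      G₂-split = begin
        G₂                                          ≡⟨ split (₂ ∷ ₁ ∷ []) (ze (ge d₂)) ⟩
        S (ge f₁) + S (lt f₁)                       ≡⟨ cong₂ _+_ (S-zs (ge f₁)) below ⟩
        S (ze (ge f₁)) + S (su (ge f₁)) + Lb        ≡⟨ cong (_+ Lb) (cong₂ _+_ even above) ⟩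
        0ℤ + Lb + Lb                                ≡⟨ cong (_+ Lb) (ℤₚ.+-identityˡ Lb) ⟩
        Lb + Lb                                     ∎
        where
        even : S (ze (ge f₁)) ≡ 0ℤ
        even = S-0 (ze (ge f₁)) λ { zero y zero w → q-even h _ _ _ _ (suc y) (solve (y ∷ []))
                                  ; zero y (suc v) w → refl ; (suc x) y v w → refl }
        above : S (su (ge f₁)) ≡ Lb
        above = match (₂ ∷ ₁ ∷ []) (su (ge f₁)) (ze (ge p₁)) λ x y v w →
          cong (⟦=0⟧ v) (q-same 0 0 (solve (x ∷ y ∷ w ∷ [])) (solve (x ∷ y ∷ w ∷ [])))
        below : S (lt f₁) ≡ Lb
        below = match (₂ ∷ ₁ ∷ ₂ ∷ []) (lt f₁) (ze (ge p₁)) λ x y v w →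
          cong (⟦=0⟧ v) (q-same 0 0 (solve (x ∷ y ∷ w ∷ [])) (solve (x ∷ y ∷ w ∷ [])))

      -- The region `Y < X`, `2Y < V` is cut in two ways: at `V = 2X` only, where the lower part is
      -- `L` with `X` and `Y` exchanged, and at both `V = X + Y` and `V = 2X`. The common part
      -- `V > 2X` cancels.
      L-split : Lₛ ≡ La + Lb + Lc
      L-split = cancelʳ (S p₅) (trans (sym by-index) by-size)
        where
        by-index : S P ≡ Lₛ + S p₅
        by-index = begin
          S P                   ≡⟨ only-even (₂ ∷ ₁ ∷ ₂ ∷ []) P (λ v x y w → q-even h _ _ _ _ (suc (suc (y ℕ.+ v))) (solve (v ∷ y ∷ []))) ⟩
          S (ev p₃)             ≡⟨ split (₁ ∷ []) (ev p₃) ⟩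
          S (ge p₄) + S (lt p₄) ≡⟨ cong₂ _+_
            (fit (₂ ∷ ₁ ∷ ₂ ∷ []) (ge p₄) (L h) λ x v y w → q-same 0 0 (solve (x ∷ v ∷ y ∷ w ∷ [])) (solve (x ∷ v ∷ y ∷ w ∷ [])))
            (sym (trans (only-even [] p₅ λ v x y w → q-even h _ _ _ _ (suc (suc (suc (y ℕ.+ x ℕ.+ v)))) (solve (v ∷ x ∷ y ∷ [])))
              (match (₁ ∷ []) (ev p₅) (lt p₄) λ v x y w → q-same 0 0 (solve (x ∷ v ∷ y ∷ w ∷ [])) (solve (x ∷ v ∷ y ∷ w ∷ []))))) ⟩
          Lₛ + S p₅             ∎
        arrange : ∀ a b c d → b + (0ℤ + d + c) + a ≡ a + b + c + d
        arrange = ℤ-Solver.solve-∀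
        by-size : S P ≡ La + Lb + Lc + S p₅
        by-size = begin
          S P                                      ≡⟨ split (₂ ∷ ₁ ∷ ₂ ∷ []) P ⟩
          S (ge p₁) + La                           ≡⟨ cong (_+ La) (S-zs (ge p₁)) ⟩
          Lb + S p₂ + La                           ≡⟨ cong (λ s → Lb + s + La) (S-≥< p₂) ⟩
          Lb + (S (ge p₂) + Lc) + La               ≡⟨ cong (λ s → Lb + (s + Lc) + La) (S-zs (ge p₂)) ⟩
          Lb + (S (ze (ge p₂)) + S p₅ + Lc) + La   ≡⟨ cong (λ s → Lb + (s + S p₅ + Lc) + La) (S-0 (ze (ge p₂))
              λ { zero x y w → q-even h _ _ _ _ (suc (suc (y ℕ.+ x))) (solve (x ∷ y ∷ [])) ; (suc v) x y w → refl }) ⟩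
          Lb + (0ℤ + S p₅ + Lc) + La               ≡⟨ arrange La Lb Lc (S p₅) ⟩
          La + Lb + Lc + S p₅                      ∎

      -- The combination on the left is the one that `triangles` evaluates as a count of triangles.
      -- Here it is reduced to the divisor cell `H₀` and to the difference of `L` and `M`, which the
      -- odd form will absorb.
      Q-reduction : + 2 * S (Q h) - + 4 * H₃ - + 2 * H₂ - + 2 * G₁ - G₂ ≡ + 2 * H₀ + + 2 * Lₛ - + 2 * Mₛ
      Q-reduction = combine H₀ H₁ H₂ G₁ Mₛ La Lb Lc Q-split QL-split H₃-split G₃-split G₂-split L-split
        where
        linear : ∀ H₀ H₁ H₂ G₁ M La Lb Lc →
          + 2 * (H₀ + (H₁ + (H₂ + (M + H₁))) + (Lb + Lb + G₁ + (La + Lc))) - + 4 * (M + H₁) - + 2 * H₂ - + 2 * G₁ - (Lb + Lb)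
          ≡ + 2 * H₀ + + 2 * (La + Lb + Lc) - + 2 * M
        linear = ℤ-Solver.solve-∀
        combine : ∀ h₀ h₁ h₂ g₁ m la lb lc {q ql h₃ g₂ g₃ l} → q ≡ ql + (g₂ + g₁ + g₃) → ql ≡ h₀ + (h₁ + (h₂ + h₃)) →
          h₃ ≡ m + h₁ → g₃ ≡ la + lc → g₂ ≡ lb + lb → l ≡ la + lb + lc →
          + 2 * q - + 4 * h₃ - + 2 * h₂ - + 2 * g₁ - g₂ ≡ + 2 * h₀ + + 2 * l - + 2 * m
        combine h₀ h₁ h₂ g₁ m la lb lc refl refl refl refl refl refl = linear h₀ h₁ h₂ g₁ m la lb lc

    O : (Bool → ℤ) → Cell
    O h = (λ α γ μ ω → o h (suc (2 ℕ.* α)) (suc (2 ℕ.* γ)) (suc (2 ℕ.* μ)) (suc (2 ℕ.* ω)) (μ ℕ.+ ω)) ,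
      λ α γ μ ω → o-large h _ _ _ _ _ _ (≤-trans (m≤m+n _ _) (≤-reflexive (bound α γ μ ω)))
      where
      bound : ∀ α γ μ ω → (α ℕ.+ γ ℕ.+ μ ℕ.+ ω) ℕ.+ (2 ℕ.+ α ℕ.+ γ ℕ.+ μ ℕ.+ ω ℕ.+ 4 ℕ.* α ℕ.* γ ℕ.+ 4 ℕ.* μ ℕ.* ω)
                        ≡ suc (2 ℕ.* α) ℕ.* suc (2 ℕ.* γ) ℕ.+ suc (2 ℕ.* μ) ℕ.* suc (2 ℕ.* ω)
      bound = solve-∀

    -- Cells of ac + uw = 2m in odd variables.

    module OddRegions (h : Bool → ℤ) where
      h̄ : Bool → ℤ
      h̄ b = h (not b)

      b₁ O> t₁ t₂ n₁ n₂ A n₃ n₄ n₅ : Cell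
      b₁ = perm (₁ ∷ ₂ ∷ []) (O h)
      O> = su (ge b₁)
      t₁ = perm (₂ ∷ ₃ ∷ []) O>
      t₂ = perm (₃ ∷ ₂ ∷ ₃ ∷ []) (ge t₁)
      n₁ = perm (₁ ∷ ₂ ∷ []) (Q h̄)
      n₂ = perm (₁ ∷ ₂ ∷ []) (ev n₁)
      A  = ge n₂
      n₃ = perm (₂ ∷ ₁ ∷ ₂ ∷ []) A
      n₄ = perm (₁ ∷ ₂ ∷ []) A
      n₅ = perm (₂ ∷ ₁ ∷ ₂ ∷ ₃ ∷ []) (lt n₄)

      -- `Oau` is the cell `u = a` and `Dₕ` the cell `u > a + c + w`. The barred sums belong to
      -- `2XY + VW = m` in the opposite class, `D̄` being the region `V < 2X`, `V < 2Y`.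
      Oau Dₕ D̄ L̄ M̄ : ℤ
      Oau = S (ze (ge b₁))
      Dₕ  = S (su (ge t₂))
      D̄   = S (ge n₃)
      L̄   = ΣΣ (L h̄)
      M̄   = ΣΣ (M h̄)

      O-split : S (O h) ≡ Oau + S O> + S O>
      O-split = begin
        S (O h)                     ≡⟨ split (₁ ∷ ₂ ∷ []) (O h) ⟩
        S (ge b₁) + S (lt b₁)       ≡⟨ cong₂ _+_ (S-zs (ge b₁)) (match (₁ ∷ ₃ ∷ []) (lt b₁) O> λ u a c w →
          trans (o-pair h (suc u ℕ.+ a) c u w) (o-cong 0 0 (solve (u ∷ a ∷ c ∷ w ∷ [])) (solve (u ∷ a ∷ c ∷ [])))) ⟩
        Oau + S O> + S O>           ∎

      -- The substitution `X = (u − a)/2`, `Y = (a + w)/2`, `V = a`, `W = (a + c + w − u)/2` carries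
      -- `a < u < a + c + w` onto the region `V < 2Y` without `M`. Since `X + Y = (u + w)/2`, it
      -- flips the class. The region `V < 2Y` is also `D̄ + L̄`, by comparing `V` with `2X`.
      O>-split : S O> ≡ Dₕ + D̄ + L̄ - M̄
      O>-split = combine Dₕ D̄ L̄ M̄ c₁ c₂ O-side Q-side₁ Q-side₂
        where
        c₁ c₂ : ℤ
        c₁ = S (lt t₁)
        c₂ = S (lt t₂)
        O-side : S O> ≡ 0ℤ + Dₕ + c₂ + c₁
        O-side = begin
          S O>                                       ≡⟨ split (₂ ∷ ₃ ∷ []) O> ⟩
          S (ge t₁) + c₁                             ≡⟨ cong (_+ c₁) (split (₃ ∷ ₂ ∷ ₃ ∷ []) (ge t₁)) ⟩
          S (ge t₂) + c₂ + c₁                        ≡⟨ cong (λ s → s + c₂ + c₁) (S-zs (ge t₂)) ⟩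
          S (ze (ge t₂)) + Dₕ + c₂ + c₁              ≡⟨ cong (λ s → s + Dₕ + c₂ + c₁) (S-0 (ze (ge t₂))
            λ { zero c a w → o-4 h _ _ _ _ _ (suc (a ℕ.+ w) ℕ.* suc (c ℕ.+ w)) (solve (c ∷ a ∷ w ∷ [])) ; (suc e) c a w → refl }) ⟩
          0ℤ + Dₕ + c₂ + c₁                          ∎
        Q-side₁ : S A ≡ D̄ + L̄
        Q-side₁ = trans (split (₂ ∷ ₁ ∷ ₂ ∷ []) A) (cong (λ s → D̄ + s) (fit [] (lt n₃) (L h̄) λ x v y w →
          q-same 0 0 (solve (x ∷ v ∷ y ∷ w ∷ [])) (solve (x ∷ v ∷ y ∷ []))))
        Q-side₂ : S A ≡ c₂ + (c₁ + M̄)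
        Q-side₂ = begin
          S A                                 ≡⟨ split (₁ ∷ ₂ ∷ []) A ⟩
          S (ge n₄) + S (lt n₄)               ≡⟨ cong₂ _+_ C₂≡ (split (₂ ∷ ₁ ∷ ₂ ∷ ₃ ∷ []) (lt n₄)) ⟩
          c₂ + (S (ge n₅) + S (lt n₅))        ≡⟨ cong (λ s → c₂ + s) (cong₂ _+_ C₁≡ (fit (₂ ∷ ₁ ∷ ₃ ∷ []) (lt n₅) (M h̄)
            λ w y x v → q-same 0 0 (solve (w ∷ y ∷ x ∷ v ∷ [])) (solve (w ∷ y ∷ x ∷ v ∷ [])))) ⟩
          c₂ + (c₁ + M̄)                       ∎
          where
          C₁≡ : S (ge n₅) ≡ c₁
          C₁≡ = sym (match (₃ ∷ ₂ ∷ ₁ ∷ ₂ ∷ []) (lt t₁) (ge n₅) λ p w a c → o≡q-not 0 0 (solve (p ∷ w ∷ a ∷ c ∷ [])) (solve (p ∷ w ∷ a ∷ [])))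
          C₂≡ : S (ge n₄) ≡ c₂
          C₂≡ = sym (match (₃ ∷ ₂ ∷ ₃ ∷ []) (lt t₂) (ge n₄) λ p c a w → o≡q-not 0 0 (solve (p ∷ c ∷ a ∷ w ∷ [])) (solve (p ∷ a ∷ w ∷ [])))
        combine : ∀ d d̄ l m c₁ c₂ {o a} → o ≡ 0ℤ + d + c₂ + c₁ → a ≡ d̄ + l → a ≡ c₂ + (c₁ + m) → o ≡ d + d̄ + l - m
        combine d d̄ l m c₁ c₂ refl refl e = trans (regroup d c₁ c₂ m) (trans (cong (λ s → d + s - m) (sym e)) (regroup′ d d̄ l m))
          where
          regroup : ∀ d c₁ c₂ m → 0ℤ + d + c₂ + c₁ ≡ d + (c₂ + (c₁ + m)) - m
          regroup = ℤ-Solver.solve-∀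
          regroup′ : ∀ d d̄ l m → d + (d̄ + l) - m ≡ d + d̄ + l - m
          regroup′ = ℤ-Solver.solve-∀

      b₂ U b₃ U> m₁ m₂ : Cell
      b₂ = perm (₂ ∷ ₁ ∷ ₃ ∷ ₂ ∷ []) (O h)
      U  = su (ge b₂)
      b₃ = perm (₂ ∷ ₁ ∷ ₃ ∷ ₂ ∷ ₃ ∷ []) U
      U> = su (ge b₃)
      m₁ = perm (₂ ∷ []) (ge n₃)
      m₂ = perm (₂ ∷ ₁ ∷ []) (su (ge t₂))

      -- The suffix `d` marks the diagonal `a = c` or `X = Y` of a symmetric cell, the suffix `s`
      -- one of its two strict halves; `Ouw` is the cell `u = w`.
      Ouw Ud D̄d D̄s Dd Ds : ℤ
      Ouw = S (ze (ge b₂))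
      Ud  = S (ze (ge b₃))
      D̄d  = S (ze (ge m₁))
      D̄s  = S (su (ge m₁))
      Dd  = S (ze (ge m₂))
      Ds  = S (su (ge m₂))

      O-split′ : S (O h) ≡ Ouw + S U + S U
      O-split′ = trans (split (₂ ∷ ₁ ∷ ₃ ∷ ₂ ∷ []) (O h)) (cong₂ _+_ (S-zs (ge b₂))
        (match (₁ ∷ []) (lt b₂) U λ u w a c → o-cong 0 0 (solve (u ∷ w ∷ a ∷ c ∷ [])) (solve (u ∷ w ∷ []))))

      U-split : S U ≡ Ud + S U> + S U>
      U-split = trans (split (₂ ∷ ₁ ∷ ₃ ∷ ₂ ∷ ₃ ∷ []) U) (cong₂ _+_ (S-zs (ge b₃))
        (match (₁ ∷ []) (lt b₃) U> λ c a t w → o-cong 0 0 (solve (c ∷ a ∷ t ∷ w ∷ [])) refl))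

      D̄-split : D̄ ≡ D̄d + D̄s + D̄s
      D̄-split = trans (split (₂ ∷ []) (ge n₃)) (cong₂ _+_ (S-zs (ge m₁))
        (match (₁ ∷ []) (lt m₁) (su (ge m₁)) λ x y v w → q-same 0 0 (solve (x ∷ y ∷ v ∷ w ∷ [])) (solve (x ∷ y ∷ v ∷ []))))

      D-split : Dₕ ≡ Dd + Ds + Ds
      D-split = trans (split (₂ ∷ ₁ ∷ []) (su (ge t₂))) (cong₂ _+_ (S-zs (ge m₂))
        (match (₁ ∷ []) (lt m₂) (su (ge m₂)) λ c a e w → o-cong 0 0 (solve (c ∷ a ∷ e ∷ w ∷ [])) (solve (c ∷ a ∷ e ∷ w ∷ []))))

      -- With `T = suc t` and `u = w + 2T` one has `uw = (w + T)² − T²`. This is where the square of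
      -- Kronecker's relation comes from.
      u-term : ℕ → ℕ → ℕ → ℕ → ℤ
      u-term a c t w = o h a c (suc (2 ℕ.* w) ℕ.+ 2 ℕ.* suc t) (suc (2 ℕ.* w)) (suc t)

      -- `V` is the region `T < a`, `T < c`: for `a = T + x` and `c = T + y` the equation becomes
      -- `2m = (w + T)² + xy + T(x + y)`. `Veq` is `a = T < c`, `I` is `a < c` and `Id` is `a = c`.
      -- Oddness of `a` and `c` is imposed by a filter because they are compared with `T`, which has
      -- either parity.
      I Id V Veq : Cell
      I = (λ a s t w → odd-only (suc a) (u-term (suc a) (suc a ℕ.+ 2 ℕ.* suc s) t w)) ,
        λ a s t w p → odd-only-0 (suc a) (o-large h _ _ _ _ _ _ (≤-trans (m≤m+n _ _) (≤-reflexive (bound a s t w))) p)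
        where
        bound : ∀ a s t w → (a ℕ.+ s ℕ.+ t ℕ.+ w) ℕ.+ (6 ℕ.+ 3 ℕ.* a ℕ.+ s ℕ.+ a ℕ.* a ℕ.+ 2 ℕ.* a ℕ.* s ℕ.+ 7 ℕ.* w ℕ.+ t ℕ.+ 4 ℕ.* w ℕ.* w ℕ.+ 4 ℕ.* t ℕ.* w)
                ≡ suc a ℕ.* (suc a ℕ.+ 2 ℕ.* suc s) ℕ.+ (suc (2 ℕ.* w) ℕ.+ 2 ℕ.* suc t) ℕ.* suc (2 ℕ.* w)
        bound = solve-∀
      Id = (λ d a t w → ⟦=0⟧ d (odd-only (suc a) (u-term (suc a) (suc a) t w))) ,
        λ { zero a t w p → odd-only-0 (suc a) (o-large h _ _ _ _ _ _ (≤-trans (m≤m+n _ _) (≤-reflexive (bound a t w))) p)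
          ; (suc d) a t w p → refl }
        where
        bound : ∀ a t w → (a ℕ.+ t ℕ.+ w) ℕ.+ (4 ℕ.+ a ℕ.+ a ℕ.* a ℕ.+ 7 ℕ.* w ℕ.+ t ℕ.+ 4 ℕ.* w ℕ.* w ℕ.+ 4 ℕ.* t ℕ.* w)
                ≡ suc a ℕ.* suc a ℕ.+ (suc (2 ℕ.* w) ℕ.+ 2 ℕ.* suc t) ℕ.* suc (2 ℕ.* w)
        bound = solve-∀
      V = (λ x y t w → odd-only (suc t ℕ.+ suc x) (odd-only (suc t ℕ.+ suc y) (u-term (suc t ℕ.+ suc x) (suc t ℕ.+ suc y) t w))) ,
        λ x y t w p → odd-only-0 (suc t ℕ.+ suc x) (odd-only-0 (suc t ℕ.+ suc y)
          (o-large h _ _ _ _ _ _ (≤-trans (m≤m+n _ _) (≤-reflexive (bound x y t w))) p))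
        where
        bound : ∀ x y t w → (x ℕ.+ y ℕ.+ t ℕ.+ w) ℕ.+ (7 ℕ.+ x ℕ.+ y ℕ.+ 5 ℕ.* t ℕ.+ 7 ℕ.* w ℕ.+ t ℕ.* t ℕ.+ t ℕ.* x ℕ.+ t ℕ.* y ℕ.+ x ℕ.* y ℕ.+ 4 ℕ.* w ℕ.* w ℕ.+ 4 ℕ.* t ℕ.* w)
                ≡ (suc t ℕ.+ suc x) ℕ.* (suc t ℕ.+ suc y) ℕ.+ (suc (2 ℕ.* w) ℕ.+ 2 ℕ.* suc t) ℕ.* suc (2 ℕ.* w)
        bound = solve-∀
      Veq = (λ d y t w → ⟦=0⟧ d (odd-only (suc t) (odd-only (suc t ℕ.+ suc y) (u-term (suc t) (suc t ℕ.+ suc y) t w)))) ,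
        λ { zero y t w p → odd-only-0 (suc t) (odd-only-0 (suc t ℕ.+ suc y)
              (o-large h _ _ _ _ _ _ (≤-trans (m≤m+n _ _) (≤-reflexive (bound y t w))) p))
          ; (suc d) y t w p → refl }
        where
        bound : ∀ y t w → (y ℕ.+ t ℕ.+ w) ℕ.+ (5 ℕ.+ 4 ℕ.* t ℕ.+ 7 ℕ.* w ℕ.+ t ℕ.* t ℕ.+ t ℕ.* y ℕ.+ 4 ℕ.* w ℕ.* w ℕ.+ 4 ℕ.* t ℕ.* w)
                ≡ suc t ℕ.* (suc t ℕ.+ suc y) ℕ.+ (suc (2 ℕ.* w) ℕ.+ 2 ℕ.* suc t) ℕ.* suc (2 ℕ.* w)
        bound = solve-∀

      i₁ j₁ j₂ j₃ k₁ k₂ k₃ b₄ : Cell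
      i₁ = perm (₁ ∷ ₂ ∷ []) I
      j₁ = ev (perm (₁ ∷ []) (ge i₁))
      j₂ = perm (₁ ∷ []) j₁
      j₃ = perm (₂ ∷ []) (su j₂)
      k₁ = perm (₂ ∷ ₁ ∷ ₂ ∷ []) Id
      k₂ = ev (perm (₁ ∷ []) (ge k₁))
      k₃ = perm (₁ ∷ []) k₂
      b₄ = perm (₁ ∷ []) V

      -- `T` is compared with `a` and with `(a + c)/2`. The case `T = a` gives `D̄d`,
      -- `a < T < (a + c)/2` gives `D̄s`, and `T > (a + c)/2`, that is `u > a + c + w`, gives `Ds`;
      -- `T = (a + c)/2` is empty modulo 4. The last term is `T < a`.
      U>-split : S U> ≡ D̄d + (Ds + D̄s) + S (lt i₁)
      U>-split = begin
        S U>                                                    ≡⟨ sym (trans (only-even [] I λ a s t w → odd-only-even _ (suc a) (solve (a ∷ [])))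
          (match (₁ ∷ []) (ev I) U> λ a s t w → trans (odd-only-odd a) (o-cong w 0 (solve (a ∷ s ∷ t ∷ w ∷ [])) (solve (t ∷ w ∷ []))))) ⟩
        S I                                                     ≡⟨ split (₁ ∷ ₂ ∷ []) I ⟩
        S (ge i₁) + S (lt i₁)                                   ≡⟨ cong (_+ S (lt i₁)) (begin
          S (ge i₁)                                 ≡⟨ only-even (₁ ∷ []) (ge i₁) (λ a t s w → odd-only-even _ (suc a) (solve (a ∷ []))) ⟩
          S j₁                                      ≡⟨ zero-suc (₁ ∷ []) j₁ ⟩
          S (ze j₂) + S (su j₂)                     ≡⟨ cong₂ _+_ E≡ (split (₂ ∷ []) (su j₂)) ⟩
          D̄d + (S (ge j₃) + S (lt j₃))              ≡⟨ cong (λ s → D̄d + s) (cong₂ _+_ (trans (S-zs (ge j₃)) (cong₂ _+_ Z≡ G≡)) F≡) ⟩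
          D̄d + (0ℤ + Ds + D̄s)                       ≡⟨ cong (λ s → D̄d + (s + D̄s)) (ℤₚ.+-identityˡ Ds) ⟩
          D̄d + (Ds + D̄s)                            ∎) ⟩
        D̄d + (Ds + D̄s) + S (lt i₁)                              ∎
        where
        E≡ : S (ze j₂) ≡ D̄d
        E≡ = match (₃ ∷ ₂ ∷ []) (ze j₂) (ze (ge m₁)) λ t a s w → cong (⟦=0⟧ t) (trans (odd-only-odd a) (o≡q-not w 0 (solve (a ∷ s ∷ w ∷ [])) (solve (a ∷ w ∷ []))))
        F≡ : S (lt j₃) ≡ D̄s
        F≡ = match (₃ ∷ ₂ ∷ ₃ ∷ []) (lt j₃) (su (ge m₁)) λ t s a w → trans (odd-only-odd a) (o≡q-not w 0 (solve (t ∷ s ∷ a ∷ w ∷ [])) (solve (t ∷ a ∷ w ∷ [])))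
        Z≡ : S (ze (ge j₃)) ≡ 0ℤ
        Z≡ = S-0 (ze (ge j₃)) λ { zero s a w → trans (odd-only-odd a) (o-4 h _ _ _ _ _ (suc (a ℕ.+ w) ℕ.* suc (a ℕ.+ suc s ℕ.+ w)) (solve (s ∷ a ∷ w ∷ [])))
                                ; (suc e) s a w → refl }
        G≡ : S (su (ge j₃)) ≡ Ds
        G≡ = match (₁ ∷ ₂ ∷ []) (su (ge j₃)) (su (ge m₂)) λ e s a w → trans (odd-only-odd a) (o-cong w 0 (solve (e ∷ s ∷ a ∷ w ∷ [])) (solve (e ∷ s ∷ a ∷ w ∷ [])))

      Ud-split : Ud ≡ Dd + S (lt k₁)
      Ud-split = begin
        Ud                                                      ≡⟨ sym (trans (only-even (₁ ∷ []) Id λ { a zero t w → odd-only-even _ (suc a) (solve (a ∷ [])) ; a (suc d) t w → refl })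
          (match (₁ ∷ []) (ev (perm (₁ ∷ []) Id)) (ze (ge b₃)) λ a d t w → cong (⟦=0⟧ d) (trans (odd-only-odd a) (o-cong w 0 (solve (a ∷ t ∷ w ∷ [])) (solve (t ∷ w ∷ [])))))) ⟩
        S Id                                                    ≡⟨ split (₂ ∷ ₁ ∷ ₂ ∷ []) Id ⟩
        S (ge k₁) + S (lt k₁)                                   ≡⟨ cong (_+ S (lt k₁)) (begin
          S (ge k₁)                                 ≡⟨ only-even (₁ ∷ []) (ge k₁) (λ { a t zero w → odd-only-even _ (suc a) (solve (a ∷ [])) ; a t (suc d) w → refl }) ⟩
          S k₂                                      ≡⟨ zero-suc (₁ ∷ []) k₂ ⟩
          S (ze k₃) + S (su k₃)                     ≡⟨ cong₂ _+_ Z≡ G≡ ⟩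
          0ℤ + Dd                                   ≡⟨ ℤₚ.+-identityˡ Dd ⟩
          Dd                                        ∎) ⟩
        Dd + S (lt k₁)                                          ∎
        where
        Z≡ : S (ze k₃) ≡ 0ℤ
        Z≡ = S-0 (ze k₃) λ { zero a zero w → trans (odd-only-odd a) (o-4 h _ _ _ _ _ (suc (a ℕ.+ w) ℕ.* suc (a ℕ.+ w)) (solve (a ∷ w ∷ [])))
                           ; zero a (suc d) w → refl ; (suc t) a d w → refl }
        G≡ : S (su k₃) ≡ Dd
        G≡ = match (₂ ∷ ₁ ∷ ₂ ∷ []) (su k₃) (ze (ge m₂)) λ t a d w → cong (⟦=0⟧ d) (trans (odd-only-odd a) (o-cong w 0 (solve (t ∷ a ∷ w ∷ [])) (solve (t ∷ a ∷ w ∷ []))))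

      V-split : S V ≡ S (lt k₁) + S (lt i₁) + S (lt i₁)
      V-split = begin
        S V                                            ≡⟨ split (₁ ∷ []) V ⟩
        S (ge b₄) + S (lt b₄)                          ≡⟨ cong₂ _+_ (S-zs (ge b₄)) symmetric ⟩
        S (ze (ge b₄)) + S (su (ge b₄)) + S (su (ge b₄)) ≡⟨ cong₂ (λ p q → p + q + q) diagonal off ⟩
        S (lt k₁) + S (lt i₁) + S (lt i₁)              ∎
        where
        symmetric : S (lt b₄) ≡ S (su (ge b₄))
        symmetric = match (₁ ∷ []) (lt b₄) (su (ge b₄)) λ y x t w → trans (odd-only-comm (suc t ℕ.+ suc (suc y ℕ.+ x)) (suc t ℕ.+ suc y))
          (cong₂ (λ n z → odd-only (suc t ℕ.+ suc y) (odd-only n z)) (solve (t ∷ x ∷ y ∷ [])) (o-cong 0 0 (solve (t ∷ x ∷ y ∷ w ∷ [])) refl))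
        diagonal : S (ze (ge b₄)) ≡ S (lt k₁)
        diagonal = match (₂ ∷ ₁ ∷ ₂ ∷ []) (ze (ge b₄)) (lt k₁) λ d x t w → cong (⟦=0⟧ d)
          (trans (odd-only-twice (suc t ℕ.+ suc x) _ 0 (solve (t ∷ x ∷ []))) (cong₂ odd-only (solve (t ∷ x ∷ [])) (o-cong 0 0 (solve (t ∷ x ∷ w ∷ [])) refl)))
        off : S (su (ge b₄)) ≡ S (lt i₁)
        off = trans (only-odd [] (su (ge b₄)) λ d x t w → odd-only-clash (suc t ℕ.+ suc x) _ d (solve (d ∷ x ∷ t ∷ [])))
          (match (₂ ∷ ₁ ∷ ₂ ∷ []) (od (su (ge b₄))) (lt i₁) λ d x t w →
            trans (odd-only-twice (suc t ℕ.+ suc x) _ (suc d) (solve (d ∷ x ∷ t ∷ []))) (cong₂ odd-only (solve (t ∷ x ∷ [])) (o-cong 0 0 (solve (d ∷ t ∷ x ∷ w ∷ [])) refl)))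

      Veq≡D̄d : S Veq ≡ D̄d
      Veq≡D̄d = begin
        S Veq            ≡⟨ only-even (₂ ∷ ₁ ∷ ₂ ∷ []) Veq (λ { t y zero w → odd-only-even _ (suc t) (solve (t ∷ [])) ; t y (suc d) w → refl }) ⟩
        S e₁             ≡⟨ only-odd (₁ ∷ []) e₁ (λ { y t zero w → odd-only-clash (suc (2 ℕ.* t)) _ y (solve (y ∷ t ∷ [])) ; y t (suc d) w → refl }) ⟩
        S (od e₂)        ≡⟨ match (₂ ∷ ₁ ∷ ₃ ∷ ₂ ∷ ₃ ∷ []) (od e₂) (ze (ge m₁)) (λ y t d w → cong (⟦=0⟧ d)
          (trans (odd-only-twice (suc (2 ℕ.* t)) _ (suc y) (solve (y ∷ t ∷ []))) (trans (odd-only-odd t) (o≡q-not w 0 (solve (y ∷ t ∷ w ∷ [])) (solve (t ∷ w ∷ [])))))) ⟩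
        D̄d               ∎
        where
        e₁ e₂ : Cell
        e₁ = ev (perm (₂ ∷ ₁ ∷ ₂ ∷ []) Veq)
        e₂ = perm (₁ ∷ []) e₁

      -- `O` is expanded twice, cut at `u = a` and at `u = w`. `Dₕ` and `D̄` enter both expansions
      -- with coefficient 2 and cancel.
      V-reduction : + 2 * S V + + 2 * S Veq + Ouw ≡ Oau + + 2 * L̄ - + 2 * M̄
      V-reduction = combine (S (lt k₁)) (S (lt i₁)) Dd Ds D̄d D̄s L̄ M̄ Oau O-split O>-split O-split′ U-split D̄-split D-split U>-split Ud-split V-split Veq≡D̄d
        where
        linear : ∀ k i dd ds d̄d d̄s l m au uw →
          + 2 * (k + i + i) + + 2 * d̄d + uw ≡
          (uw + (dd + k + (d̄d + (ds + d̄s) + i) + (d̄d + (ds + d̄s) + i)) + (dd + k + (d̄d + (ds + d̄s) + i) + (d̄d + (ds + d̄s) + i)))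
            - (au + (dd + ds + ds + (d̄d + d̄s + d̄s) + l - m) + (dd + ds + ds + (d̄d + d̄s + d̄s) + l - m)) + (au + + 2 * l - + 2 * m)
        linear = ℤ-Solver.solve-∀
        combine : ∀ k i dd ds d̄d d̄s l m au {o o> u u> ud d̄ d v veq uw} → o ≡ au + o> + o> → o> ≡ d + d̄ + l - m →
          o ≡ uw + u + u → u ≡ ud + u> + u> → d̄ ≡ d̄d + d̄s + d̄s → d ≡ dd + ds + ds → u> ≡ d̄d + (ds + d̄s) + i → ud ≡ dd + k →
          v ≡ k + i + i → veq ≡ d̄d → + 2 * v + + 2 * veq + uw ≡ au + + 2 * l - + 2 * m
        combine k i dd ds d̄d d̄s l m au {uw = uw} refl refl e refl refl refl refl refl refl refl =
          trans (linear k i dd ds d̄d d̄s l m au uw) (trans (cong (λ s → s - all + r) (sym e)) (cancel all r))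
          where
          all r : ℤ
          all = au + (dd + ds + ds + (d̄d + d̄s + d̄s) + l - m) + (dd + ds + ds + (d̄d + d̄s + d̄s) + l - m)
          r = au + + 2 * l - + 2 * m
          cancel : ∀ o r → o - o + r ≡ r
          cancel = ℤ-Solver.solve-∀

      M̄≡L : M̄ ≡ ΣΣ (L h)
      M̄≡L = trans (sym (L-flip h̄)) (ΣΣ-match [] (L (λ b → h̄ (not b))) (L h) λ x α y w →
        q-cong refl λ _ _ → cong h (not-involutive (par (suc x ℕ.+ (suc x ℕ.+ suc (α ℕ.+ y))))))

      open Regions h using (H₀; H₂; H₃; G₁; G₂; Lₛ; Mₛ; Q-reduction)

      -- Changing the class exchanges `L` and `M`, so their differences cancel between the two
      -- forms. On the right only cells remain where the equation factors: `a (c + w) = 2m` on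
      -- `u = a`, and `W (2X + V) = m` on `Y = W`.
      reduction : + 2 * S V + + 2 * S Veq + Ouw + (+ 2 * S (Q h) - + 4 * H₃ - + 2 * H₂ - + 2 * G₁ - G₂) ≡ Oau + + 2 * H₀
      reduction = begin
        + 2 * S V + + 2 * S Veq + Ouw + (+ 2 * S (Q h) - + 4 * H₃ - + 2 * H₂ - + 2 * G₁ - G₂)
          ≡⟨ cong₂ _+_ V-reduction Q-reduction ⟩
        Oau + + 2 * L̄ - + 2 * M̄ + (+ 2 * H₀ + + 2 * Lₛ - + 2 * Mₛ)
          ≡⟨ cong₂ (λ l m → Oau + + 2 * l - + 2 * m + (+ 2 * H₀ + + 2 * Lₛ - + 2 * Mₛ)) (L-flip h) M̄≡L ⟩
        Oau + + 2 * Mₛ - + 2 * Lₛ + (+ 2 * H₀ + + 2 * Lₛ - + 2 * Mₛ)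
          ≡⟨ linear Oau H₀ Lₛ Mₛ ⟩
        Oau + + 2 * H₀ ∎
        where
        linear : ∀ a h l m → a + + 2 * m - + 2 * l + (+ 2 * h + + 2 * l - + 2 * m) ≡ a + + 2 * h
        linear = ℤ-Solver.solve-∀

    -- Triples (X , Y , W) with no entry larger than the sum of the other two, by the parity of X + Y + W:
    -- half sums of three odd, resp. of three positive even numbers.
    module Triangles (h : Bool → ℤ) where
      open Regions h

      T₁ T₂ z₁ z₂ z₃ z₄ z₅ z₆ y₁ y₂ y₃ y₄ : Cell
      T₁ = (λ i j l v → q h (suc (i ℕ.+ l)) (suc (j ℕ.+ l)) (suc v) (suc (i ℕ.+ j))) ,
        λ i j l v p → q-large h _ _ _ _ (<-≤-trans m<B (grow p (i ℕ.+ j ℕ.+ l) (bound i j l v)))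
        where
        bound : ∀ i j l v → (i ℕ.+ j ℕ.+ l ℕ.+ v) ℕ.+ (i ℕ.+ j ℕ.+ l) ≡ (i ℕ.+ l) ℕ.+ (j ℕ.+ l) ℕ.+ v ℕ.+ (i ℕ.+ j)
        bound = solve-∀
      T₂ = (λ i j l v → q h (suc (suc (i ℕ.+ l))) (suc (suc (j ℕ.+ l))) (suc v) (suc (suc (i ℕ.+ j)))) ,
        λ i j l v p → q-large h _ _ _ _ (<-≤-trans m<B (grow p (3 ℕ.+ i ℕ.+ j ℕ.+ l) (bound i j l v)))
        where
        bound : ∀ i j l v → (i ℕ.+ j ℕ.+ l ℕ.+ v) ℕ.+ (3 ℕ.+ i ℕ.+ j ℕ.+ l) ≡ suc (i ℕ.+ l) ℕ.+ suc (j ℕ.+ l) ℕ.+ v ℕ.+ suc (i ℕ.+ j)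
        bound = solve-∀
      z₁ = perm (₂ ∷ ₁ ∷ []) (lt c₁)
      z₂ = perm (₁ ∷ ₂ ∷ []) QL
      z₃ = perm (₁ ∷ ₂ ∷ []) (ev (ge z₂))
      z₄ = perm (₂ ∷ []) (od (ge z₂))
      z₅ = perm (₁ ∷ ₂ ∷ []) (ev (perm (₁ ∷ []) (lt z₁)))
      z₆ = perm (₂ ∷ []) (od (perm (₁ ∷ []) (lt z₁)))
      y₁ = perm (₁ ∷ ₂ ∷ []) T₁
      y₂ = perm (₁ ∷ ₂ ∷ []) T₂
      y₃ = perm (₂ ∷ ₁ ∷ []) (ev (su (ge c₂)))
      y₄ = perm (₂ ∷ ₁ ∷ []) (od (su (ge c₂)))

      T₁-split : S T₁ ≡ S (ge z₃) + S (ge z₅)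
      T₁-split = trans (split (₁ ∷ ₂ ∷ []) T₁) (cong₂ _+_
        (match (₂ ∷ ₁ ∷ ₂ ∷ []) (ge y₁) (ge z₃) λ l i j v → q-same 0 0 (solve (l ∷ i ∷ j ∷ v ∷ [])) (solve (l ∷ i ∷ j ∷ [])))
        (match (₂ ∷ ₁ ∷ []) (lt y₁) (ge z₅) λ l i j v → q-same 0 0 (solve (l ∷ i ∷ j ∷ v ∷ [])) (solve (l ∷ i ∷ j ∷ []))))

      T₂-split : S T₂ ≡ S (lt z₄) + S (lt z₆)
      T₂-split = trans (split (₁ ∷ ₂ ∷ []) T₂) (cong₂ _+_
        (match (₁ ∷ ₂ ∷ []) (ge y₂) (lt z₄) λ l i j v → q-same 0 0 (solve (l ∷ i ∷ j ∷ v ∷ [])) (solve (l ∷ i ∷ j ∷ [])))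
        (match (₂ ∷ []) (lt y₂) (lt z₆) λ l i j v → q-same 0 0 (solve (l ∷ i ∷ j ∷ v ∷ [])) (solve (l ∷ i ∷ j ∷ []))))

      H₂-split′ : H₂ ≡ S (ze (ge z₄)) + S (ze (ge z₆))
      H₂-split′ = trans (split (₂ ∷ ₁ ∷ []) (ze (ge c₂))) (cong₂ _+_
        (match (₂ ∷ ₁ ∷ ₂ ∷ []) (ge (perm (₂ ∷ ₁ ∷ []) (ze (ge c₂)))) (ze (ge z₄)) λ x w y v → cong (⟦=0⟧ y) (q-same 0 0 (solve (x ∷ w ∷ v ∷ [])) (solve (x ∷ w ∷ []))))
        (match (₂ ∷ ₁ ∷ []) (lt (perm (₂ ∷ ₁ ∷ []) (ze (ge c₂)))) (ze (ge z₆)) λ x w y v → cong (⟦=0⟧ y) (q-same 0 0 (solve (x ∷ w ∷ v ∷ [])) (solve (x ∷ w ∷ [])))))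

      H₃-split′ : H₃ ≡ (S (lt z₃) + S (lt z₅)) + (S (su (ge z₄)) + S (su (ge z₆)))
      H₃-split′ = trans (even-odd [] (su (ge c₂))) (cong₂ _+_
        (trans (split (₂ ∷ ₁ ∷ []) (ev (su (ge c₂)))) (cong₂ _+_
          (match (₁ ∷ ₂ ∷ []) (ge y₃) (lt z₃) λ x w y v → q-same 0 0 (solve (x ∷ w ∷ y ∷ v ∷ [])) (solve (x ∷ w ∷ y ∷ [])))
          (match (₂ ∷ []) (lt y₃) (lt z₅) λ x w y v → q-same 0 0 (solve (x ∷ w ∷ y ∷ v ∷ [])) (solve (x ∷ w ∷ y ∷ [])))))
        (trans (split (₂ ∷ ₁ ∷ []) (od (su (ge c₂)))) (cong₂ _+_
          (match (₂ ∷ ₁ ∷ ₂ ∷ []) (ge y₄) (su (ge z₄)) λ x w y v → q-same 0 0 (solve (x ∷ w ∷ y ∷ v ∷ [])) (solve (x ∷ w ∷ y ∷ [])))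
          (match (₂ ∷ ₁ ∷ []) (lt y₄) (su (ge z₆)) λ x w y v → q-same 0 0 (solve (x ∷ w ∷ y ∷ v ∷ [])) (solve (x ∷ w ∷ y ∷ []))))))

      -- By the symmetries `X ↔ Y` and `V ↔ W`, the sum over `Q` consists of the strict triangles
      -- `T₁ + T₂`, the degenerate ones `2 H₂ + G₂`, and `2 H₃ + G₁` where one of `X`, `Y`, `W`
      -- exceeds the sum of the others.
      triangles : + 2 * S (Q h) - + 4 * H₃ - + 2 * H₂ - + 2 * G₁ - G₂ ≡ + 2 * S T₁ + + 2 * S T₂ + + 2 * H₂ + G₂
      triangles = combine (S (ge z₃)) (S (lt z₃)) (S (lt z₄)) (S (ze (ge z₄))) (S (su (ge z₄)))
          (S (ge z₅)) (S (lt z₅)) (S (lt z₆)) (S (ze (ge z₆))) (S (su (ge z₆))) G₁ G₂ Q≡ T₁-split T₂-split H₂-split′ H₃-split′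
        where
        QL≡ : S QL ≡ (S (ge z₃) + S (lt z₃)) + (S (ze (ge z₄)) + S (su (ge z₄)) + S (lt z₄)) + (H₂ + H₃)
        QL≡ = trans (split (₁ ∷ ₂ ∷ []) QL) (cong₂ _+_
          (trans (S-eo (ge z₂)) (cong₂ _+_ (split (₁ ∷ ₂ ∷ []) (ev (ge z₂)))
            (trans (split (₂ ∷ []) (od (ge z₂))) (cong (_+ S (lt z₄)) (S-zs (ge z₄))))))
          (trans (match (₁ ∷ []) (lt z₂) (ge c₂) λ x y w v → q-same 0 0 (solve (x ∷ y ∷ w ∷ v ∷ [])) (solve (x ∷ y ∷ w ∷ []))) (S-zs (ge c₂))))
        rest≡ : S (lt c₁) ≡ G₂ + G₁ + ((S (ge z₅) + S (lt z₅)) + (S (ze (ge z₆)) + S (su (ge z₆)) + S (lt z₆)))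
        rest≡ = trans (split (₂ ∷ ₁ ∷ []) (lt c₁)) (cong₂ _+_
          (trans (S-zs (ge z₁)) (cong₂ _+_
            (match [] (ze (ge z₁)) (ze (ge d₂)) λ w x y v → cong (⟦=0⟧ w) (q-same 0 0 (solve (x ∷ y ∷ v ∷ [])) refl))
            (match [] (su (ge z₁)) (su (ge d₂)) λ w x y v → q-same 0 0 (solve (w ∷ x ∷ y ∷ v ∷ [])) refl)))
          (trans (even-odd (₁ ∷ []) (lt z₁)) (cong₂ _+_
            (split (₁ ∷ ₂ ∷ []) (ev (perm (₁ ∷ []) (lt z₁))))
            (trans (split (₂ ∷ []) (od (perm (₁ ∷ []) (lt z₁)))) (cong (_+ S (lt z₆)) (S-zs (ge z₆)))))))
        Q≡ : S (Q h) ≡ (S (ge z₃) + S (lt z₃)) + (S (ze (ge z₄)) + S (su (ge z₄)) + S (lt z₄)) + (H₂ + H₃)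
                     + (G₂ + G₁ + ((S (ge z₅) + S (lt z₅)) + (S (ze (ge z₆)) + S (su (ge z₆)) + S (lt z₆))))
        Q≡ = trans (split (₂ ∷ ₁ ∷ ₃ ∷ []) (Q h)) (cong₂ _+_ QL≡ rest≡)
        linear : ∀ a b c d e a′ b′ c′ d′ e′ g₁ g₂ →
          + 2 * ((a + b) + (d + e + c) + (d + d′ + ((b + b′) + (e + e′))) + (g₂ + g₁ + ((a′ + b′) + (d′ + e′ + c′))))
            - + 4 * ((b + b′) + (e + e′)) - + 2 * (d + d′) - + 2 * g₁ - g₂
          ≡ + 2 * (a + a′) + + 2 * (c + c′) + + 2 * (d + d′) + g₂
        linear = ℤ-Solver.solve-∀
        combine : ∀ a b c d e a′ b′ c′ d′ e′ g₁ g₂ {q t₁ t₂ h₂ h₃} →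
          q ≡ (a + b) + (d + e + c) + (h₂ + h₃) + (g₂ + g₁ + ((a′ + b′) + (d′ + e′ + c′))) → t₁ ≡ a + a′ → t₂ ≡ c + c′ →
          h₂ ≡ d + d′ → h₃ ≡ (b + b′) + (e + e′) →
          + 2 * q - + 4 * h₃ - + 2 * h₂ - + 2 * g₁ - g₂ ≡ + 2 * t₁ + + 2 * t₂ + + 2 * h₂ + g₂
        combine a b c d e a′ b′ c′ d′ e′ g₁ g₂ refl refl refl refl refl = linear a b c d e a′ b′ c′ d′ e′ g₁ g₂

    -- Divisor sums on the factoring cells.

    module Divisors where

      σ : ℤ
      σ = Σ (λ a → Σ (λ e → at m (suc (2 ℕ.* a) ℕ.* (suc (2 ℕ.* e))) (+ (suc (2 ℕ.* e)))))

      N W w₀ w₁ w₂ : Cell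
      N = (λ d d′ a e → ⟦=0⟧ d (⟦=0⟧ d′ (at m ((suc (2 ℕ.* a)) ℕ.* (suc (2 ℕ.* e))) 1ℤ))) ,
        λ { zero zero a e p → at-≢ _ λ eq → <-irrefl (sym eq) (<-≤-trans m<B (grow p _ (bound a e)))
          ; zero (suc d′) a e p → refl ; (suc d) d′ a e p → refl }
        where
        bound : ∀ a e → (a ℕ.+ e) ℕ.+ (1 ℕ.+ a ℕ.+ e ℕ.+ 4 ℕ.* a ℕ.* e) ≡ (suc (2 ℕ.* a)) ℕ.* (suc (2 ℕ.* e))
        bound = solve-∀
      W = (λ d a v x → ⟦=0⟧ d (at m ((suc (2 ℕ.* a)) ℕ.* (suc (2 ℕ.* (v ℕ.+ suc x)))) 1ℤ)) ,
        λ { zero a v x p → at-≢ _ λ eq → <-irrefl (sym eq) (<-≤-trans m<B (grow p _ (bound a v x)))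
          ; (suc d) a v x p → refl }
        where
        bound : ∀ a v x → (a ℕ.+ v ℕ.+ x) ℕ.+ (3 ℕ.+ 5 ℕ.* a ℕ.+ v ℕ.+ x ℕ.+ 4 ℕ.* a ℕ.* (v ℕ.+ x)) ≡ (suc (2 ℕ.* a)) ℕ.* (suc (2 ℕ.* (v ℕ.+ suc x)))
        bound = solve-∀
      w₀ = perm (₁ ∷ ₂ ∷ ₃ ∷ []) W
      w₁ = perm (₃ ∷ ₂ ∷ ₁ ∷ ₂ ∷ ₃ ∷ []) (ev w₀)
      w₂ = perm (₂ ∷ ₁ ∷ ₃ ∷ ₂ ∷ ₃ ∷ []) N

      -- The number of odd, resp. even, `suc x` among `1, …, e`, summed over the factorisations of
      -- `m` with second factor `2e + 1`.
      Wₒ Wₑ : ℤ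
      Wₒ = S (ev w₀)
      Wₑ = S (od w₀)

      σ≡ : σ ≡ S N + + 2 * (Wₒ + Wₑ)
      σ≡ = begin
        σ ≡⟨ sumTo-cong B (λ a → trans (sumTo-cong B (pointwise a)) (trans (sumTo-+ B _ _) (cong (λ s → Σ (f a) + s)
               (trans (sumTo-*ˡ B (+ 2) _) (cong (λ s → + 2 * s) (Σ-weight (vanish a))))))) ⟩
        Σ (λ a → Σ (f a) + + 2 * Σ (λ v → Σ (λ x → f a (v ℕ.+ suc x)))) ≡⟨ sumTo-+ B _ _ ⟩
        Σ (λ a → Σ (f a)) + Σ (λ a → + 2 * Σ (λ v → Σ (λ x → f a (v ℕ.+ suc x)))) ≡⟨ cong₂ _+_ (sym (S-dummy₂ f))
          (trans (sumTo-*ˡ B (+ 2) _) (cong (λ s → + 2 * s) (trans (sym (S-dummy λ a v x → f a (v ℕ.+ suc x))) (even-odd (₁ ∷ ₂ ∷ ₃ ∷ []) W)))) ⟩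
        S N + + 2 * (Wₒ + Wₑ) ∎
        where
        f : ℕ → ℕ → ℤ
        f a e = at m (suc (2 ℕ.* a) ℕ.* (suc (2 ℕ.* e))) 1ℤ
        vanish : ∀ a → Vanish (f a)
        vanish a e p = sup N 0 0 a e (≤-trans p (m≤n+m e a))
        split-odd : ∀ (e x : ℤ) → (1ℤ + + 2 * e) * x ≡ x + + 2 * (e * x)
        split-odd = ℤ-Solver.solve-∀
        pointwise : ∀ a e → at m (suc (2 ℕ.* a) ℕ.* (suc (2 ℕ.* e))) (+ (suc (2 ℕ.* e))) ≡ f a e + + 2 * (+ e * f a e)
        pointwise a e = trans (at-const m _ (+ (suc (2 ℕ.* e)))) (trans (cong (λ c → c * f a e)
          (cong (λ s → 1ℤ + s) (ℤₚ.pos-* 2 e))) (split-odd (+ e) (f a e)))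

      module _ (m′ : ℕ) (m≡ : m ≡ suc (2 ℕ.* m′)) where

        residue : ∀ a e → (suc (2 ℕ.* a)) ℕ.* (suc (2 ℕ.* e)) ≡ m → par (a ℕ.+ e) ≡ par m′
        residue a e eq = par-≡ (a ℕ.* e) 0 {a ℕ.+ e} {m′} (ℕₚ.*-cancelˡ-≡ _ m′ 2 (ℕₚ.suc-injective (trans (expand a e) (trans eq m≡))))
          where
          expand : ∀ a e → suc (2 ℕ.* (2 ℕ.* (a ℕ.* e) ℕ.+ (a ℕ.+ e))) ≡ (suc (2 ℕ.* a)) ℕ.* (suc (2 ℕ.* e))
          expand = solve-∀

        -- Exactly one of two complementary divisors of m is 3 mod 4.
        3-mod-4 : par m′ ≡ true → + 2 * Wₒ ≡ S N + + 2 * Wₑ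
        3-mod-4 three = combine (S (ev u₁)) Wₒ≡ N≡
          where
          u₀ u₁ : Cell
          u₀ = perm (₁ ∷ []) (ev w₂)
          u₁ = perm (₁ ∷ []) (od w₂)
          clash : ∀ a e k → a ℕ.+ e ≡ 2 ℕ.* k → at m (suc (2 ℕ.* a) ℕ.* (suc (2 ℕ.* e))) 1ℤ ≡ 0ℤ
          clash a e k p = at-≢ _ λ eq → true≢false (trans (sym three) (trans (sym (residue a e eq)) (trans (cong par p) (par-2* k))))
          -- In `e = v + suc x`, lowering `v` and raising `x` by one makes an odd `suc x` even. Only
          -- `v = 0` is left over, where `e` is odd and `2e + 1` is 3 modulo 4.
          Wₒ≡ : Wₒ ≡ S (ev u₁) + Wₑ
          Wₒ≡ = trans (zero-suc (₃ ∷ ₂ ∷ ₁ ∷ ₂ ∷ ₃ ∷ []) (ev w₀)) (cong₂ _+_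
            (trans (match (₃ ∷ ₂ ∷ ₁ ∷ ₃ ∷ ₂ ∷ []) (ze w₁) (od w₂) λ { zero zero a x → at-cong refl (λ _ → refl)
                 ; zero (suc d) a x → refl ; (suc v) zero a x → refl ; (suc v) (suc d) a x → refl })
              (only-even (₁ ∷ []) (od w₂) λ { a e zero zero → clash (suc (2 ℕ.* a)) (suc (2 ℕ.* e)) (suc (a ℕ.+ e)) (solve (a ∷ e ∷ []))
                 ; a e zero (suc d) → refl ; a e (suc c) d → refl }))
            (match (₃ ∷ ₂ ∷ ₁ ∷ ₂ ∷ ₃ ∷ []) (su w₁) (od w₀) λ v d a x → cong (⟦=0⟧ d) (at-cong (solve (v ∷ a ∷ x ∷ [])) λ _ → refl)))
          N≡ : S N ≡ S (ev u₁) + S (ev u₁)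
          N≡ = trans (even-odd (₂ ∷ ₁ ∷ ₃ ∷ ₂ ∷ ₃ ∷ []) N) (cong₂ _+_
            (trans (only-odd (₁ ∷ []) (ev w₂) λ { a e zero zero → clash (2 ℕ.* a) (2 ℕ.* e) (a ℕ.+ e) (solve (a ∷ e ∷ []))
                 ; a e zero (suc d) → refl ; a e (suc c) d → refl })
              (match (₁ ∷ []) (od u₀) (ev u₁) λ { a e zero zero → at-cong (solve (a ∷ e ∷ [])) (λ _ → refl)
                 ; a e zero (suc d) → refl ; a e (suc c) d → refl }))
            (only-even (₁ ∷ []) (od w₂) λ { a e zero zero → clash (suc (2 ℕ.* a)) (suc (2 ℕ.* e)) (suc (a ℕ.+ e)) (solve (a ∷ e ∷ []))
                 ; a e zero (suc d) → refl ; a e (suc c) d → refl }))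
          combine : ∀ u {w n e} → w ≡ u + e → n ≡ u + u → + 2 * w ≡ n + + 2 * e
          combine u {e = e} refl refl = linear e u
            where
            linear : ∀ (e u : ℤ) → + 2 * (u + e) ≡ u + u + + 2 * e
            linear = ℤ-Solver.solve-∀

        module _ (h : Bool → ℤ) where
          open Regions h using (QL; H₀)
          open OddRegions h using (b₁; Oau)

          private
            μ : Bool
            μ = par m′
            r₁ r₂ k₁ k₂ k₃ : Cell
            r₁ = perm (₂ ∷ ₁ ∷ ₃ ∷ ₂ ∷ []) (ze (ge b₁))
            r₂ = od (su (ge r₁))
            k₁ = ev (perm (₁ ∷ ₂ ∷ ₃ ∷ []) (ze QL))
            k₂ = ev (perm (₁ ∷ ₂ ∷ []) k₁)
            k₃ = perm (₁ ∷ ₂ ∷ ₃ ∷ []) k₂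

            scaled : ∀ d {x y} c → x ≡ c * y → ⟦=0⟧ d x ≡ c * ⟦=0⟧ d y
            scaled zero    c e = e
            scaled (suc d) c e = sym (ℤₚ.*-zeroʳ c)

          -- On `Y = W` the equation is `W (2X + V) = m`, so `2X + V = 2e + 1` and `X` runs over
          -- `1, …, e`. As `W` is odd, `X + Y` is even exactly for odd `X`.
          H₀≡ : H₀ ≡ h false * Wₒ + h true * Wₑ
          H₀≡ = begin
            H₀                        ≡⟨ only-even (₁ ∷ ₂ ∷ ₃ ∷ []) (ze QL) (λ { v zero w x → q-even h _ _ _ _ (suc v) (ss v) ; v (suc y) w x → refl }) ⟩
            S k₁                      ≡⟨ only-even (₁ ∷ ₂ ∷ []) k₁ (λ { w v zero x → q-even-W h _ _ _ _ (suc w) (ss w) ; w v (suc y) x → refl }) ⟩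
            S k₂                      ≡⟨ even-odd (₁ ∷ ₂ ∷ ₃ ∷ []) k₂ ⟩
            S (ev k₃) + S (od k₃)     ≡⟨ cong₂ _+_
              (S-scale (₃ ∷ ₂ ∷ []) (ev k₃) (ev w₀) (h false) λ x w v y → scaled y (h false)
                (trans (q≡at (suc (2 ℕ.* w) ℕ.* suc (2 ℕ.* (v ℕ.+ suc (2 ℕ.* x)))) (solve (x ∷ w ∷ v ∷ []))) (trans (at-cong refl λ _ → cong h (par-≡ 0 (suc (x ℕ.+ w)) {suc (2 ℕ.* x) ℕ.+ suc (2 ℕ.* w ℕ.+ 0)} {0} (solve (x ∷ w ∷ [])))) (at-const _ _ _))))
              (S-scale (₃ ∷ ₂ ∷ []) (od k₃) (od w₀) (h true) λ x w v y → scaled y (h true)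
                (trans (q≡at (suc (2 ℕ.* w) ℕ.* suc (2 ℕ.* (v ℕ.+ suc (suc (2 ℕ.* x))))) (solve (x ∷ w ∷ v ∷ []))) (trans (at-cong refl λ _ → cong h (par-≡ 0 (suc (x ℕ.+ w)) {suc (suc (2 ℕ.* x)) ℕ.+ suc (2 ℕ.* w ℕ.+ 0)} {1} (solve (x ∷ w ∷ [])))) (at-const _ _ _)))) ⟩
            h false * Wₒ + h true * Wₑ ∎
            where
            ss : ∀ k → suc (suc (2 ℕ.* k)) ≡ 2 ℕ.* suc k
            ss = solve-∀

          -- On `u = a` the equation is `a (c + w)/2 = m`. The case `c = w` counts factorisations.
          -- For `c > w` the factor `(c + w)/2` is odd, which forces `c − w = 4 suc x` and
          -- `(c + w)/2 = 2e + 1` with `e = ω + suc x`; the class then follows from `residue`. The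
          -- case `c < w` is symmetric.
          Oau≡ : Oau ≡ h μ * S N + (h (not μ) * Wₒ + h μ * Wₑ) + (h (not μ) * Wₒ + h μ * Wₑ)
          Oau≡ = trans (split (₂ ∷ ₁ ∷ ₃ ∷ ₂ ∷ []) (ze (ge b₁))) (cong₂ _+_ (trans (S-zs (ge r₁)) (cong₂ _+_ equal above)) (trans below above))
            where
            equal : S (ze (ge r₁)) ≡ h μ * S N
            equal = S-scale (₂ ∷ ₃ ∷ []) (ze (ge r₁)) N (h μ) λ s w u a → scaled s (h μ) (scaled u (h μ)
              (trans (o≡at (suc (2 ℕ.* a) ℕ.* suc (2 ℕ.* w)) (solve (a ∷ w ∷ []))) (trans (at-cong refl λ e → cong h (trans (cong (λ n → par (n ℕ.+ w)) (ℕₚ.+-identityʳ a)) (residue a w e))) (at-const _ _ _))))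
            below : S (lt r₁) ≡ S (su (ge r₁))
            below = match (₁ ∷ []) (lt r₁) (su (ge r₁)) λ c w u a → cong (⟦=0⟧ u)
              (trans (o-pair h a c (a ℕ.+ 0) (suc c ℕ.+ w)) (o-cong 0 0 (solve (c ∷ w ∷ a ∷ [])) (solve (c ∷ a ∷ []))))
            above : S (su (ge r₁)) ≡ h (not μ) * Wₒ + h μ * Wₑ
            above = begin
              S (su (ge r₁))            ≡⟨ only-odd [] (su (ge r₁)) (λ { s w zero a → o-4 h _ _ _ _ _ (suc (2 ℕ.* a) ℕ.* suc (w ℕ.+ s)) (solve (s ∷ w ∷ a ∷ [])) ; s w (suc u) a → refl }) ⟩
              S r₂                      ≡⟨ S-eo r₂ ⟩
              S (ev r₂) + S (od r₂)     ≡⟨ cong₂ _+_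
                (S-scale (₂ ∷ ₃ ∷ []) (ev r₂) (ev w₀) (h (not μ)) λ x w u a → scaled u (h (not μ))
                  (trans (o≡at (suc (2 ℕ.* a) ℕ.* suc (2 ℕ.* (w ℕ.+ suc (2 ℕ.* x)))) (solve (x ∷ w ∷ a ∷ []))) (trans (at-cong refl λ e → cong h (odd-part x w a e)) (at-const _ _ _))))
                (S-scale (₂ ∷ ₃ ∷ []) (od r₂) (od w₀) (h μ) λ x w u a → scaled u (h μ)
                  (trans (o≡at (suc (2 ℕ.* a) ℕ.* suc (2 ℕ.* (w ℕ.+ suc (suc (2 ℕ.* x))))) (solve (x ∷ w ∷ a ∷ []))) (trans (at-cong refl λ e → cong h
                    (trans (par-≡ (suc x) 0 {(a ℕ.+ 0) ℕ.+ w} {a ℕ.+ (w ℕ.+ suc (suc (2 ℕ.* x)))} (solve (x ∷ w ∷ a ∷ []))) (residue a (w ℕ.+ suc (suc (2 ℕ.* x))) e))) (at-const _ _ _)))) ⟩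
              h (not μ) * Wₒ + h μ * Wₑ ∎
              where
              odd-part : ∀ x w a → suc (2 ℕ.* a) ℕ.* suc (2 ℕ.* (w ℕ.+ suc (2 ℕ.* x))) ≡ m → par ((a ℕ.+ 0) ℕ.+ w) ≡ not μ
              odd-part x w a e = trans (sym (not-involutive _)) (cong not (trans
                (par-≡ x 0 {suc ((a ℕ.+ 0) ℕ.+ w)} {a ℕ.+ (w ℕ.+ suc (2 ℕ.* x))} (solve (x ∷ w ∷ a ∷ []))) (residue a (w ℕ.+ suc (2 ℕ.* x)) e)))

      even-class odd-class : Bool → ℤ
      even-class b = if b then 0ℤ else 1ℤ
      odd-class  b = if b then 1ℤ else 0ℤ

      private
        even-value : ∀ μ n o e → (μ ≡ true → + 2 * o ≡ n + + 2 * e) →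
          even-class μ * n + (even-class (not μ) * o + even-class μ * e) + (even-class (not μ) * o + even-class μ * e)
            + + 2 * (1ℤ * o + 0ℤ * e) ≡ n + + 2 * (o + e)
        even-value false n o e _ = linear n o e
          where
          linear : ∀ n o e → 1ℤ * n + (0ℤ * o + 1ℤ * e) + (0ℤ * o + 1ℤ * e) + + 2 * (1ℤ * o + 0ℤ * e) ≡ n + + 2 * (o + e)
          linear = ℤ-Solver.solve-∀
        even-value true n o e r = trans (linear n o e) (trans (cong (λ s → s + + 2 * o) (r refl)) (linear′ n o e))
          where
          linear : ∀ n o e → 0ℤ * n + (1ℤ * o + 0ℤ * e) + (1ℤ * o + 0ℤ * e) + + 2 * (1ℤ * o + 0ℤ * e) ≡ + 2 * o + + 2 * o
          linear = ℤ-Solver.solve-∀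
          linear′ : ∀ n o e → n + + 2 * e + + 2 * o ≡ n + + 2 * (o + e)
          linear′ = ℤ-Solver.solve-∀
        odd-value : ∀ μ n o e → (μ ≡ true → + 2 * o ≡ n + + 2 * e) →
          odd-class μ * n + (odd-class (not μ) * o + odd-class μ * e) + (odd-class (not μ) * o + odd-class μ * e)
            + + 2 * (0ℤ * o + 1ℤ * e) + n ≡ n + + 2 * (o + e)
        odd-value false n o e _ = linear n o e
          where
          linear : ∀ n o e → 0ℤ * n + (1ℤ * o + 0ℤ * e) + (1ℤ * o + 0ℤ * e) + + 2 * (0ℤ * o + 1ℤ * e) + n ≡ n + + 2 * (o + e)
          linear = ℤ-Solver.solve-∀
        odd-value true n o e r = trans (linear n o e) (trans (cong (λ s → s + (n + + 2 * e)) (sym (r refl))) (linear′ n o e))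
          where
          linear : ∀ n o e → 1ℤ * n + (0ℤ * o + 1ℤ * e) + (0ℤ * o + 1ℤ * e) + + 2 * (0ℤ * o + 1ℤ * e) + n ≡ (n + + 2 * e) + (n + + 2 * e)
          linear = ℤ-Solver.solve-∀
          linear′ : ∀ n o e → + 2 * o + (n + + 2 * e) ≡ n + + 2 * (o + e)
          linear′ = ℤ-Solver.solve-∀
        half : ∃ λ m′ → m ≡ suc (2 ℕ.* m′)
        half = odd-half m m-odd

      -- The two residues of `m` modulo 4 give different combinations of `S N`, `Wₒ` and `Wₑ`; for
      -- residue 3 the relation `3-mod-4` turns the combination into `σ`.
      even-total : OddRegions.Oau even-class + + 2 * Regions.H₀ even-class ≡ σ
      even-total = trans (cong₂ (λ a b → a + + 2 * b) (Oau≡ (proj₁ half) (proj₂ half) even-class) (H₀≡ (proj₁ half) (proj₂ half) even-class))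
        (trans (even-value (par (proj₁ half)) (S N) Wₒ Wₑ (3-mod-4 (proj₁ half) (proj₂ half))) (sym σ≡))

      odd-total : OddRegions.Oau odd-class + + 2 * Regions.H₀ odd-class + S N ≡ σ
      odd-total = trans (cong₂ (λ a b → a + + 2 * b + S N) (Oau≡ (proj₁ half) (proj₂ half) odd-class) (H₀≡ (proj₁ half) (proj₂ half) odd-class))
        (trans (odd-value (par (proj₁ half)) (S N) Wₒ Wₑ (3-mod-4 (proj₁ half) (proj₂ half))) (sym σ≡))

    -- Kronecker's relation for n ≡ 1 mod 4.

    module EvenClass where
      open Divisors using (σ; even-class; even-total)
      open Regions even-class using (c₂; d₂; H₂; G₂)
      open OddRegions even-class using (b₂; Ouw; V; Veq; reduction)
      open Triangles even-class using (T₁; T₂; triangles)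

      -- Solutions of `2m = p² + xy + yz + zx` with `p`, `x`, `y` odd and `z` positive and even;
      -- `K₀` is the case `z = 0`.
      K : Cell
      K = (λ i j z l → at (2 ℕ.* m) (suc (2 ℕ.* l) ℕ.* suc (2 ℕ.* l) ℕ.+ suc (2 ℕ.* i) ℕ.* suc (2 ℕ.* j) ℕ.+ 2 ℕ.* suc z ℕ.* (suc (2 ℕ.* i) ℕ.+ suc (2 ℕ.* j))) 1ℤ) ,
        λ i j z l p → at-≢ _ λ e → <-irrefl (sym e) (<-≤-trans 2m<B (grow p _ (bound i j z l)))
        where
        bound : ∀ i j z l → (i ℕ.+ j ℕ.+ z ℕ.+ l) ℕ.+ (6 ℕ.+ 5 ℕ.* i ℕ.+ 5 ℕ.* j ℕ.+ 3 ℕ.* z ℕ.+ 3 ℕ.* l ℕ.+ 4 ℕ.* l ℕ.* l ℕ.+ 4 ℕ.* i ℕ.* j ℕ.+ 4 ℕ.* z ℕ.* (i ℕ.+ j))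
              ≡ suc (2 ℕ.* l) ℕ.* suc (2 ℕ.* l) ℕ.+ suc (2 ℕ.* i) ℕ.* suc (2 ℕ.* j) ℕ.+ 2 ℕ.* suc z ℕ.* (suc (2 ℕ.* i) ℕ.+ suc (2 ℕ.* j))
        bound = solve-∀

      K₀ : ℤ
      K₀ = Σ (λ l → Σ (λ i → Σ (λ j → at (2 ℕ.* m) (suc (2 ℕ.* l) ℕ.* suc (2 ℕ.* l) ℕ.+ suc (2 ℕ.* i) ℕ.* suc (2 ℕ.* j)) 1ℤ)))

      private
        k₁ v₁ v₂ v₃ v₄ : Cell
        k₁ = perm (₂ ∷ ₁ ∷ ₃ ∷ ₂ ∷ []) K
        v₁ = od (perm (₁ ∷ ₂ ∷ []) V)
        v₂ = ev (perm (₁ ∷ []) v₁)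
        v₃ = ev (perm (₁ ∷ ₂ ∷ []) v₂)
        v₄ = perm (₁ ∷ ₂ ∷ ₃ ∷ []) T₁

        class-0 : ∀ X Y V W k → X ℕ.+ Y ≡ 2 ℕ.* k ℕ.+ W → q even-class X Y V W ≡ 0ℤ
        class-0 X Y V W k e = trans (q≡at-odd _ 0ℤ refl λ _ oW → cong even-class (trans (cong par e) (trans (par-2*+ k W) oW))) (at-const-0 m _)

        u-0 : ∀ t w {a c} → par (suc t) ≡ true → o even-class a c (suc (2 ℕ.* w) ℕ.+ 2 ℕ.* suc t) (suc (2 ℕ.* w)) (suc t) ≡ 0ℤ
        u-0 t w p = trans (o≡at₂ _ refl) (trans (cong (at (2 ℕ.* m) _) (cong even-class p)) (at-const-0 _ _))

      Ouw≡ : Ouw ≡ K₀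
      Ouw≡ = trans (S-cong′ (ze (ge b₂)) λ d w a c → cong (⟦=0⟧ d) (trans (o≡at₂ (suc (2 ℕ.* w) ℕ.* suc (2 ℕ.* w) ℕ.+ suc (2 ℕ.* a) ℕ.* suc (2 ℕ.* c)) (solve (w ∷ a ∷ c ∷ [])))
          (at-cong refl λ _ → cong even-class (trans (par-≡ 0 0 {(w ℕ.+ 0) ℕ.+ w} {2 ℕ.* w} (solve (w ∷ []))) (par-2* w)))))
        (S-dummy λ w a c → at (2 ℕ.* m) (suc (2 ℕ.* w) ℕ.* suc (2 ℕ.* w) ℕ.+ suc (2 ℕ.* a) ℕ.* suc (2 ℕ.* c)) 1ℤ)

      Veq≡0 : S Veq ≡ 0ℤ
      Veq≡0 = S-0 Veq λ { zero y t w → odd-only-true (suc t) λ p → odd-only-0 (suc t ℕ.+ suc y) (u-0 t w p) ; (suc d) y t w → refl }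

      T₂≡0 : S T₂ ≡ 0ℤ
      T₂≡0 = S-0 T₂ λ i j l v → class-0 _ _ _ _ (suc l) (solve (i ∷ j ∷ l ∷ []))

      H₂≡0 : H₂ ≡ 0ℤ
      H₂≡0 = S-0 (ze (ge c₂)) λ { zero x w v → class-0 _ _ _ _ (suc x) (solve (x ∷ w ∷ [])) ; (suc y) x w v → refl }

      G₂≡0 : G₂ ≡ 0ℤ
      G₂≡0 = S-0 (ze (ge d₂)) λ { zero x y w → trans (q≡at-odd _ 0ℤ refl λ oV _ → cong even-class (trans (par-≡ 0 0 {suc x ℕ.+ suc y} {suc (suc y ℕ.+ (x ℕ.+ 0))} (solve (x ∷ y ∷ []))) oV)) (at-const-0 m _)
                                ; (suc v) x y w → refl }

      -- For `p > z` put `T = z`, `w = p − z`, `a = x + z`, `c = y + z`, which is `V`. For `p < z`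
      -- put `X = (x + p)/2`, `Y = (y + p)/2`, `V = z − p`, `W = (x + y)/2`, which is `T₁`. Parity
      -- excludes `p = z`.
      K-split : S K ≡ S T₁ + S V
      K-split = trans (split (₂ ∷ ₁ ∷ ₃ ∷ ₂ ∷ []) K) (cong₂ _+_
        (sym (trans (only-even (₁ ∷ ₂ ∷ ₃ ∷ []) T₁ λ v i j l → q-even _ _ _ _ _ (suc v) (solve (v ∷ []))) (match (₃ ∷ ₂ ∷ []) (ev v₄) (ge k₁) λ v i j l →
          trans (q≡at-odd _ 1ℤ refl λ _ oW → cong even-class (class i j l oW)) (trans (sym (at-mul 1 m _ 1ℤ)) (at-cong (solve (v ∷ i ∷ j ∷ l ∷ [])) λ _ → refl)))))
        (sym (trans (only-odd (₁ ∷ ₂ ∷ []) V λ t x y w → odd-only-0 (suc (2 ℕ.* t) ℕ.+ suc x) (odd-only-0 (suc (2 ℕ.* t) ℕ.+ suc y) (u-0 (2 ℕ.* t) w (cong not (par-2* t)))))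
          (trans (only-even (₁ ∷ []) v₁ λ x t y w → odd-only-even _ (suc t ℕ.+ suc x) (solve (t ∷ x ∷ [])))
          (trans (only-even (₁ ∷ ₂ ∷ []) v₂ λ y x t w → odd-only-0 (suc (suc (2 ℕ.* t)) ℕ.+ suc (2 ℕ.* x)) (odd-only-even _ (suc t ℕ.+ suc y) (solve (t ∷ y ∷ []))))
          (match (₂ ∷ ₁ ∷ ₃ ∷ ₂ ∷ ₃ ∷ []) v₃ (lt k₁) λ y x t w →
            trans (odd-only-odd′ (suc t ℕ.+ x) (solve (t ∷ x ∷ []))) (trans (odd-only-odd′ (suc t ℕ.+ y) (solve (t ∷ y ∷ [])))
              (trans (o≡at₂ _ refl) (trans (cong (at (2 ℕ.* m) _) (cong even-class (trans (not-involutive _) (par-2* t))))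
                (at-cong (solve (y ∷ x ∷ t ∷ w ∷ [])) λ _ → refl))))))))))
        where
        class : ∀ i j l → par (suc (i ℕ.+ j)) ≡ true → par (suc (i ℕ.+ l) ℕ.+ suc (j ℕ.+ l)) ≡ false
        class i j l p = trans (par-≡ 0 l {suc (i ℕ.+ l) ℕ.+ suc (j ℕ.+ l)} {suc (suc (i ℕ.+ j))} (solve (i ∷ j ∷ l ∷ []))) (cong not p)

      kronecker : K₀ + + 2 * S K ≡ σ
      kronecker = trans (combine K₀ (S T₁) (S V) K-split Ouw≡ Veq≡0 T₂≡0 H₂≡0 G₂≡0 triangles reduction) even-total
        where
        linear : ∀ k₀ t₁ v → k₀ + + 2 * (t₁ + v) ≡ + 2 * v + + 2 * 0ℤ + k₀ + (+ 2 * t₁ + + 2 * 0ℤ + + 2 * 0ℤ + 0ℤ)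
        linear = ℤ-Solver.solve-∀
        combine : ∀ k₀ t₁ v {k t₂ veq uw h₂ g₂ tb r} → k ≡ t₁ + v → uw ≡ k₀ → veq ≡ 0ℤ → t₂ ≡ 0ℤ → h₂ ≡ 0ℤ → g₂ ≡ 0ℤ →
          tb ≡ + 2 * t₁ + + 2 * t₂ + + 2 * h₂ + g₂ → + 2 * v + + 2 * veq + uw + tb ≡ r → k₀ + + 2 * k ≡ r
        combine k₀ t₁ v refl refl refl refl refl refl refl e = trans (linear k₀ t₁ v) e

    -- Kronecker's relation for 2n ≡ 2 mod 4.

    module OddClass where
      open Divisors using (σ; N; odd-class; odd-total)
      open Regions odd-class using (c₂; d₂; H₂; G₂)
      open OddRegions odd-class using (b₂; Ouw; V; Veq; reduction)
      open Triangles odd-class using (T₁; T₂; triangles)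

      -- After doubling, `K` reads `2m = (2p)² + xy + yz + zx` with `p` positive, `x` and `y`
      -- positive and even, and `z` positive, hence odd as `m` is. In `J` one of the two even
      -- variables is 0.
      K J : Cell
      K = (λ i j z p → at m (2 ℕ.* suc i ℕ.* suc j ℕ.+ suc z ℕ.* (suc i ℕ.+ suc j) ℕ.+ 2 ℕ.* suc p ℕ.* suc p) 1ℤ) ,
        λ i j z p le → at-≢ _ λ e → <-irrefl (sym e) (<-≤-trans m<B (grow le _ (bound i j z p)))
        where
        bound : ∀ i j z p → (i ℕ.+ j ℕ.+ z ℕ.+ p) ℕ.+ (6 ℕ.+ 2 ℕ.* i ℕ.+ 2 ℕ.* j ℕ.+ z ℕ.+ 3 ℕ.* p ℕ.+ 2 ℕ.* i ℕ.* j ℕ.+ z ℕ.* (i ℕ.+ j) ℕ.+ 2 ℕ.* p ℕ.* p)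
              ≡ 2 ℕ.* suc i ℕ.* suc j ℕ.+ suc z ℕ.* (suc i ℕ.+ suc j) ℕ.+ 2 ℕ.* suc p ℕ.* suc p
        bound = solve-∀
      J = (λ d y z p → ⟦=0⟧ d (at m (suc y ℕ.* suc z ℕ.+ 2 ℕ.* suc p ℕ.* suc p) 1ℤ)) ,
        λ { zero y z p le → at-≢ _ λ e → <-irrefl (sym e) (<-≤-trans m<B (grow le _ (bound y z p))) ; (suc d) y z p le → refl }
        where
        bound : ∀ y z p → (y ℕ.+ z ℕ.+ p) ℕ.+ (3 ℕ.+ y ℕ.* z ℕ.+ 3 ℕ.* p ℕ.+ 2 ℕ.* p ℕ.* p) ≡ suc y ℕ.* suc z ℕ.+ 2 ℕ.* suc p ℕ.* suc p
        bound = solve-∀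

      K₀ : ℤ
      K₀ = Σ (λ i → Σ (λ j → Σ (λ z → at m (2 ℕ.* suc i ℕ.* suc j ℕ.+ suc z ℕ.* (suc i ℕ.+ suc j)) 1ℤ)))

      private
        k₁ k₂ j₁ j₂ v₁ v₂ v₃ v₄ w₁ w₂ x₁ : Cell
        k₁ = perm (₁ ∷ ₂ ∷ []) K
        k₂ = perm (₁ ∷ ₂ ∷ ₃ ∷ []) (ev k₁)
        j₁ = perm (₁ ∷ ₂ ∷ []) J
        j₂ = perm (₁ ∷ ₂ ∷ ₃ ∷ []) (ev j₁)
        v₁ = ev (perm (₁ ∷ ₂ ∷ []) V)
        v₂ = od (perm (₁ ∷ []) v₁)
        v₃ = od (perm (₁ ∷ ₂ ∷ []) v₂)
        v₄ = perm (₁ ∷ ₂ ∷ ₃ ∷ []) T₂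
        w₁ = ev (perm (₁ ∷ ₂ ∷ []) Veq)
        w₂ = od (perm (₁ ∷ ₂ ∷ []) w₁)
        x₁ = perm (₁ ∷ ₂ ∷ ₃ ∷ []) (ze (ge c₂))

        class-0 : ∀ X Y V W k → X ℕ.+ Y ≡ 2 ℕ.* k ℕ.+ suc W → q odd-class X Y V W ≡ 0ℤ
        class-0 X Y V W k e = trans (q≡at-odd _ 0ℤ refl λ _ oW → cong odd-class (trans (cong par e) (trans (par-2*+ k (suc W)) (cong not oW)))) (at-const-0 m _)

        class-1 : ∀ X Y V W n k → 2 ℕ.* X ℕ.* Y ℕ.+ V ℕ.* W ≡ n → X ℕ.+ Y ≡ 2 ℕ.* k ℕ.+ W → q odd-class X Y V W ≡ at m n 1ℤ
        class-1 X Y V W n k e p = q≡at-odd n 1ℤ e λ _ oW → cong odd-class (trans (cong par p) (trans (par-2*+ k W) oW))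

        even-0 : ∀ n k → n ≡ 2 ℕ.* k → at m n 1ℤ ≡ 0ℤ
        even-0 n k e = at-≢ _ λ e′ → true≢false (trans (sym m-odd) (trans (cong par (trans (sym e′) e)) (par-2* k)))

        u-0 : ∀ t w {a c} → par (suc t) ≡ false → o odd-class a c (suc (2 ℕ.* w) ℕ.+ 2 ℕ.* suc t) (suc (2 ℕ.* w)) (suc t) ≡ 0ℤ
        u-0 t w p = trans (o≡at₂ _ refl) (trans (cong (at (2 ℕ.* m) _) (cong odd-class p)) (at-const-0 _ _))

        u-1 : ∀ t {a c w} n → a ℕ.* c ℕ.+ (suc (2 ℕ.* w) ℕ.+ 2 ℕ.* suc (2 ℕ.* t)) ℕ.* suc (2 ℕ.* w) ≡ 2 ℕ.* n →
              o odd-class a c (suc (2 ℕ.* w) ℕ.+ 2 ℕ.* suc (2 ℕ.* t)) (suc (2 ℕ.* w)) (suc (2 ℕ.* t)) ≡ at m n 1ℤ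
        u-1 t n e = trans (o≡at n e) (cong (λ b → at m n (odd-class b)) (cong not (par-2* t)))

      Ouw≡0 : Ouw ≡ 0ℤ
      Ouw≡0 = S-0 (ze (ge b₂)) λ { zero w a c → trans (o≡at₂ _ refl) (trans (at-cong refl λ _ → cong odd-class (trans (par-≡ 0 0 {(w ℕ.+ 0) ℕ.+ w} {2 ℕ.* w} (solve (w ∷ []))) (par-2* w))) (at-const-0 _ _))
                                 ; (suc d) w a c → refl }

      T₁≡0 : S T₁ ≡ 0ℤ
      T₁≡0 = S-0 T₁ λ i j l v → class-0 _ _ _ _ l (solve (i ∷ j ∷ l ∷ []))

      G₂≡ : G₂ ≡ K₀
      G₂≡ = trans (S-cong′ (ze (ge d₂)) λ d x y w → cong (⟦=0⟧ d) (q≡at-odd (2 ℕ.* suc x ℕ.* suc y ℕ.+ suc w ℕ.* (suc x ℕ.+ suc y)) 1ℤ (solve (x ∷ y ∷ w ∷ []))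
          λ oV _ → cong odd-class (trans (par-≡ 0 0 {suc x ℕ.+ suc y} {suc (suc y ℕ.+ (x ℕ.+ 0))} (solve (x ∷ y ∷ []))) oV)))
        (S-dummy λ x y w → at m (2 ℕ.* suc x ℕ.* suc y ℕ.+ suc w ℕ.* (suc x ℕ.+ suc y)) 1ℤ)

      K-split : S K ≡ S V + S T₂
      K-split = trans (only-even (₁ ∷ ₂ ∷ []) K λ z i j p → even-0 _ (suc i ℕ.* suc j ℕ.+ suc z ℕ.* (suc i ℕ.+ suc j) ℕ.+ suc p ℕ.* suc p) (solve (z ∷ i ∷ j ∷ p ∷ [])))
        (trans (split (₁ ∷ ₂ ∷ ₃ ∷ []) (ev k₁)) (cong₂ _+_
          (sym (trans (only-even (₁ ∷ ₂ ∷ []) V λ t x y w → odd-only-0 (suc (suc (2 ℕ.* t)) ℕ.+ suc x) (odd-only-0 (suc (suc (2 ℕ.* t)) ℕ.+ suc y) (u-0 (suc (2 ℕ.* t)) w (trans (not-involutive _) (par-2* t)))))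
            (trans (only-odd (₁ ∷ []) v₁ λ x t y w → odd-only-even _ (t ℕ.+ suc x) (solve (t ∷ x ∷ [])))
            (trans (only-odd (₁ ∷ ₂ ∷ []) v₂ λ y x t w → odd-only-0 (suc (2 ℕ.* t) ℕ.+ suc (suc (2 ℕ.* x))) (odd-only-even _ (t ℕ.+ suc y) (solve (t ∷ y ∷ []))))
            (match (₃ ∷ ₂ ∷ ₁ ∷ ₃ ∷ ₂ ∷ ₃ ∷ []) v₃ (ge k₂) λ y x t w →
              trans (odd-only-odd′ (t ℕ.+ suc x) (solve (t ∷ x ∷ []))) (trans (odd-only-odd′ (t ℕ.+ suc y) (solve (t ∷ y ∷ []))) (trans (u-1 t {suc (2 ℕ.* t) ℕ.+ suc (suc (2 ℕ.* x))} {suc (2 ℕ.* t) ℕ.+ suc (suc (2 ℕ.* y))} {w} (2 ℕ.* suc x ℕ.* suc y ℕ.+ suc (2 ℕ.* t) ℕ.* (suc x ℕ.+ suc y) ℕ.+ 2 ℕ.* suc (t ℕ.+ w) ℕ.* suc (t ℕ.+ w)) (solve (y ∷ x ∷ t ∷ w ∷ []))) (at-cong refl λ _ → refl))))))))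
          (sym (trans (only-even (₁ ∷ ₂ ∷ ₃ ∷ []) T₂ λ v i j l → q-even _ _ _ _ _ (suc v) (solve (v ∷ []))) (match (₃ ∷ ₂ ∷ ₁ ∷ []) (ev v₄) (lt k₂) λ v i j l →
            class-1 _ _ _ _ _ (suc l) (solve (v ∷ i ∷ j ∷ l ∷ [])) (solve (i ∷ j ∷ l ∷ [])))))))

      J-split : S J ≡ S Veq + H₂
      J-split = trans (only-even (₁ ∷ ₂ ∷ []) J λ { z zero y p → odd-0 z y p ; z (suc d) y p → refl })
        (trans (split (₁ ∷ ₂ ∷ ₃ ∷ []) (ev j₁)) (cong₂ _+_
          (sym (trans (only-even (₁ ∷ ₂ ∷ []) Veq λ { t zero y w → odd-only-even _ (suc t) (solve (t ∷ [])) ; t (suc d) y w → refl })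
            (trans (only-odd (₁ ∷ ₂ ∷ []) w₁ λ { y t zero w → odd-only-0 (suc (2 ℕ.* t)) (odd-only-even _ (suc (t ℕ.+ y)) (solve (t ∷ y ∷ []))) ; y t (suc d) w → refl })
            (match (₃ ∷ ₂ ∷ ₁ ∷ ₂ ∷ ₃ ∷ []) w₂ (ge j₂) λ y t d w → cong (⟦=0⟧ d) (trans (odd-only-odd′ t refl) (trans (odd-only-odd′ (t ℕ.+ suc y) (solve (t ∷ y ∷ [])))
              (u-1 t {suc (2 ℕ.* t)} {suc (2 ℕ.* t) ℕ.+ suc (suc (2 ℕ.* y))} {w} (suc y ℕ.* suc (2 ℕ.* t) ℕ.+ 2 ℕ.* suc (t ℕ.+ w) ℕ.* suc (t ℕ.+ w)) (solve (y ∷ t ∷ w ∷ [])))))))))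
          (sym (trans (only-even (₁ ∷ ₂ ∷ ₃ ∷ []) (ze (ge c₂)) λ { v zero x w → q-even _ _ _ _ _ (suc v) (solve (v ∷ [])) ; v (suc y) x w → refl })
            (match (₂ ∷ ₁ ∷ []) (ev x₁) (lt j₂) λ v y x w → cong (⟦=0⟧ y) (class-1 _ _ _ _ _ (suc x) (solve (v ∷ x ∷ w ∷ [])) (solve (x ∷ w ∷ []))))))))
        where
        odd-0 : ∀ z y p → at m (suc y ℕ.* suc (suc (2 ℕ.* z)) ℕ.+ 2 ℕ.* suc p ℕ.* suc p) 1ℤ ≡ 0ℤ
        odd-0 z y p = even-0 _ (suc y ℕ.* suc z ℕ.+ suc p ℕ.* suc p) (solve (z ∷ y ∷ p ∷ []))

      -- `S N` and `K₀` are the terms of the zero square, `J` and `K` those of a nonzero square,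
      -- doubled for the sign of its root; in `S N` and `J` one even variable vanishes.
      kronecker : S N + K₀ + + 2 * S J + + 2 * S K ≡ σ
      kronecker = trans (combine (S N) K₀ (S T₂) (S V) (S Veq) H₂ K-split J-split Ouw≡0 T₁≡0 G₂≡ triangles reduction) odd-total
        where
        linear : ∀ n k₀ t₂ v veq h₂ → n + k₀ + + 2 * (veq + h₂) + + 2 * (v + t₂) ≡ + 2 * v + + 2 * veq + 0ℤ + (+ 2 * 0ℤ + + 2 * t₂ + + 2 * h₂ + k₀) + n
        linear = ℤ-Solver.solve-∀
        combine : ∀ n k₀ t₂ v veq h₂ {k j t₁ uw g₂ tb r} → k ≡ v + t₂ → j ≡ veq + h₂ → uw ≡ 0ℤ → t₁ ≡ 0ℤ → g₂ ≡ k₀ →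
          tb ≡ + 2 * t₁ + + 2 * t₂ + + 2 * h₂ + g₂ → + 2 * v + + 2 * veq + uw + tb ≡ r → n + k₀ + + 2 * j + + 2 * k ≡ r + n
        combine n k₀ t₂ v veq h₂ refl refl refl refl refl refl e = trans (linear n k₀ t₂ v veq h₂) (cong (_+ n) e)

  -- Representations by xy + yz + zx with x, y, z odd

  module Bilinear (m : ℕ) (m-odd : par m ≡ true) (B : ℕ) (0<B : 0 < B) (m<B : m < B) where

    open Sums B 0<B

    abstract
      r : ℕ → ℕ → ℕ → ℕ → ℤ
      r a c u w = at m (a ℕ.* c ℕ.+ u ℕ.* w) 1ℤ

      r≡at : ∀ a c u w n → a ℕ.* c ℕ.+ u ℕ.* w ≡ n → r a c u w ≡ at m n 1ℤ
      r≡at a c u w n e = cong (λ n → at m n 1ℤ) e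

      r-cong : ∀ {a c u w a′ c′ u′ w′} → a ℕ.* c ℕ.+ u ℕ.* w ≡ a′ ℕ.* c′ ℕ.+ u′ ℕ.* w′ → r a c u w ≡ r a′ c′ u′ w′
      r-cong e = cong (λ n → at m n 1ℤ) e

      r-even : ∀ a c u w k → a ℕ.* c ℕ.+ u ℕ.* w ≡ 2 ℕ.* k → r a c u w ≡ 0ℤ
      r-even a c u w k e = at-≢ _ λ e′ → true≢false (trans (sym m-odd) (trans (cong par (trans (sym e′) e)) (par-2* k)))

      r-par : ∀ a c u w → (par a ∧ par c) xor (par u ∧ par w) ≡ false → r a c u w ≡ 0ℤ
      r-par a c u w e = at-≢ {m} {a ℕ.* c ℕ.+ u ℕ.* w} 1ℤ λ e′ → true≢false (begin
        true                                    ≡⟨ sym (trans (cong par e′) m-odd) ⟩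
        par (a ℕ.* c ℕ.+ u ℕ.* w)               ≡⟨ par-+ (a ℕ.* c) (u ℕ.* w) ⟩
        par (a ℕ.* c) xor par (u ℕ.* w)         ≡⟨ cong₂ _xor_ (par-* a c) (par-* u w) ⟩
        (par a ∧ par c) xor (par u ∧ par w)     ≡⟨ e ⟩
        false                                   ∎)

      r-large : ∀ a c u w n k → B ≤ n → n ℕ.+ k ≡ a ℕ.* c ℕ.+ u ℕ.* w → r a c u w ≡ 0ℤ
      r-large a c u w n k p e = at-≢ _ λ e′ → <-irrefl (sym e′) (<-≤-trans m<B (grow p k e))

    private
      par-ss : ∀ k → par (suc (suc (2 ℕ.* k))) ≡ false
      par-ss k = trans (not-involutive _) (par-2* k)

      par-gap : ∀ n d → par n ∧ par (n ℕ.+ suc (2 ℕ.* d)) ≡ false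
      par-gap n d = trans (cong (par n ∧_) (trans (par-+ n (suc (2 ℕ.* d))) (cong (par n xor_) (par-odd d)))) (clash (par n))
        where clash : ∀ b → b ∧ (b xor true) ≡ false
              clash true  = refl
              clash false = refl

      r-0 : ∀ {a c w t} → par a ∧ par c ≡ false → r a c (suc w) (suc w ℕ.+ suc (2 ℕ.* t)) ≡ 0ℤ
      r-0 {a} {c} {w} {t} e = r-par a c (suc w) _ (cong₂ _xor_ e (par-gap (suc w) t))

      r-0ˡ : ∀ {a c w} t → par a ≡ false → r a c (suc w) (suc w ℕ.+ suc (2 ℕ.* t)) ≡ 0ℤ
      r-0ˡ {a} {c} {w} t e = r-0 {a} {c} {w} {t} (cong (_∧ par c) e)

      r-0ʳ : ∀ {a c w} t → par c ≡ false → r a c (suc w) (suc w ℕ.+ suc (2 ℕ.* t)) ≡ 0ℤ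
      r-0ʳ {a} {c} {w} t e = r-0 {a} {c} {w} {t} (trans (cong (par a ∧_) e) (∧-zeroʳ (par a)))

      r-0ᵍ : ∀ {a c w} t d → c ≡ a ℕ.+ suc (2 ℕ.* d) → r a c (suc w) (suc w ℕ.+ suc (2 ℕ.* t)) ≡ 0ℤ
      r-0ᵍ {a} {w = w} t d refl = r-0 {a} {_} {w} {t} (par-gap a d)

    -- All six count solutions of `m = ac + uw`. In `U` the factors of the second product differ by
    -- an odd `T = 2t + 1`, and `A′` adds `T < 2a`, `T < 2c`. `R` asks for `X + Y + W` odd, `Tri`
    -- moreover for the triangle inequalities, its entries being half sums of three odd numbers. `N`
    -- and `L₂` fix the parities of the factors.
    U A′ Tri R N L₂ : Cell
    U = (λ a c t w → r (suc a) (suc c) (suc w) (suc w ℕ.+ suc (2 ℕ.* t))) ,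
      λ a c t w p → r-large _ _ _ _ _ _ p (bound a c t w)
      where
      bound : ∀ a c t w → (a ℕ.+ c ℕ.+ t ℕ.+ w) ℕ.+ (3 ℕ.+ a ℕ.* c ℕ.+ t ℕ.+ 2 ℕ.* w ℕ.+ w ℕ.* w ℕ.+ 2 ℕ.* t ℕ.* w)
              ≡ suc a ℕ.* suc c ℕ.+ suc w ℕ.* (suc w ℕ.+ suc (2 ℕ.* t))
      bound = solve-∀
    A′ = (λ x y t w → r (suc (t ℕ.+ x)) (suc (t ℕ.+ y)) (suc w) (suc w ℕ.+ suc (2 ℕ.* t))) ,
      λ x y t w p → r-large _ _ _ _ _ _ p (bound x y t w)
      where
      bound : ∀ x y t w → (x ℕ.+ y ℕ.+ t ℕ.+ w) ℕ.+ (3 ℕ.+ 3 ℕ.* t ℕ.+ t ℕ.* t ℕ.+ t ℕ.* x ℕ.+ t ℕ.* y ℕ.+ x ℕ.* y ℕ.+ 2 ℕ.* w ℕ.+ w ℕ.* w ℕ.+ 2 ℕ.* t ℕ.* w)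
              ≡ suc (t ℕ.+ x) ℕ.* suc (t ℕ.+ y) ℕ.+ suc w ℕ.* (suc w ℕ.+ suc (2 ℕ.* t))
      bound = solve-∀
    Tri = (λ x y k v → r (suc (x ℕ.+ k)) (suc (y ℕ.+ k)) (suc v) (suc (x ℕ.+ y))) ,
      λ x y k v p → r-large _ _ _ _ _ _ p (bound x y k v)
      where
      bound : ∀ x y k v → (x ℕ.+ y ℕ.+ k ℕ.+ v) ℕ.+ (2 ℕ.+ x ℕ.+ y ℕ.+ k ℕ.+ x ℕ.* y ℕ.+ x ℕ.* k ℕ.+ k ℕ.* y ℕ.+ k ℕ.* k ℕ.+ v ℕ.* x ℕ.+ v ℕ.* y)
              ≡ suc (x ℕ.+ k) ℕ.* suc (y ℕ.+ k) ℕ.+ suc v ℕ.* suc (x ℕ.+ y)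
      bound = solve-∀
    R = (λ x y v w → odd-only (suc x ℕ.+ suc y ℕ.+ suc w) (r (suc x) (suc y) (suc v) (suc w))) ,
      λ x y v w p → odd-only-0 (suc x ℕ.+ suc y ℕ.+ suc w) (r-large _ _ _ _ _ _ p (bound x y v w))
      where
      bound : ∀ x y v w → (x ℕ.+ y ℕ.+ v ℕ.+ w) ℕ.+ (2 ℕ.+ x ℕ.* y ℕ.+ v ℕ.* w) ≡ suc x ℕ.* suc y ℕ.+ suc v ℕ.* suc w
      bound = solve-∀
    N = (λ a c o e → r (suc (2 ℕ.* a)) (suc (2 ℕ.* c)) (suc (2 ℕ.* o)) (2 ℕ.* suc e)) ,
      λ a c o e p → r-large _ _ _ _ _ _ p (bound a c o e)
      where
      bound : ∀ a c o e → (a ℕ.+ c ℕ.+ o ℕ.+ e) ℕ.+ (3 ℕ.+ a ℕ.+ c ℕ.+ 4 ℕ.* a ℕ.* c ℕ.+ 3 ℕ.* o ℕ.+ e ℕ.+ 4 ℕ.* o ℕ.* e)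
              ≡ suc (2 ℕ.* a) ℕ.* suc (2 ℕ.* c) ℕ.+ suc (2 ℕ.* o) ℕ.* (2 ℕ.* suc e)
      bound = solve-∀
    L₂ = (λ v w x y → r (suc (2 ℕ.* v)) (suc (2 ℕ.* w)) (2 ℕ.* suc x) (2 ℕ.* suc y)) ,
      λ v w x y p → r-large _ _ _ _ _ _ p (bound v w x y)
      where
      bound : ∀ v w x y → (v ℕ.+ w ℕ.+ x ℕ.+ y) ℕ.+ (5 ℕ.+ v ℕ.+ w ℕ.+ 4 ℕ.* v ℕ.* w ℕ.+ 3 ℕ.* x ℕ.+ 3 ℕ.* y ℕ.+ 4 ℕ.* x ℕ.* y)
              ≡ suc (2 ℕ.* v) ℕ.* suc (2 ℕ.* w) ℕ.+ (2 ℕ.* suc x) ℕ.* (2 ℕ.* suc y)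
      bound = solve-∀

    -- U = A′ + 2F + G and F = N(c < w), splitting by the sign of a − c and by T against 2a and a + c.
    u₁ Us u₂ u₃ u₄ a₁ As h₁ f₁ f₂ g₁ g₂ g₃ Gc g₄ gd : Cell
    u₁ = perm (₁ ∷ []) U
    Us = od (su (ge u₁))
    u₂ = perm (₂ ∷ ₁ ∷ []) (ze (ge u₁))
    u₃ = perm (₂ ∷ ₁ ∷ []) Us
    u₄ = perm (₂ ∷ ₁ ∷ ₂ ∷ []) (ev (lt u₃))
    a₁ = perm (₁ ∷ []) A′
    As = od (su (ge a₁))
    h₁ = perm (₂ ∷ ₁ ∷ ₃ ∷ []) U
    f₁ = ev (lt h₁)
    f₂ = ev (perm (₁ ∷ ₂ ∷ []) f₁)
    g₁ = ev U
    g₂ = ev (perm (₁ ∷ []) g₁)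
    g₃ = perm (₂ ∷ []) (ge (perm (₂ ∷ ₁ ∷ ₂ ∷ []) g₂))
    Gc = su (ge g₃)
    g₄ = perm (₂ ∷ ₁ ∷ []) Gc
    gd = ev (lt u₂)

    F Nc= Nc> Nc< G : ℤ
    F   = S (ge u₄)
    Nc= = S (ze (ge h₁))
    Nc> = S (su (ge h₁))
    Nc< = S (lt h₁)
    G   = S Gc

    U≡A′FG : S U ≡ S A′ + + 2 * F + G
    U≡A′FG = combine (S (ge u₂)) (S gd) (S (ge u₃)) (S (lt u₄)) F U≡ diagonal off A′≡ G≡
      where
      U≡ : S U ≡ S (ze (ge u₁)) + S Us + S Us
      U≡ = trans (split (₁ ∷ []) U) (trans (cong₂ _+_ (S-zs (ge u₁)) (match (₁ ∷ []) (lt u₁) (su (ge u₁)) λ c a t w → r-cong (solve (c ∷ a ∷ t ∷ w ∷ []))))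
        (cong₂ (λ p q → S (ze (ge u₁)) + p + q) odd-gap odd-gap))
        where
        odd-gap : S (su (ge u₁)) ≡ S Us
        odd-gap = only-odd [] (su (ge u₁)) λ d a t w → r-0ᵍ t d refl
      diagonal : S (ze (ge u₁)) ≡ S (ge u₂) + S gd
      diagonal = trans (split (₂ ∷ ₁ ∷ []) (ze (ge u₁))) (cong (λ s → S (ge u₂) + s)
        (only-even [] (lt u₂) λ { a t zero w → r-0ˡ (suc (suc (2 ℕ.* a)) ℕ.+ t) (par-ss a) ; a t (suc d) w → refl }))
      off : S Us ≡ S (ge u₃) + (F + S (lt u₄))
      off = trans (split (₂ ∷ ₁ ∷ []) Us) (cong (λ s → S (ge u₃) + s) (trans
        (only-even [] (lt u₃) λ a t s w → r-0ˡ (suc (suc (2 ℕ.* a)) ℕ.+ t) (par-ss a)) (split (₂ ∷ ₁ ∷ ₂ ∷ []) (ev (lt u₃)))))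
      A′≡ : S A′ ≡ S (ge u₂) + S (ge u₃) + S (ge u₃)
      A′≡ = trans (split (₁ ∷ []) A′) (trans (cong₂ _+_ (S-zs (ge a₁)) (match (₁ ∷ []) (lt a₁) (su (ge a₁)) λ y x t w → r-cong (solve (y ∷ x ∷ t ∷ w ∷ []))))
        (cong₂ _+_ (cong₂ _+_ (match (₁ ∷ ₂ ∷ []) (ze (ge a₁)) (ge u₂) λ d x t w → cong (⟦=0⟧ d) (r-cong (solve (x ∷ t ∷ w ∷ [])))) odd-gap) odd-gap))
        where
        odd-gap : S (su (ge a₁)) ≡ S (ge u₃)
        odd-gap = trans (only-odd [] (su (ge a₁)) λ d x t w → r-0ᵍ t d (gap d x t))
          (match (₁ ∷ ₂ ∷ []) As (ge u₃) λ s x t w → r-cong (solve (s ∷ x ∷ t ∷ w ∷ [])))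
          where
          gap : ∀ d x t → suc (t ℕ.+ (x ℕ.+ suc (2 ℕ.* d))) ≡ suc (t ℕ.+ x) ℕ.+ suc (2 ℕ.* d)
          gap = solve-∀
      G≡ : G ≡ S gd + S (lt u₄) + S (lt u₄)
      G≡ = trans (split (₂ ∷ ₁ ∷ []) Gc) (cong₂ _+_ (trans (S-zs (ge g₄)) (cong₂ _+_
          (match (₁ ∷ ₂ ∷ []) (ze (ge g₄)) gd λ d a t w → cong (⟦=0⟧ d) (r-cong (solve (a ∷ t ∷ w ∷ []))))
          (match (₂ ∷ []) (su (ge g₄)) (lt u₄) λ s a t w → r-cong (solve (s ∷ a ∷ t ∷ w ∷ [])))))
        (match (₁ ∷ ₂ ∷ []) (lt g₄) (lt u₄) λ c a t w → r-cong (solve (c ∷ a ∷ t ∷ w ∷ []))))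
      combine : ∀ x d y e f {u ud us a g} → u ≡ ud + us + us → ud ≡ x + d → us ≡ y + (f + e) → a ≡ x + y + y → g ≡ d + e + e → u ≡ a + + 2 * f + g
      combine x d y e f refl refl refl refl refl = linear x d y e f
        where
        linear : ∀ x d y e f → x + d + (y + (f + e)) + (y + (f + e)) ≡ x + y + y + + 2 * f + (d + e + e)
        linear = ℤ-Solver.solve-∀

    -- The substitution is `(a , c , T , w) ↦ (c , a + c + T , T + 2c , w − c)` in the actual,
    -- positive values; it preserves `ac + w(w + T)`.
    F≡ : F ≡ Nc<
    F≡ = sym (trans (only-even [] (lt h₁) λ c w a t → r-0ʳ t (par-ss c))
      (trans (only-even (₁ ∷ ₂ ∷ []) f₁ λ a c w t → r-0ˡ t (par-ss a))
        (match (₃ ∷ ₂ ∷ []) f₂ (ge u₄) λ a c w t → r-cong (solve (a ∷ c ∷ w ∷ t ∷ [])))))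

    U≡N : S U ≡ Nc> + Nc= + Nc<
    U≡N = trans (split (₂ ∷ ₁ ∷ ₃ ∷ []) U) (cong (_+ Nc<) (trans (S-zs (ge h₁)) (ℤₚ.+-comm Nc= Nc>)))

    ρ₁ ρ₂ R₃ ρ₄ ρ₅ RW ρ₆ ρ₇ y₁ δ₁ : Cell
    ρ₁ = perm (₂ ∷ ₁ ∷ ₃ ∷ []) R
    ρ₂ = perm (₁ ∷ ₂ ∷ []) (ge ρ₁)
    R₃ = od (perm (₁ ∷ []) (lt ρ₂))
    ρ₄ = perm (₁ ∷ ₂ ∷ []) (ev (ge ρ₂))
    ρ₅ = perm (₂ ∷ ₁ ∷ []) (lt ρ₁)
    RW = od (ge ρ₅)
    ρ₆ = perm (₁ ∷ []) (lt ρ₅)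
    ρ₇ = perm (₁ ∷ ₂ ∷ []) (ev ρ₆)
    y₁ = perm (₁ ∷ ₂ ∷ []) Tri
    δ₁ = perm (₂ ∷ ₁ ∷ []) R₃

    private
      both-odd : ∀ {n n′ x y} k l → n ≡ suc (2 ℕ.* k) → n′ ≡ suc (2 ℕ.* l) → x ≡ y → odd-only n x ≡ odd-only n′ y
      both-odd k l e e′ refl = trans (odd-only-odd′ k e) (sym (odd-only-odd′ l e′))

    -- An odd sum `X + Y + W` excludes degenerate triangles. `R₃` is `Y > X + W`, counted twice for
    -- the symmetry `X ↔ Y`, and `RW` is `W > X + Y`.
    R≡Tri : S R ≡ S Tri + + 2 * S R₃ + S RW
    R≡Tri = combine (S (ge ρ₄)) (S (lt ρ₄)) (S (ge ρ₇)) (S (lt ρ₇)) (S RW) R≡ Tri≡ R₃≡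
      where
      R≡ : S R ≡ (S (ge ρ₄) + S (lt ρ₄) + S R₃) + (S RW + (S (ge ρ₇) + S (lt ρ₇)))
      R≡ = trans (split (₂ ∷ ₁ ∷ ₃ ∷ []) R) (cong₂ _+_
        (trans (split (₁ ∷ ₂ ∷ []) (ge ρ₁)) (cong₂ _+_
          (trans (only-even [] (ge ρ₂) λ x y w v → odd-only-even _ (suc (suc (x ℕ.+ y ℕ.+ w))) (solve (x ∷ y ∷ w ∷ []))) (split (₁ ∷ ₂ ∷ []) (ev (ge ρ₂))))
          (only-odd (₁ ∷ []) (lt ρ₂) λ y x w v → odd-only-even _ (suc (suc (x ℕ.+ y ℕ.+ w))) (solve (y ∷ x ∷ w ∷ [])))))
        (trans (split (₂ ∷ ₁ ∷ []) (lt ρ₁)) (cong₂ _+_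
          (only-odd [] (ge ρ₅) λ w x y v → odd-only-even _ (suc (suc (x ℕ.+ y ℕ.+ w))) (solve (w ∷ x ∷ y ∷ [])))
          (trans (only-even (₁ ∷ []) (lt ρ₅) λ x w y v → odd-only-even _ (suc (suc (suc (x ℕ.+ y ℕ.+ w)))) (solve (x ∷ w ∷ y ∷ []))) (split (₁ ∷ ₂ ∷ []) (ev ρ₆))))))
      Tri≡ : S Tri ≡ S (ge ρ₄) + S (ge ρ₇)
      Tri≡ = trans (split (₁ ∷ ₂ ∷ []) Tri) (cong₂ _+_
        (match (₂ ∷ ₁ ∷ ₂ ∷ []) (ge y₁) (ge ρ₄) λ k x y v → sym (trans (odd-only-odd′ (suc (2 ℕ.* x ℕ.+ y ℕ.+ k)) (solve (k ∷ x ∷ y ∷ []))) (r-cong (solve (k ∷ x ∷ y ∷ v ∷ [])))))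
        (match (₂ ∷ ₁ ∷ []) (lt y₁) (ge ρ₇) λ k x y v → sym (trans (odd-only-odd′ (suc (suc (2 ℕ.* k ℕ.+ y ℕ.+ x))) (solve (k ∷ x ∷ y ∷ []))) (r-cong (solve (k ∷ x ∷ y ∷ v ∷ []))))))
      R₃≡ : S R₃ ≡ S (lt ρ₄) + S (lt ρ₇)
      R₃≡ = trans (split (₂ ∷ ₁ ∷ []) R₃) (cong₂ _+_
        (match (₁ ∷ ₂ ∷ []) (ge δ₁) (lt ρ₄) λ x w e v → both-odd (suc (suc (2 ℕ.* w ℕ.+ x ℕ.+ e))) (suc (suc (2 ℕ.* w ℕ.+ x ℕ.+ e))) (solve (x ∷ w ∷ e ∷ [])) (solve (x ∷ w ∷ e ∷ [])) (r-cong (solve (x ∷ w ∷ e ∷ v ∷ []))))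
        (match (₂ ∷ []) (lt δ₁) (lt ρ₇) λ x w e v → both-odd (suc (suc (suc (2 ℕ.* x ℕ.+ w ℕ.+ e)))) (suc (suc (suc (2 ℕ.* x ℕ.+ w ℕ.+ e)))) (solve (x ∷ w ∷ e ∷ [])) (solve (x ∷ w ∷ e ∷ [])) (r-cong (solve (x ∷ w ∷ e ∷ v ∷ [])))))
      combine : ∀ a b c d e {r t r₃} → r ≡ (a + b + r₃) + (e + (c + d)) → t ≡ a + c → r₃ ≡ b + d → r ≡ t + + 2 * r₃ + e
      combine a b c d e refl refl refl = linear a b c d e
        where
        linear : ∀ a b c d e → (a + b + (b + d)) + (e + (c + d)) ≡ a + c + + 2 * (b + d) + e
        linear = ℤ-Solver.solve-∀

    -- With `T = Y − X − W`, which is odd, `XY + VW = W(V + X) + X(X + T)`, and `V + X` exceeds `X`.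
    R₃≡Nc> : S R₃ ≡ Nc>
    R₃≡Nc> = match (₃ ∷ ₂ ∷ ₁ ∷ ₂ ∷ ₃ ∷ []) R₃ (su (ge h₁)) λ e x w v → trans (odd-only-odd′ (suc (suc (x ℕ.+ w ℕ.+ e))) (solve (e ∷ x ∷ w ∷ []))) (r-cong (solve (e ∷ x ∷ w ∷ v ∷ [])))

    κ₁ κ₂ κ₃ κ₄ κ₅ κ₆ κ₇ ν₁ ν₂ λ₁ λ₂ ω₀ ω₁ ω₂ ω₃ ω₄ : Cell
    κ₁ = perm (₁ ∷ ₂ ∷ []) R
    κ₂ = ev (perm (₁ ∷ []) (od κ₁))
    κ₃ = ev (perm (₁ ∷ ₂ ∷ []) κ₂)
    κ₄ = ev (perm (₁ ∷ ₂ ∷ ₃ ∷ []) κ₃)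
    κ₅ = ev (perm (₁ ∷ ₂ ∷ ₃ ∷ []) (ev κ₁))
    κ₆ = od (perm (₁ ∷ ₂ ∷ []) κ₅)
    κ₇ = od (perm (₁ ∷ ₂ ∷ ₃ ∷ []) κ₆)
    ν₁ = perm (₂ ∷ ₁ ∷ ₃ ∷ ₂ ∷ ₃ ∷ []) N
    ν₂ = perm (₁ ∷ ₂ ∷ ₃ ∷ []) g₂
    λ₁ = perm (₂ ∷ ₁ ∷ ₂ ∷ []) L₂
    λ₂ = perm (₂ ∷ ₁ ∷ ₂ ∷ ₃ ∷ []) (lt λ₁)
    ω₀ = perm (₁ ∷ ₂ ∷ ₃ ∷ []) RW
    ω₁ = ev (perm (₁ ∷ ₂ ∷ []) (od ω₀))
    ω₂ = ev (perm (₁ ∷ ₂ ∷ ₃ ∷ []) ω₁)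
    ω₃ = od (perm (₁ ∷ ₂ ∷ []) (ev ω₀))
    ω₄ = od (perm (₁ ∷ ₂ ∷ ₃ ∷ []) ω₃)

    Nce : ℤ
    Nce = S (ge λ₁)

    private
      R-0 : ∀ X Y V W {x y v w} → par X ≡ x → par Y ≡ y → par V ≡ v → par W ≡ w →
            ((x xor y) xor w) ∧ ((x ∧ y) xor (v ∧ w)) ≡ false → odd-only (X ℕ.+ Y ℕ.+ W) (r X Y V W) ≡ 0ℤ
      R-0 X Y V W refl refl refl refl e = odd-only-true (X ℕ.+ Y ℕ.+ W) λ p → r-par X Y V W
        (trans (cong (_∧ ((par X ∧ par Y) xor (par V ∧ par W))) (sym (trans (sym (trans (par-+ (X ℕ.+ Y) W) (cong (_xor par W) (par-+ X Y)))) p))) e)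

      even-W : ∀ x y → ((x xor y) xor false) ∧ ((x ∧ y) xor (true ∧ false)) ≡ false
      even-W true  true  = refl
      even-W true  false = refl
      even-W false true  = refl
      even-W false false = refl

      odd-X : ∀ y → ((true xor y) xor true) ∧ ((true ∧ y) xor (true ∧ true)) ≡ false
      odd-X true  = refl
      odd-X false = refl

      odd-X′ : ∀ y → (true ∧ y) xor (true ∧ ((y xor true) xor true)) ≡ false
      odd-X′ true  = refl
      odd-X′ false = refl

    -- With `m` and `X + Y + W` both odd, two parity patterns survive: `V` alone is even, or exactly
    -- `X` and `Y` are.
    R≡N+L₂ : S R ≡ S L₂ + S N
    R≡N+L₂ = trans (even-odd (₁ ∷ ₂ ∷ []) R) (cong₂ _+_
      (trans (only-even (₁ ∷ ₂ ∷ ₃ ∷ []) (ev κ₁) λ w v x y → R-0 (suc x) (suc y) _ _ refl refl (par-odd v) (par-ss w) (even-W (par (suc x)) (par (suc y))))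
      (trans (only-odd (₁ ∷ ₂ ∷ []) κ₅ λ x w v y → R-0 _ (suc y) _ _ (par-odd x) refl (par-odd v) (par-odd w) (odd-X (par (suc y))))
      (trans (only-odd (₁ ∷ ₂ ∷ ₃ ∷ []) κ₆ λ y x w v → odd-only-even _ (suc (suc (x ℕ.+ y ℕ.+ w))) (solve (y ∷ x ∷ w ∷ [])))
        (match (₃ ∷ ₂ ∷ ₁ ∷ ₃ ∷ ₂ ∷ ₃ ∷ []) κ₇ L₂ λ y x w v → trans (odd-only-odd′ (suc (suc (x ℕ.+ y ℕ.+ w))) (solve (y ∷ x ∷ w ∷ []))) (r-cong (solve (y ∷ x ∷ w ∷ v ∷ [])))))))
      (trans (only-even (₁ ∷ []) (od κ₁) λ x v y w → odd-only-0 _ (r-even _ _ _ _ (suc x ℕ.* suc y ℕ.+ suc v ℕ.* suc w) (solve (x ∷ v ∷ y ∷ w ∷ []))))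
      (trans (only-even (₁ ∷ ₂ ∷ []) κ₂ λ y x v w → odd-only-0 _ (r-even _ _ _ _ (suc (2 ℕ.* x) ℕ.* suc y ℕ.+ suc v ℕ.* suc w) (solve (y ∷ x ∷ v ∷ w ∷ []))))
      (trans (only-even (₁ ∷ ₂ ∷ ₃ ∷ []) κ₃ λ w y x v → odd-only-even _ (suc (suc (x ℕ.+ y ℕ.+ w))) (solve (y ∷ x ∷ w ∷ [])))
        (match (₂ ∷ ₁ ∷ ₂ ∷ []) κ₄ N λ w y x v → trans (odd-only-odd′ (suc (x ℕ.+ y ℕ.+ w)) (solve (y ∷ x ∷ w ∷ []))) (r-cong (solve (w ∷ y ∷ x ∷ v ∷ []))))))))

    -- One of `w` and `w + T` is even, so `ac` must be odd; the two orders of the odd and the even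
    -- factor make up `N`.
    U≡N-all : S U ≡ S N
    U≡N-all = trans (only-even [] U λ a c t w → r-0ˡ t (par-ss a))
      (trans (only-even (₁ ∷ []) g₁ λ c a t w → r-0ʳ t (par-ss c))
      (trans (even-odd (₁ ∷ ₂ ∷ ₃ ∷ []) g₂) (trans (cong₂ _+_
        (match (₃ ∷ ₂ ∷ ₁ ∷ ₃ ∷ []) (ev ν₂) (ge ν₁) λ w c a t → r-cong (solve (w ∷ c ∷ a ∷ t ∷ [])))
        (match (₃ ∷ ₂ ∷ ₃ ∷ []) (od ν₂) (lt ν₁) λ w c a t → r-cong (solve (w ∷ c ∷ a ∷ t ∷ [])))) (sym (split (₂ ∷ ₁ ∷ ₃ ∷ ₂ ∷ ₃ ∷ []) N)))))

    RW≡ : S RW ≡ S (lt λ₂) + S (ge λ₂)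
    RW≡ = trans (even-odd (₁ ∷ ₂ ∷ ₃ ∷ []) RW) (cong₂ _+_
      (trans (only-odd (₁ ∷ ₂ ∷ []) (ev ω₀) λ x v w y → odd-only-0 _ (r-par _ _ _ _ (trans (cong₂ (λ a b → (a ∧ par (suc y)) xor (b ∧ par (suc (suc y ℕ.+ (2 ℕ.* x ℕ.+ suc (2 ℕ.* w)))))) (par-odd x) (par-odd v))
          (trans (cong (λ b → (true ∧ par (suc y)) xor (true ∧ b)) (W-par x y w)) (odd-X′ (par (suc y)))))))
      (trans (only-odd (₁ ∷ ₂ ∷ ₃ ∷ []) ω₃ λ y x v w → odd-only-0 _ (r-even _ _ _ _ (suc x ℕ.* suc (2 ℕ.* y) ℕ.+ suc (2 ℕ.* v) ℕ.* suc (suc (y ℕ.+ x ℕ.+ w))) (solve (y ∷ x ∷ v ∷ w ∷ []))))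
        (match (₃ ∷ ₂ ∷ []) ω₄ (lt λ₂) λ y x v w → trans (odd-only-odd′ (suc (suc (suc (suc (2 ℕ.* (x ℕ.+ y) ℕ.+ w))))) (solve (y ∷ x ∷ w ∷ []))) (r-cong (solve (y ∷ x ∷ v ∷ w ∷ []))))))
      (trans (only-even (₁ ∷ ₂ ∷ []) (od ω₀) λ x v w y → odd-only-0 _ (r-even _ _ _ _ (suc x ℕ.* suc y ℕ.+ suc v ℕ.* suc (suc y ℕ.+ (suc (2 ℕ.* x) ℕ.+ suc (2 ℕ.* w)))) (solve (x ∷ v ∷ w ∷ y ∷ []))))
      (trans (only-even (₁ ∷ ₂ ∷ ₃ ∷ []) ω₁ λ y x v w → odd-only-0 _ (r-even _ _ _ _ (suc (2 ℕ.* x) ℕ.* suc y ℕ.+ suc v ℕ.* suc (suc (suc (2 ℕ.* y)) ℕ.+ ((2 ℕ.* x) ℕ.+ suc (2 ℕ.* w)))) (solve (y ∷ x ∷ v ∷ w ∷ []))))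
        (match (₃ ∷ ₂ ∷ ₁ ∷ ₂ ∷ ₃ ∷ []) ω₂ (ge λ₂) λ y x v w → trans (odd-only-odd′ (suc (suc (2 ℕ.* (x ℕ.+ y) ℕ.+ w))) (solve (y ∷ x ∷ w ∷ []))) (r-cong (solve (y ∷ x ∷ v ∷ w ∷ [])))))))
      where
      W-par : ∀ x y w → par (suc (suc y ℕ.+ (2 ℕ.* x ℕ.+ suc (2 ℕ.* w)))) ≡ (par (suc y) xor true) xor true
      W-par x y w = trans (par-≡ 0 (suc (x ℕ.+ w)) {suc (suc y ℕ.+ (2 ℕ.* x ℕ.+ suc (2 ℕ.* w)))} {suc y} (solve (x ∷ y ∷ w ∷ []))) (twice (par (suc y)))
        where twice : ∀ b → b ≡ (b xor true) xor true
              twice true  = refl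
              twice false = refl

    R≡U : S R ≡ S U + Nce + S RW
    R≡U = begin
      S R                                         ≡⟨ R≡N+L₂ ⟩
      S L₂ + S N                                  ≡⟨ cong₂ _+_ (trans (split (₂ ∷ ₁ ∷ ₂ ∷ []) L₂) (cong (λ s → Nce + s) (split (₂ ∷ ₁ ∷ ₂ ∷ ₃ ∷ []) (lt λ₁)))) (sym U≡N-all) ⟩
      Nce + (S (ge λ₂) + S (lt λ₂)) + S U         ≡⟨ linear Nce (S (ge λ₂)) (S (lt λ₂)) (S U) ⟩
      S U + Nce + (S (lt λ₂) + S (ge λ₂))         ≡⟨ cong (λ s → S U + Nce + s) (sym RW≡) ⟩
      S U + Nce + S RW                            ∎
      where
      linear : ∀ n g l u → n + (g + l) + u ≡ u + n + (l + g)
      linear = ℤ-Solver.solve-∀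

    Nce≡G : Nce ≡ G
    Nce≡G = trans (split (₂ ∷ ₁ ∷ ₂ ∷ ₃ ∷ []) (ge λ₁)) (sym (trans (even-odd (₁ ∷ ₂ ∷ ₃ ∷ []) Gc) (cong₂ _+_
      (match (₂ ∷ ₁ ∷ ₃ ∷ []) (ev γ) (ge λ₃) λ w t c a → r-cong (solve (w ∷ t ∷ c ∷ a ∷ [])))
      (match (₂ ∷ []) (od γ) (lt λ₃) λ w t c a → r-cong (solve (w ∷ t ∷ c ∷ a ∷ []))))))
      where
      γ λ₃ : Cell
      γ  = perm (₁ ∷ ₂ ∷ ₃ ∷ []) Gc
      λ₃ = perm (₂ ∷ ₁ ∷ ₂ ∷ ₃ ∷ []) (ge λ₁)

    -- `U` and `R` have each been expanded in two ways; on elimination every cell but `Nc=` drops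
    -- out.
    A′+Tri : S A′ + S Tri ≡ + 2 * Nc=
    A′+Tri = combine Nc> Nc= Nc< G (S RW) (S Tri) (S A′) U≡A′FG F≡ U≡N R≡Tri R₃≡Nc> R≡U Nce≡G
      where
      combine : ∀ a b c g w t p {u f n r₃ r} → u ≡ p + + 2 * f + g → f ≡ c → u ≡ a + b + c → r ≡ t + + 2 * r₃ + w → r₃ ≡ a → r ≡ u + n + w → n ≡ g → p + t ≡ + 2 * b
      combine a b c g w t p e₁ refl refl e₂ refl refl refl = trans (linear a b c g w t p) (trans (cong₂ (λ x y → (p + + 2 * c + g) - x + ((t + + 2 * a + w) - y) + + 2 * b) e₁ e₂) (linear′ a b c g w t p))
        where
        linear : ∀ a b c g w t p → p + t ≡ (p + + 2 * c + g) - (a + b + c) + ((t + + 2 * a + w) - (a + b + c + g + w)) + + 2 * b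
        linear = ℤ-Solver.solve-∀
        linear′ : ∀ a b c g w t p → (p + + 2 * c + g) - (p + + 2 * c + g) + ((t + + 2 * a + w) - (t + + 2 * a + w)) + + 2 * b ≡ + 2 * b
        linear′ = ℤ-Solver.solve-∀

    σ : ℤ
    σ = Σ (λ a → Σ (λ e → at m (suc (2 ℕ.* a) ℕ.* suc (2 ℕ.* e)) (+ suc (2 ℕ.* e))))

    Y : Cell
    Y = (λ q d l j → ⟦=0⟧ q (at m (suc d ℕ.* suc (l ℕ.+ j)) 1ℤ)) ,
      λ { zero d l j p → at-≢ _ λ e → <-irrefl (sym e) (<-≤-trans m<B (grow p _ (bound d l j))) ; (suc q) d l j p → refl }
      where
      bound : ∀ d l j → (d ℕ.+ l ℕ.+ j) ℕ.+ (1 ℕ.+ d ℕ.* (l ℕ.+ j)) ≡ suc d ℕ.* suc (l ℕ.+ j)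
      bound = solve-∀

    private
      at-even : ∀ a c x → par a ∧ par c ≡ false → at m (a ℕ.* c) x ≡ 0ℤ
      at-even a c x e = at-≢ _ λ e′ → true≢false (trans (sym m-odd) (trans (cong par (sym e′)) (trans (par-* a c) e)))

    σ≡Y : σ ≡ S Y
    σ≡Y = begin
      σ                                                                   ≡⟨ sym reindex ⟩
      Σ (λ d → Σ (λ e → at m (suc d ℕ.* suc e) (+ suc e)))                ≡⟨ sumTo-cong B (λ d → trans (sumTo-cong B λ e → at-const m _ (+ suc e))
        (Σ-weight⁺ λ e p → vanish d e 1ℤ (≤-trans p (m≤n+m e d)))) ⟩
      Σ (λ d → Σ (λ l → Σ (λ j → at m (suc d ℕ.* suc (l ℕ.+ j)) 1ℤ)))     ≡⟨ sym (S-dummy λ d l j → at m (suc d ℕ.* suc (l ℕ.+ j)) 1ℤ) ⟩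
      S Y                                                                 ∎
      where
      vanish : ∀ d e x → B ≤ d ℕ.+ e → at m (suc d ℕ.* suc e) x ≡ 0ℤ
      vanish d e x p = at-≢ _ λ eq → <-irrefl (sym eq) (<-≤-trans m<B (grow p (suc (d ℕ.* e)) (bound d e)))
        where
        bound : ∀ d e → (d ℕ.+ e) ℕ.+ suc (d ℕ.* e) ≡ suc d ℕ.* suc e
        bound = solve-∀
      reindex : Σ (λ d → Σ (λ e → at m (suc d ℕ.* suc e) (+ suc e))) ≡ σ
      reindex = trans (Σ-parity λ d p → sumTo-0 B λ e → vanish d e _ (≤-trans p (m≤m+n d e)))
        (trans (cong₂ _+_ (sumTo-cong B inner) (sumTo-0 B λ d → sumTo-0 B λ e → at-even (suc (suc (2 ℕ.* d))) (suc e) _ (cong (_∧ par (suc e)) (par-ss d)))) (ℤₚ.+-identityʳ σ))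
        where
        inner : ∀ a → Σ (λ e → at m (suc (2 ℕ.* a) ℕ.* suc e) (+ suc e)) ≡ Σ (λ e → at m (suc (2 ℕ.* a) ℕ.* suc (2 ℕ.* e)) (+ suc (2 ℕ.* e)))
        inner a = trans (Σ-parity λ e p → vanish (2 ℕ.* a) e _ (≤-trans p (m≤n+m e _)))
          (trans (cong (λ s → Σ (λ e → at m (suc (2 ℕ.* a) ℕ.* suc (2 ℕ.* e)) (+ suc (2 ℕ.* e))) + s)
            (sumTo-0 B λ e → at-even (suc (2 ℕ.* a)) (suc (suc (2 ℕ.* e))) _ (trans (cong (par (suc (2 ℕ.* a)) ∧_) (par-ss e)) (∧-zeroʳ (par (suc (2 ℕ.* a))))))) (ℤₚ.+-identityʳ _))

    module _ (4m<B : 4 ℕ.* m < B) where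

      K : Cell
      K = (λ x y z k → at (4 ℕ.* m) (suc (2 ℕ.* k) ℕ.* suc (2 ℕ.* k) ℕ.+ (suc (2 ℕ.* x) ℕ.* suc (2 ℕ.* y) ℕ.+ suc (2 ℕ.* y) ℕ.* suc (2 ℕ.* z) ℕ.+ suc (2 ℕ.* z) ℕ.* suc (2 ℕ.* x))) 1ℤ) ,
        λ x y z k p → at-≢ _ λ e → <-irrefl (sym e) (<-≤-trans 4m<B (grow p _ (bound x y z k)))
        where
        bound : ∀ x y z k → (x ℕ.+ y ℕ.+ z ℕ.+ k) ℕ.+ (4 ℕ.+ 3 ℕ.* x ℕ.+ 3 ℕ.* y ℕ.+ 3 ℕ.* z ℕ.+ 3 ℕ.* k ℕ.+ 4 ℕ.* k ℕ.* k ℕ.+ 4 ℕ.* x ℕ.* y ℕ.+ 4 ℕ.* y ℕ.* z ℕ.+ 4 ℕ.* z ℕ.* x)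
              ≡ suc (2 ℕ.* k) ℕ.* suc (2 ℕ.* k) ℕ.+ (suc (2 ℕ.* x) ℕ.* suc (2 ℕ.* y) ℕ.+ suc (2 ℕ.* y) ℕ.* suc (2 ℕ.* z) ℕ.+ suc (2 ℕ.* z) ℕ.* suc (2 ℕ.* x))
        bound = solve-∀

      private
        k₁ l₁ l₂ l₃ l₄ e₁ : Cell
        k₁ = perm (₂ ∷ ₁ ∷ ₃ ∷ ₂ ∷ []) K
        l₁ = perm (₂ ∷ ₁ ∷ []) Y
        l₂ = perm (₁ ∷ []) (lt l₁)
        l₃ = perm (₁ ∷ ₂ ∷ ₃ ∷ []) (ev l₂)
        l₄ = perm (₁ ∷ ₂ ∷ ₃ ∷ []) (od l₂)
        e₁ = perm (₁ ∷ ₂ ∷ []) (ze (ge h₁))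

        quarter : ∀ {n} n′ → n ≡ 4 ℕ.* n′ → at (4 ℕ.* m) n 1ℤ ≡ at m n′ 1ℤ
        quarter n′ refl = at-mul 3 m n′ 1ℤ

      -- Here `p = 2k + 1` is compared with the odd `z`. All factors of
      -- `(x + z)(y + z) + (p − z)(p + z)` are even, so a quarter of the equation is again bilinear:
      -- `p > z` gives `A′`, `p = z` leaves a product, and `p < z`, in the form
      -- `(x + p)(y + p) + (z − p)(x + y)`, gives `Tri`.
      K-split : S K ≡ S (ge l₁) + S Tri + S A′
      K-split = trans (split (₂ ∷ ₁ ∷ ₃ ∷ ₂ ∷ []) K) (cong₂ _+_ (trans (S-zs (ge k₁)) (cong₂ _+_
        (match (₂ ∷ ₁ ∷ ₂ ∷ []) (ze (ge k₁)) (ge l₁) λ z k x y → cong (⟦=0⟧ z) (trans (quarter (suc (x ℕ.+ k) ℕ.* suc (y ℕ.+ k)) (solve (k ∷ x ∷ y ∷ []))) (at-cong (solve (k ∷ x ∷ y ∷ [])) λ _ → refl)))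
        (match (₂ ∷ ₁ ∷ ₃ ∷ ₂ ∷ ₃ ∷ []) (su (ge k₁)) Tri λ z k x y → trans (quarter (suc (x ℕ.+ k) ℕ.* suc (y ℕ.+ k) ℕ.+ suc z ℕ.* suc (x ℕ.+ y)) (solve (z ∷ k ∷ x ∷ y ∷ []))) (sym (r≡at _ _ _ _ _ refl)))))
        (match (₂ ∷ ₁ ∷ ₃ ∷ ₂ ∷ []) (lt k₁) A′ λ z k x y → trans (quarter (suc (z ℕ.+ x) ℕ.* suc (z ℕ.+ y) ℕ.+ suc k ℕ.* (suc k ℕ.+ suc (2 ℕ.* z))) (solve (z ∷ k ∷ x ∷ y ∷ []))) (sym (r≡at _ _ _ _ _ refl))))

      -- Beyond the diagonal the second factor is `c + 1 + l + j` with `c = suc d` and `l` the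
      -- remaining gap. Both factors are odd, so exactly one of `l` and `j` is odd; either choice
      -- gives `Nc=`, where `m = c(c + a + T)` with `a` and `T` odd.
      Y-split : S Y ≡ S (ge l₁) + + 2 * Nc=
      Y-split = trans (split (₂ ∷ ₁ ∷ []) Y) (cong (λ s → S (ge l₁) + s) (begin
        S (lt l₁)                       ≡⟨ even-odd (₁ ∷ []) (lt l₁) ⟩
        S (ev l₂) + S (od l₂)           ≡⟨ cong₂ _+_
          (trans (only-odd (₁ ∷ ₂ ∷ ₃ ∷ []) (ev l₂) λ { j l d zero → clash d (l ℕ.+ j) (solve (j ∷ l ∷ d ∷ [])) ; j l d (suc q) → refl })
            (match (₃ ∷ ₂ ∷ ₃ ∷ []) (od l₃) (ev e₁) λ j l d q → cong (⟦=0⟧ q) (sym (r≡at _ _ _ _ _ (solve (j ∷ l ∷ d ∷ []))))))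
          (trans (only-even (₁ ∷ ₂ ∷ ₃ ∷ []) (od l₂) λ { j l d zero → clash d (suc (l ℕ.+ j)) (solve (j ∷ l ∷ d ∷ [])) ; j l d (suc q) → refl })
            (match (₁ ∷ ₃ ∷ ₂ ∷ ₃ ∷ []) (ev l₄) (ev e₁) λ j l d q → cong (⟦=0⟧ q) (sym (r≡at _ _ _ _ _ (solve (j ∷ l ∷ d ∷ [])))))) ⟩
        S (ev e₁) + S (ev e₁)           ≡⟨ cong (λ s → s + s) (sym (only-even (₁ ∷ ₂ ∷ []) (ze (ge h₁)) λ { a zero w t → r-0ˡ t (par-ss a) ; a (suc c) w t → refl })) ⟩
        Nc= + Nc=                       ≡⟨ double Nc= ⟩
        + 2 * Nc=                       ∎))
        where
        double : ∀ (x : ℤ) → x + x ≡ + 2 * x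
        double = ℤ-Solver.solve-∀
        clash : ∀ d k {n} → n ≡ suc d ℕ.+ suc (2 ℕ.* k) → at m (suc d ℕ.* n) 1ℤ ≡ 0ℤ
        clash d k refl = at-even (suc d) _ 1ℤ (par-gap (suc d) k)

      kronecker : S K ≡ σ
      kronecker = trans K-split (trans (trans (linear (S (ge l₁)) (S Tri) (S A′)) (cong (λ s → S (ge l₁) + s) A′+Tri)) (sym (trans σ≡Y Y-split)))
        where
        linear : ∀ z t a → z + t + a ≡ z + (a + t)
        linear = ℤ-Solver.solve-∀

  -- Nonzero sums and their witnesses.

  sumTo-witness : ∀ n {f : ℕ → ℤ} → sumTo n f ≢ 0ℤ → ∃ λ i → f i ≢ 0ℤ
  sumTo-witness zero        ne = ⊥-elim (ne refl)
  sumTo-witness (suc n) {f} ne with f n ℤₚ.≟ 0ℤ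
  ... | no neₙ = n , neₙ
  ... | yes e  = sumTo-witness n λ e′ → ne (cong₂ _+_ e′ e)

  sumTo-nonneg : ∀ n {f : ℕ → ℤ} → (∀ i → 0ℤ ℤ.≤ f i) → 0ℤ ℤ.≤ sumTo n f
  sumTo-nonneg zero    p = ℤₚ.≤-refl
  sumTo-nonneg (suc n) p = ℤₚ.+-mono-≤ (sumTo-nonneg n p) (p n)

  sumTo-positive : ∀ {n k} {f : ℕ → ℤ} → (∀ i → 0ℤ ℤ.≤ f i) → k < n → 0ℤ ℤ.< f k → 0ℤ ℤ.< sumTo n f
  sumTo-positive {suc n} {k} p k<1+n q with ℕₚ.m<1+n⇒m<n∨m≡n k<1+n
  ... | inj₁ k<n  = ℤₚ.+-mono-<-≤ (sumTo-positive p k<n q) (p n)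
  ... | inj₂ refl = ℤₚ.+-mono-≤-< (sumTo-nonneg n p) q

  at-nonneg : ∀ N n → 0ℤ ℤ.≤ at N n 1ℤ
  at-nonneg N n with n ≟ N
  ... | yes refl = subst (0ℤ ℤ.≤_) (sym (at-≡ N 1ℤ)) (ℤ.+≤+ z≤n)
  ... | no ne    = ℤₚ.≤-reflexive (sym (at-≢ 1ℤ ne))

  at-positive : ∀ {N n} → n ≡ N → 0ℤ ℤ.< at N n 1ℤ
  at-positive {N} refl = subst (0ℤ ℤ.<_) (sym (at-≡ N 1ℤ)) (ℤ.+<+ (s≤s z≤n))

  at-hit : ∀ {N n} → at N n 1ℤ ≢ 0ℤ → n ≡ N
  at-hit {N} {n} ne with n ≟ N
  ... | yes e = e
  ... | no e  = ⊥-elim (ne (at-≢ 1ℤ e))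

  SumOfThreeSquares : ℕ → Set
  SumOfThreeSquares n = ∃ λ x → ∃ λ y → ∃ λ z → n ≡ x ℕ.* x ℕ.+ y ℕ.* y ℕ.+ z ℕ.* z

  -- Sums of four odd squares

  at-+ : ∀ N n x y → at N n (x + y) ≡ at N n x + at N n y
  at-+ N n x y with n ≟ N
  ... | yes refl = trans (at-≡ N _) (sym (cong₂ _+_ (at-≡ N x) (at-≡ N y)))
  ... | no ne    = trans (at-≢ _ ne) (sym (cong₂ _+_ (at-≢ x ne) (at-≢ y ne)))

  at-value : ∀ N n x → at N n (+ n * x) ≡ + N * at N n x
  at-value N n x with n ≟ N
  ... | yes refl = at-scale N N (+ N) x
  ... | no ne    = trans (at-≢ _ ne) (sym (trans (cong (λ s → + N * s) (at-≢ x ne)) (ℤₚ.*-zeroʳ (+ N))))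

  -- pull N a D is D (N − a) if a ≤ N, and 0 otherwise.
  pull : ℕ → ℕ → (ℕ → ℤ) → ℤ
  pull N       zero    D = D N
  pull zero    (suc a) D = 0ℤ
  pull (suc N) (suc a) D = pull N a D

  at-suc : ∀ N n x → at (suc N) (suc n) x ≡ at N n x
  at-suc N n x with n ≟ N
  ... | yes refl = trans (at-≡ (suc N) x) (sym (at-≡ N x))
  ... | no ne    = trans (at-≢ x λ e → ne (ℕₚ.suc-injective e)) (sym (at-≢ x ne))

  at-pull : ∀ N a b x → at N (a ℕ.+ b) x ≡ pull N a (λ n → at n b x)
  at-pull N       zero    b x = refl
  at-pull zero    (suc a) b x = at-≢ x λ ()
  at-pull (suc N) (suc a) b x = trans (at-suc N (a ℕ.+ b) x) (at-pull N a b x)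

  pull-sum : ∀ n N a (F : ℕ → ℕ → ℤ) → pull N a (λ k → sumTo n (F k)) ≡ sumTo n (λ i → pull N a (λ k → F k i))
  pull-sum n N       zero    F = refl
  pull-sum n zero    (suc a) F = sym (sumTo-0 n λ _ → refl)
  pull-sum n (suc N) (suc a) F = pull-sum n N a F

  pull-cong : ∀ N a {D E : ℕ → ℤ} → (∀ n → D n ≡ E n) → pull N a D ≡ pull N a E
  pull-cong N       zero    e = e N
  pull-cong zero    (suc a) e = refl
  pull-cong (suc N) (suc a) e = pull-cong N a e

  pull-+ : ∀ N a (D E : ℕ → ℤ) → pull N a (λ n → D n + E n) ≡ pull N a D + pull N a E
  pull-+ N       zero    D E = refl
  pull-+ zero    (suc a) D E = refl
  pull-+ (suc N) (suc a) D E = pull-+ N a D E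

  pull-* : ∀ N a c (D : ℕ → ℤ) → pull N a (λ n → c * D n) ≡ c * pull N a D
  pull-* N       zero    c D = refl
  pull-* zero    (suc a) c D = sym (ℤₚ.*-zeroʳ c)
  pull-* (suc N) (suc a) c D = pull-* N a c D

  pull-0 : ∀ N a {D : ℕ → ℤ} → (∀ n → n ℕ.+ a ≡ N → D n ≡ 0ℤ) → pull N a D ≡ 0ℤ
  pull-0 N       zero    e = e N (ℕₚ.+-identityʳ N)
  pull-0 zero    (suc a) e = refl
  pull-0 (suc N) (suc a) e = pull-0 N a λ n p → e n (trans (ℕₚ.+-suc n a) (cong suc p))

  sq : ℕ → ℕ
  sq i = suc (2 ℕ.* i) ℕ.* suc (2 ℕ.* i)

  module Squares (B : ℕ) (0<B : 0 < B) where

    open Sums B 0<B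

    four : ℕ → ℤ
    four n = ΣΣ (λ i j k l → at n (sq i ℕ.+ sq j ℕ.+ sq k ℕ.+ sq l) 1ℤ)

    -- Jacobi's value. It is supported on four times the odd numbers, in agreement with four odd
    -- squares adding up to 4 modulo 8.
    divisor-sum : ℕ → ℤ
    divisor-sum n = Σ (λ a → Σ (λ e → at n (4 ℕ.* (suc (2 ℕ.* a) ℕ.* suc (2 ℕ.* e))) (+ suc (2 ℕ.* e))))

    private
      Σ⁵ : (ℕ → ℕ → ℕ → ℕ → ℕ → ℤ) → ℤ
      Σ⁵ F = Σ (λ p → ΣΣ (F p))

      Σ⁵-cong : ∀ {F G} → (∀ p i j k l → F p i j k l ≡ G p i j k l) → Σ⁵ F ≡ Σ⁵ G
      Σ⁵-cong e = sumTo-cong B λ p → sumTo-cong B λ i → sumTo-cong B λ j → sumTo-cong B λ k → sumTo-cong B λ l → e p i j k l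

      Σ⁵-+ : ∀ F G → Σ⁵ (λ p i j k l → F p i j k l + G p i j k l) ≡ Σ⁵ F + Σ⁵ G
      Σ⁵-+ F G = trans (sumTo-cong B λ p → trans (sumTo-cong B λ i → trans (sumTo-cong B λ j → trans (sumTo-cong B λ k →
        sumTo-+ B _ _) (sumTo-+ B _ _)) (sumTo-+ B _ _)) (sumTo-+ B _ _)) (sumTo-+ B _ _)

      Σ⁵-* : ∀ c F → Σ⁵ (λ p i j k l → c * F p i j k l) ≡ c * Σ⁵ F
      Σ⁵-* c F = trans (sumTo-cong B λ p → trans (sumTo-cong B λ i → trans (sumTo-cong B λ j → trans (sumTo-cong B λ k →
        sumTo-*ˡ B c _) (sumTo-*ˡ B c _)) (sumTo-*ˡ B c _)) (sumTo-*ˡ B c _)) (sumTo-*ˡ B c _)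

    -- Each of the five squares has the same sum, a fifth of N times the number of representations.
    five : ∀ N → Σ (λ p → (+ 5 * + sq p - + N) * pull N (sq p) four) ≡ 0ℤ
    five N = begin
      Σ (λ p → (+ 5 * + sq p - + N) * pull N (sq p) four)
        ≡⟨ sumTo-cong B (λ p → cong (λ s → (+ 5 * + sq p - + N) * s) (unpull p)) ⟩
      Σ (λ p → (+ 5 * + sq p - + N) * ΣΣ (λ i j k l → at N (total p i j k l) 1ℤ))
        ≡⟨ sumTo-cong B (λ p → sym (inside p)) ⟩
      Σ⁵ (λ p i j k l → + 5 * T₁ p i j k l + (- (+ N)) * T₀ p i j k l)
        ≡⟨ trans (Σ⁵-+ _ _) (cong₂ _+_ (Σ⁵-* (+ 5) T₁) (Σ⁵-* (- (+ N)) T₀)) ⟩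
      + 5 * Σ⁵ T₁ + (- (+ N)) * Σ⁵ T₀
        ≡⟨ cong (λ s → + 5 * Σ⁵ T₁ + s) (trans (neg (+ N) (Σ⁵ T₀)) (cong -_ by-symmetry)) ⟩
      + 5 * Σ⁵ T₁ + - (+ 5 * Σ⁵ T₁)
        ≡⟨ ℤₚ.+-inverseʳ (+ 5 * Σ⁵ T₁) ⟩
      0ℤ ∎
      where
      total : ℕ → ℕ → ℕ → ℕ → ℕ → ℕ
      total p i j k l = sq p ℕ.+ (sq i ℕ.+ sq j ℕ.+ sq k ℕ.+ sq l)
      T₀ T₁ : ℕ → ℕ → ℕ → ℕ → ℕ → ℤ
      T₀ p i j k l = at N (total p i j k l) 1ℤ
      T₁ p i j k l = at N (total p i j k l) (+ sq p)
      neg : ∀ n s → (- n) * s ≡ - (n * s)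
      neg = ℤ-Solver.solve-∀
      unpull : ∀ p → pull N (sq p) four ≡ ΣΣ (λ i j k l → at N (total p i j k l) 1ℤ)
      unpull p = trans (pull-sum B N (sq p) _) (sumTo-cong B λ i → trans (pull-sum B N (sq p) _) (sumTo-cong B λ j →
        trans (pull-sum B N (sq p) _) (sumTo-cong B λ k → trans (pull-sum B N (sq p) _) (sumTo-cong B λ l → sym (at-pull N (sq p) _ 1ℤ)))))
      inside : ∀ p → ΣΣ (λ i j k l → + 5 * T₁ p i j k l + (- (+ N)) * T₀ p i j k l) ≡ (+ 5 * + sq p - + N) * ΣΣ (T₀ p)
      inside p = trans (sumTo-cong B λ i → trans (sumTo-cong B λ j → trans (sumTo-cong B λ k → trans (sumTo-cong B λ l →
        trans (cong (λ s → + 5 * s + (- (+ N)) * T₀ p i j k l) (at-const N _ (+ sq p))) (factor (+ sq p) (+ N) (T₀ p i j k l)))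
        (sumTo-*ˡ B c _)) (sumTo-*ˡ B c _)) (sumTo-*ˡ B c _)) (sumTo-*ˡ B c _)
        where
        c : ℤ
        c = + 5 * + sq p - + N
        factor : ∀ s n x → + 5 * (s * x) + (- n) * x ≡ (+ 5 * s - n) * x
        factor = ℤ-Solver.solve-∀
      T₂ T₃ T₄ T₅ : ℕ → ℕ → ℕ → ℕ → ℕ → ℤ
      T₂ p i j k l = at N (total p i j k l) (+ sq i)
      T₃ p i j k l = at N (total p i j k l) (+ sq j)
      T₄ p i j k l = at N (total p i j k l) (+ sq k)
      T₅ p i j k l = at N (total p i j k l) (+ sq l)
      exchange : ∀ a b c d e → a ℕ.+ (b ℕ.+ c ℕ.+ d ℕ.+ e) ≡ b ℕ.+ (a ℕ.+ c ℕ.+ d ℕ.+ e)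
      exchange = solve-∀
      same : ∀ {x y} w → x ≡ y → at N x w ≡ at N y w
      same w e = cong (λ n → at N n w) e
      T₂≡ : Σ⁵ T₂ ≡ Σ⁵ T₁
      T₂≡ = trans (sumTo-swap B B _) (Σ⁵-cong λ p i j k l → same _ (exchange (sq i) (sq p) (sq j) (sq k) (sq l)))
      T₃≡ : Σ⁵ T₃ ≡ Σ⁵ T₂
      T₃≡ = sumTo-cong B λ p → ΣΣ-match (₁ ∷ []) (T₃ p) (T₂ p) λ i j k l → same _ (cong (λ n → sq p ℕ.+ (n ℕ.+ sq k ℕ.+ sq l)) (ℕₚ.+-comm (sq i) (sq j)))
      T₄≡ : Σ⁵ T₄ ≡ Σ⁵ T₃
      T₄≡ = sumTo-cong B λ p → ΣΣ-match (₂ ∷ []) (T₄ p) (T₃ p) λ i j k l → same _ (swap₂ (sq p) (sq i) (sq j) (sq k) (sq l))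
        where
        swap₂ : ∀ a b c d e → a ℕ.+ (b ℕ.+ c ℕ.+ d ℕ.+ e) ≡ a ℕ.+ (b ℕ.+ d ℕ.+ c ℕ.+ e)
        swap₂ = solve-∀
      T₅≡ : Σ⁵ T₅ ≡ Σ⁵ T₄
      T₅≡ = sumTo-cong B λ p → ΣΣ-match (₃ ∷ []) (T₅ p) (T₄ p) λ i j k l → same _ (swap₃ (sq p) (sq i) (sq j) (sq k) (sq l))
        where
        swap₃ : ∀ a b c d e → a ℕ.+ (b ℕ.+ c ℕ.+ d ℕ.+ e) ≡ a ℕ.+ (b ℕ.+ c ℕ.+ e ℕ.+ d)
        swap₃ = solve-∀
      by-symmetry : + N * Σ⁵ T₀ ≡ + 5 * Σ⁵ T₁
      by-symmetry = begin
        + N * Σ⁵ T₀ ≡⟨ sym (Σ⁵-* (+ N) T₀) ⟩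
        Σ⁵ (λ p i j k l → + N * T₀ p i j k l) ≡⟨ Σ⁵-cong (λ p i j k l → sym (split-total p i j k l)) ⟩
        Σ⁵ (λ p i j k l → T₁ p i j k l + (T₂ p i j k l + T₃ p i j k l + T₄ p i j k l + T₅ p i j k l))
          ≡⟨ trans (Σ⁵-+ _ _) (cong (λ s → Σ⁵ T₁ + s) (trans (Σ⁵-+ _ _) (cong (λ s → s + Σ⁵ T₅) (trans (Σ⁵-+ _ _) (cong (λ s → s + Σ⁵ T₄) (Σ⁵-+ T₂ T₃)))))) ⟩
        Σ⁵ T₁ + (Σ⁵ T₂ + Σ⁵ T₃ + Σ⁵ T₄ + Σ⁵ T₅) ≡⟨ combine T₂≡ T₃≡ T₄≡ T₅≡ ⟩
        + 5 * Σ⁵ T₁ ∎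
        where
        split-total : ∀ p i j k l → T₁ p i j k l + (T₂ p i j k l + T₃ p i j k l + T₄ p i j k l + T₅ p i j k l) ≡ + N * T₀ p i j k l
        split-total p i j k l = trans (cong (λ s → T₁ p i j k l + s) (sym (trans (at-+ N _ _ _) (cong (_+ T₅ p i j k l) (trans (at-+ N _ _ _) (cong (_+ T₄ p i j k l) (at-+ N _ _ _)))))))
          (trans (sym (at-+ N _ _ _)) (trans (cong (at N _) (sym (ℤₚ.*-identityʳ _))) (at-value N (total p i j k l) 1ℤ)))
        combine : ∀ {a b c d e} → b ≡ a → c ≡ b → d ≡ c → e ≡ d → a + (b + c + d + e) ≡ + 5 * a
        combine {a} refl refl refl refl = linear a
          where
          linear : ∀ a → a + (a + a + a + a) ≡ + 5 * a
          linear = ℤ-Solver.solve-∀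

    module _ (N : ℕ) (N<B : N < B) where

      private
        form : ℕ → ℕ → ℕ → ℕ
        form k d e = sq k ℕ.+ 4 ℕ.* (suc (2 ℕ.* d) ℕ.* suc (2 ℕ.* e))

        -- Chosen so that it changes sign under both substitutions in `weighted-sum`, while its
        -- symmetrisation in `d` and `e` is `2(d + e)(de − k²)`.
        w : ℤ → ℤ → ℤ → ℤ
        w k d e = (d + e) * (d + k) * (e - k)

        C c₁ c₂ c₃ : Cell
        C = (λ q k d e → ⟦=0⟧ q (at N (form k d e) (w (+ suc (2 ℕ.* k)) (+ suc (2 ℕ.* d)) (+ suc (2 ℕ.* e))))) ,
          λ { zero k d e p → at-≢ _ λ eq → <-irrefl (sym eq) (<-≤-trans N<B (grow p _ (bound k d e))) ; (suc q) k d e p → refl }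
          where
          bound : ∀ k d e → (k ℕ.+ d ℕ.+ e) ℕ.+ (5 ℕ.+ 3 ℕ.* k ℕ.+ 4 ℕ.* k ℕ.* k ℕ.+ 7 ℕ.* d ℕ.+ 7 ℕ.* e ℕ.+ 16 ℕ.* d ℕ.* e)
                ≡ suc (2 ℕ.* k) ℕ.* suc (2 ℕ.* k) ℕ.+ 4 ℕ.* (suc (2 ℕ.* d) ℕ.* suc (2 ℕ.* e))
          bound = solve-∀
        c₁ = perm (₂ ∷ ₁ ∷ ₃ ∷ []) C
        c₂ = su (ge c₁)
        c₃ = perm (₃ ∷ ₂ ∷ ₁ ∷ ₃ ∷ []) (lt c₁)

        weight : ∀ {n k d e k′ d′ e′} x → n ≡ x → k ≡ k′ → d ≡ d′ → e ≡ e′ → at N n (w k d e) ≡ at N x (w k′ d′ e′)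
        weight x refl refl refl refl = refl

        opposite : ∀ n x y → x ≡ (- 1ℤ) * y → at N n x ≡ (- 1ℤ) * at N n y
        opposite n x y refl = at-scale N n (- 1ℤ) y

        scaled : ∀ q {x y} → x ≡ (- 1ℤ) * y → ⟦=0⟧ q x ≡ (- 1ℤ) * ⟦=0⟧ q y
        scaled zero    e = e
        scaled (suc q) e = refl

      -- Two substitutions preserve `k² + 4de` and negate the weight: `(k − 2e , e , k − e + d)`
      -- carries `k > 2e` onto `e > k + d`, and `(2e − k , d + k − e , e)` carries `e < k < 2e` onto
      -- `k < e < k + d`. For `k = e` the weight is 0, and parity excludes the other boundaries.
      weighted-sum : S C ≡ 0ℤ
      weighted-sum = begin
        S C                                                     ≡⟨ split (₂ ∷ ₁ ∷ ₃ ∷ []) C ⟩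
        S (ge c₁) + S (lt c₁)                                   ≡⟨ cong₂ _+_ (trans (S-zs (ge c₁)) (cong₂ _+_ equal (S-≥< c₂))) (split (₃ ∷ ₂ ∷ ₁ ∷ ₃ ∷ []) (lt c₁)) ⟩
        0ℤ + (S (ge c₂) + S (lt c₂)) + (S (ge c₃) + S (lt c₃))  ≡⟨ cong₂ (λ x y → 0ℤ + (x + y) + (S (ge c₃) + S (lt c₃))) large small ⟩
        0ℤ + ((- 1ℤ) * S (ge c₃) + (- 1ℤ) * S (lt c₃)) + (S (ge c₃) + S (lt c₃)) ≡⟨ cancel (S (ge c₃)) (S (lt c₃)) ⟩
        0ℤ                                                      ∎
        where
        cancel : ∀ x y → 0ℤ + ((- 1ℤ) * x + (- 1ℤ) * y) + (x + y) ≡ 0ℤ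
        cancel = ℤ-Solver.solve-∀
        equal : S (ze (ge c₁)) ≡ 0ℤ
        equal = S-0 (ze (ge c₁)) λ { zero e zero d → trans (weight _ refl (cong (λ i → + suc (2 ℕ.* i)) (ℕₚ.+-identityʳ e)) (refl {x = + suc (2 ℕ.* d)}) (refl {x = + suc (2 ℕ.* e)})) (trans (cong (at N _) (vanish (+ suc (2 ℕ.* d)) (+ suc (2 ℕ.* e)))) (at-const-0 N _))
                                   ; zero e (suc q) d → refl ; (suc k) e q d → refl }
          where
          vanish : ∀ d e → ((d + e) * (d + e) * (e - e)) ≡ 0ℤ
          vanish = ℤ-Solver.solve-∀
        large : S (ge c₂) ≡ (- 1ℤ) * S (ge c₃)
        large = S-scale (₃ ∷ ₂ ∷ ₁ ∷ ₂ ∷ ₃ ∷ []) (ge c₂) (ge c₃) (- 1ℤ) λ k e q d → scaled q (trans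
          (weight (suc (2 ℕ.* k) ℕ.* suc (2 ℕ.* k) ℕ.+ 4 ℕ.* (suc (2 ℕ.* e) ℕ.* (suc (2 ℕ.* k) ℕ.+ suc (2 ℕ.* e) ℕ.+ suc (2 ℕ.* d)))) (poly k e d) (cong +_ (arg k e)) (refl {x = + suc (2 ℕ.* d)}) (refl {x = + suc (2 ℕ.* e)}))
          (trans (opposite _ _ (w (+ suc (2 ℕ.* k)) (+ suc (2 ℕ.* e)) (+ suc (2 ℕ.* k) + + suc (2 ℕ.* e) + + suc (2 ℕ.* d))) (sign (+ suc (2 ℕ.* k)) (+ suc (2 ℕ.* e)) (+ suc (2 ℕ.* d))))
            (cong (λ z → (- 1ℤ) * z) (sym (weight _ (poly′ k e d) (refl {x = + suc (2 ℕ.* k)}) (refl {x = + suc (2 ℕ.* e)}) (cong +_ (arg′ k e d)))))))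
          where
          poly : ∀ k e d → suc (2 ℕ.* (e ℕ.+ suc (e ℕ.+ k))) ℕ.* suc (2 ℕ.* (e ℕ.+ suc (e ℕ.+ k))) ℕ.+ 4 ℕ.* (suc (2 ℕ.* d) ℕ.* suc (2 ℕ.* e))
               ≡ suc (2 ℕ.* k) ℕ.* suc (2 ℕ.* k) ℕ.+ 4 ℕ.* (suc (2 ℕ.* e) ℕ.* (suc (2 ℕ.* k) ℕ.+ suc (2 ℕ.* e) ℕ.+ suc (2 ℕ.* d)))
          poly = solve-∀
          poly′ : ∀ k e d → suc (2 ℕ.* k) ℕ.* suc (2 ℕ.* k) ℕ.+ 4 ℕ.* (suc (2 ℕ.* e) ℕ.* suc (2 ℕ.* (suc k ℕ.+ (e ℕ.+ d))))
                ≡ suc (2 ℕ.* k) ℕ.* suc (2 ℕ.* k) ℕ.+ 4 ℕ.* (suc (2 ℕ.* e) ℕ.* (suc (2 ℕ.* k) ℕ.+ suc (2 ℕ.* e) ℕ.+ suc (2 ℕ.* d)))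
          poly′ = solve-∀
          arg : ∀ k e → suc (2 ℕ.* (e ℕ.+ suc (e ℕ.+ k))) ≡ suc (2 ℕ.* e) ℕ.+ suc (2 ℕ.* e) ℕ.+ suc (2 ℕ.* k)
          arg = solve-∀
          arg′ : ∀ k e d → suc (2 ℕ.* (suc k ℕ.+ (e ℕ.+ d))) ≡ suc (2 ℕ.* k) ℕ.+ suc (2 ℕ.* e) ℕ.+ suc (2 ℕ.* d)
          arg′ = solve-∀
          sign : ∀ k e d → ((d + e) * (d + (e + e + k)) * (e - (e + e + k))) ≡ (- 1ℤ) * ((e + (k + e + d)) * (e + k) * ((k + e + d) - k))
          sign = ℤ-Solver.solve-∀
        small : S (lt c₂) ≡ (- 1ℤ) * S (lt c₃)
        small = S-scale (₃ ∷ ₂ ∷ ₃ ∷ []) (lt c₂) (lt c₃) (- 1ℤ) λ k e q d → scaled q (trans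
          (weight ((suc (2 ℕ.* e) ℕ.+ 4 ℕ.* suc k) ℕ.* (suc (2 ℕ.* e) ℕ.+ 4 ℕ.* suc k) ℕ.+ 4 ℕ.* (suc (2 ℕ.* d) ℕ.* (suc (2 ℕ.* e) ℕ.+ 2 ℕ.* suc k))) (poly k e d) (cong +_ (arg k e)) (refl {x = + suc (2 ℕ.* d)}) (cong +_ (arg′ k e)))
          (trans (opposite _ _ (w (+ suc (2 ℕ.* e)) (+ (2 ℕ.* suc k) + + suc (2 ℕ.* d)) (+ suc (2 ℕ.* e) + + (2 ℕ.* suc k))) (sign (+ suc (2 ℕ.* e)) (+ suc (2 ℕ.* d)) (+ (2 ℕ.* suc k))))
            (cong (λ z → (- 1ℤ) * z) (sym (weight _ (poly′ k e d) (refl {x = + suc (2 ℕ.* e)}) (cong +_ (arg″ k d)) (cong +_ (arg‴ k e)))))))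
          where
          poly : ∀ k e d → suc (2 ℕ.* (suc k ℕ.+ e ℕ.+ suc k)) ℕ.* suc (2 ℕ.* (suc k ℕ.+ e ℕ.+ suc k)) ℕ.+ 4 ℕ.* (suc (2 ℕ.* d) ℕ.* suc (2 ℕ.* (suc k ℕ.+ e)))
               ≡ (suc (2 ℕ.* e) ℕ.+ 4 ℕ.* suc k) ℕ.* (suc (2 ℕ.* e) ℕ.+ 4 ℕ.* suc k) ℕ.+ 4 ℕ.* (suc (2 ℕ.* d) ℕ.* (suc (2 ℕ.* e) ℕ.+ 2 ℕ.* suc k))
          poly = solve-∀
          poly′ : ∀ k e d → suc (2 ℕ.* e) ℕ.* suc (2 ℕ.* e) ℕ.+ 4 ℕ.* (suc (2 ℕ.* (suc k ℕ.+ d)) ℕ.* suc (2 ℕ.* (suc e ℕ.+ k)))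
                ≡ (suc (2 ℕ.* e) ℕ.+ 4 ℕ.* suc k) ℕ.* (suc (2 ℕ.* e) ℕ.+ 4 ℕ.* suc k) ℕ.+ 4 ℕ.* (suc (2 ℕ.* d) ℕ.* (suc (2 ℕ.* e) ℕ.+ 2 ℕ.* suc k))
          poly′ = solve-∀
          arg : ∀ k e → suc (2 ℕ.* (suc k ℕ.+ e ℕ.+ suc k)) ≡ suc (2 ℕ.* e) ℕ.+ 2 ℕ.* suc k ℕ.+ 2 ℕ.* suc k
          arg = solve-∀
          arg′ : ∀ k e → suc (2 ℕ.* (suc k ℕ.+ e)) ≡ suc (2 ℕ.* e) ℕ.+ 2 ℕ.* suc k
          arg′ = solve-∀
          arg″ : ∀ k d → suc (2 ℕ.* (suc k ℕ.+ d)) ≡ 2 ℕ.* suc k ℕ.+ suc (2 ℕ.* d)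
          arg″ = solve-∀
          arg‴ : ∀ k e → suc (2 ℕ.* (suc e ℕ.+ k)) ≡ suc (2 ℕ.* e) ℕ.+ 2 ℕ.* suc k
          arg‴ = solve-∀
          sign : ∀ e d s → ((d + (e + s)) * (d + (e + s + s)) * ((e + s) - (e + s + s))) ≡ (- 1ℤ) * (((s + d) + (e + s)) * ((s + d) + e) * ((e + s) - e))
          sign = ℤ-Solver.solve-∀

      -- For `N = k² + 4de` the term is `(5k² − N)e = 4e(k² − de)`. Its part symmetric in `d` and
      -- `e` is, up to sign, the symmetrised weight of `weighted-sum`; the antisymmetric part sums
      -- to 0.
      five-divisors : Σ (λ p → (+ 5 * + sq p - + N) * pull N (sq p) divisor-sum) ≡ 0ℤ
      five-divisors = begin
        Σ (λ p → (+ 5 * + sq p - + N) * pull N (sq p) divisor-sum)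
          ≡⟨ sumTo-cong B (λ p → trans (cong (λ s → (+ 5 * + sq p - + N) * s) (unpull p)) (sym (trans (sumTo-cong B λ a → sumTo-*ˡ B (+ 5 * + sq p - + N) _) (sumTo-*ˡ B (+ 5 * + sq p - + N) _)))) ⟩
        Σ³ (λ p a e → (+ 5 * + sq p - + N) * at N (form p a e) (+ suc (2 ℕ.* e)))
          ≡⟨ Σ³-cong pointwise ⟩
        Σ³ (λ p a e → (- 1ℤ) * (X p a e + X p e a) + (Y p a e + (- 1ℤ) * Y p e a))
          ≡⟨ trans (Σ³-+ _ _) (cong₂ _+_ (trans (Σ³-* (- 1ℤ) _) (cong (λ s → (- 1ℤ) * s) (Σ³-+ X _))) (trans (Σ³-+ Y _) (cong (λ s → Σ³ Y + s) (Σ³-* (- 1ℤ) _)))) ⟩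
        (- 1ℤ) * (Σ³ X + Σ³ (λ p a e → X p e a)) + (Σ³ Y + (- 1ℤ) * Σ³ (λ p a e → Y p e a))
          ≡⟨ cong₂ (λ x y → (- 1ℤ) * (Σ³ X + x) + (Σ³ Y + (- 1ℤ) * y)) (sumTo-cong B λ p → sumTo-swap B B _) (sumTo-cong B λ p → sumTo-swap B B _) ⟩
        (- 1ℤ) * (Σ³ X + Σ³ X) + (Σ³ Y + (- 1ℤ) * Σ³ Y)
          ≡⟨ cong (λ s → (- 1ℤ) * (s + s) + (Σ³ Y + (- 1ℤ) * Σ³ Y)) (trans (sym (S-dummy X)) weighted-sum) ⟩
        (- 1ℤ) * (0ℤ + 0ℤ) + (Σ³ Y + (- 1ℤ) * Σ³ Y)
          ≡⟨ cancel (Σ³ Y) ⟩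
        0ℤ ∎
        where
        Σ³ : (ℕ → ℕ → ℕ → ℤ) → ℤ
        Σ³ F = Σ (λ p → Σ (λ a → Σ (λ e → F p a e)))
        Σ³-cong : ∀ {F G} → (∀ p a e → F p a e ≡ G p a e) → Σ³ F ≡ Σ³ G
        Σ³-cong q = sumTo-cong B λ p → sumTo-cong B λ a → sumTo-cong B λ e → q p a e
        Σ³-+ : ∀ F G → Σ³ (λ p a e → F p a e + G p a e) ≡ Σ³ F + Σ³ G
        Σ³-+ F G = trans (sumTo-cong B λ p → trans (sumTo-cong B λ a → sumTo-+ B _ _) (sumTo-+ B _ _)) (sumTo-+ B _ _)
        Σ³-* : ∀ c F → Σ³ (λ p a e → c * F p a e) ≡ c * Σ³ F
        Σ³-* c F = trans (sumTo-cong B λ p → trans (sumTo-cong B λ a → sumTo-*ˡ B c _) (sumTo-*ˡ B c _)) (sumTo-*ˡ B c _)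
        cancel : ∀ y → (- 1ℤ) * (0ℤ + 0ℤ) + (y + (- 1ℤ) * y) ≡ 0ℤ
        cancel = ℤ-Solver.solve-∀
        unpull : ∀ p → pull N (sq p) divisor-sum ≡ Σ (λ a → Σ (λ e → at N (form p a e) (+ suc (2 ℕ.* e))))
        unpull p = trans (pull-sum B N (sq p) _) (sumTo-cong B λ a → trans (pull-sum B N (sq p) _) (sumTo-cong B λ e → sym (at-pull N (sq p) _ _)))
        X Y : ℕ → ℕ → ℕ → ℤ
        X k d e = at N (form k d e) (w (+ suc (2 ℕ.* k)) (+ suc (2 ℕ.* d)) (+ suc (2 ℕ.* e)))
        Y k d e = at N (form k d e) (+ 2 * + suc (2 ℕ.* e) * (+ suc (2 ℕ.* k) * + suc (2 ℕ.* k) - + suc (2 ℕ.* d) * + suc (2 ℕ.* e)))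
        pointwise : ∀ k d e → (+ 5 * + sq k - + N) * at N (form k d e) (+ suc (2 ℕ.* e)) ≡ (- 1ℤ) * (X k d e + X k e d) + (Y k d e + (- 1ℤ) * Y k e d)
        pointwise k d e with form k d e ≟ N
        ... | no ne = trans (cong (λ s → (+ 5 * + sq k - + N) * s) (at-≢ _ ne)) (trans (ℤₚ.*-zeroʳ (+ 5 * + sq k - + N))
          (sym (cong₂ (λ x y → (- 1ℤ) * x + y) (cong₂ _+_ (at-≢ _ ne) (at-≢ _ ne′)) (cong₂ (λ x y → x + (- 1ℤ) * y) (at-≢ _ ne) (at-≢ _ ne′)))))
          where
          ne′ : form k e d ≢ N
          ne′ eq = ne (trans (cong (λ n → sq k ℕ.+ 4 ℕ.* n) (ℕₚ.*-comm (suc (2 ℕ.* d)) (suc (2 ℕ.* e)))) eq)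
        ... | yes eq = begin
          (+ 5 * + sq k - + N) * at N (form k d e) (+ suc (2 ℕ.* e))
            ≡⟨ cong₂ _*_ (cong (λ n → + 5 * + sq k - + n) (sym eq)) (hit _ eq) ⟩
          (+ 5 * + sq k - + (form k d e)) * + suc (2 ℕ.* e)
            ≡⟨ cong (λ z → z * + suc (2 ℕ.* e)) (trans (cong₂ (λ x y → + 5 * x - (x + y)) (ℤₚ.pos-* (suc (2 ℕ.* k)) (suc (2 ℕ.* k))) (trans (ℤₚ.pos-* 4 (suc (2 ℕ.* d) ℕ.* suc (2 ℕ.* e))) (cong (λ z → + 4 * z) (ℤₚ.pos-* (suc (2 ℕ.* d)) (suc (2 ℕ.* e)))))) refl) ⟩
          (+ 5 * (K * K) - (K * K + + 4 * (D * E))) * E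
            ≡⟨ identity K D E ⟩
          (- 1ℤ) * (w K D E + w K E D) + (+ 2 * E * (K * K - D * E) + (- 1ℤ) * (+ 2 * D * (K * K - E * D)))
            ≡⟨ sym (cong₂ (λ x y → (- 1ℤ) * x + y) (cong₂ _+_ (hit _ eq) (hit _ eq′)) (cong₂ (λ x y → x + (- 1ℤ) * y) (hit _ eq) (hit _ eq′))) ⟩
          (- 1ℤ) * (X k d e + X k e d) + (Y k d e + (- 1ℤ) * Y k e d) ∎
          where
          K D E : ℤ
          K = + suc (2 ℕ.* k)
          D = + suc (2 ℕ.* d)
          E = + suc (2 ℕ.* e)
          eq′ : form k e d ≡ N
          eq′ = trans (cong (λ n → sq k ℕ.+ 4 ℕ.* n) (ℕₚ.*-comm (suc (2 ℕ.* e)) (suc (2 ℕ.* d)))) eq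
          hit : ∀ {n} x → n ≡ N → at N n x ≡ x
          hit x refl = at-≡ N x
          identity : ∀ K D E → (+ 5 * (K * K) - (K * K + + 4 * (D * E))) * E
                   ≡ (- 1ℤ) * (((D + E) * (D + K) * (E - K)) + ((E + D) * (E + K) * (D - K))) + (+ 2 * E * (K * K - D * E) + (- 1ℤ) * (+ 2 * D * (K * K - E * D)))
          identity = ℤ-Solver.solve-∀

    Σ-first : ∀ {F : ℕ → ℤ} → (∀ i → F (suc i) ≡ 0ℤ) → Σ F ≡ F 0
    Σ-first {F} e = trans (first 0<B F) (trans (cong (λ s → F 0 + s) (sumTo-0 (ℕ.pred B) e)) (ℤₚ.+-identityʳ (F 0)))
      where
      first : ∀ {n} → 0 < n → ∀ (F : ℕ → ℤ) → sumTo n F ≡ F 0 + sumTo (ℕ.pred n) (λ i → F (suc i))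
      first {suc n} _ F = sumTo-suc n F

    sq≥ : ∀ p → p < sq p
    sq≥ p = grow {a = suc p} ≤-refl (3 ℕ.* p ℕ.+ 4 ℕ.* p ℕ.* p) (bound p)
      where
      bound : ∀ p → suc p ℕ.+ (3 ℕ.* p ℕ.+ 4 ℕ.* p ℕ.* p) ≡ suc (2 ℕ.* p) ℕ.* suc (2 ℕ.* p)
      bound = solve-∀

    sq-suc≥ : ∀ p → 1 < sq (suc p)
    sq-suc≥ p = grow {a = 2} (s≤s (s≤s z≤n)) (7 ℕ.+ 12 ℕ.* p ℕ.+ 4 ℕ.* p ℕ.* p) (bound p)
      where
      bound : ∀ p → 2 ℕ.+ (7 ℕ.+ 12 ℕ.* p ℕ.+ 4 ℕ.* p ℕ.* p) ≡ suc (2 ℕ.* (suc p)) ℕ.* suc (2 ℕ.* (suc p))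
      bound = solve-∀

    private
      one : at 4 4 1ℤ ≡ 1ℤ
      one = at-≡ 4 1ℤ
      big : ∀ i x → 4 < sq (suc i) ℕ.+ x
      big i x = ≤-trans (grow {a = 9} (s≤s (s≤s (s≤s (s≤s (s≤s z≤n))))) (12 ℕ.* i ℕ.+ 4 ℕ.* i ℕ.* i) (bound i)) (m≤m+n (sq (suc i)) x)
        where
        bound : ∀ p → 9 ℕ.+ (12 ℕ.* p ℕ.+ 4 ℕ.* p ℕ.* p) ≡ suc (2 ℕ.* (suc p)) ℕ.* suc (2 ℕ.* (suc p))
        bound = solve-∀
      none : ∀ {n} i x → n ≡ sq (suc i) ℕ.+ x → at 4 n 1ℤ ≡ 0ℤ
      none i x refl = at-≢ _ λ e → <-irrefl (sym e) (big i x)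
      four-4 : four 4 ≡ 1ℤ
      four-4 = trans (Σ-first λ i → sumTo-0 B λ j → sumTo-0 B λ k → sumTo-0 B λ l → none i _ (arr₁ (sq (suc i)) (sq j) (sq k) (sq l)))
        (trans (Σ-first λ j → sumTo-0 B λ k → sumTo-0 B λ l → none j _ (arr₂ (sq (suc j)) (sq k) (sq l)))
        (trans (Σ-first λ k → sumTo-0 B λ l → none k _ (arr₃ (sq (suc k)) (sq l)))
        (trans (Σ-first λ l → none l _ (arr₄ (sq (suc l)))) one)))
        where
        arr₁ : ∀ a b c d → a ℕ.+ b ℕ.+ c ℕ.+ d ≡ a ℕ.+ (b ℕ.+ c ℕ.+ d)
        arr₁ = solve-∀
        arr₂ : ∀ b c d → 1 ℕ.+ b ℕ.+ c ℕ.+ d ≡ b ℕ.+ (1 ℕ.+ c ℕ.+ d)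
        arr₂ = solve-∀
        arr₃ : ∀ c d → 2 ℕ.+ c ℕ.+ d ≡ c ℕ.+ (2 ℕ.+ d)
        arr₃ = solve-∀
        arr₄ : ∀ d → 3 ℕ.+ d ≡ d ℕ.+ 3
        arr₄ = solve-∀
      divisors-4 : divisor-sum 4 ≡ 1ℤ
      divisors-4 = trans (Σ-first λ a → sumTo-0 B λ e → at-≢ _ λ eq → large a e eq)
        (trans (Σ-first λ e → at-≢ _ λ eq → large′ e eq) one)
        where
        large : ∀ a e → 4 ℕ.* (suc (2 ℕ.* (suc a)) ℕ.* suc (2 ℕ.* e)) ≢ 4
        large a e eq = <-irrefl (sym eq) (grow {a = 12} (s≤s (s≤s (s≤s (s≤s (s≤s z≤n))))) (24 ℕ.* e ℕ.+ 8 ℕ.* a ℕ.+ 16 ℕ.* a ℕ.* e) (bound a e))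
          where
          bound : ∀ a e → 12 ℕ.+ (24 ℕ.* e ℕ.+ 8 ℕ.* a ℕ.+ 16 ℕ.* a ℕ.* e) ≡ 4 ℕ.* (suc (2 ℕ.* (suc a)) ℕ.* suc (2 ℕ.* e))
          bound = solve-∀
        large′ : ∀ e → 4 ℕ.* (1 ℕ.* suc (2 ℕ.* (suc e))) ≢ 4
        large′ e eq = <-irrefl (sym eq) (grow {a = 12} (s≤s (s≤s (s≤s (s≤s (s≤s z≤n))))) (8 ℕ.* e) (bound e))
          where
          bound : ∀ e → 12 ℕ.+ 8 ℕ.* e ≡ 4 ℕ.* (1 ℕ.* suc (2 ℕ.* (suc e)))
          bound = solve-∀

    -- In the recursion at `N = suc n` the leading coefficient is `5 − suc n`. It vanishes only for
    -- `n = 4`, where both sides are 1; otherwise the induction hypothesis determines the leading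
    -- term.
    four≡divisor-sum : ∀ n → suc n < B → four n ≡ divisor-sum n
    four≡divisor-sum n n<B = ℤₚ.i-j≡0⇒i≡j _ _ (<-rec (λ n → suc n < B → four n - divisor-sum n ≡ 0ℤ) step n n<B)
      where
      D : ℕ → ℤ
      D n = four n - divisor-sum n
      recursion : ∀ N → N < B → Σ (λ p → (+ 5 * + sq p - + N) * pull N (sq p) D) ≡ 0ℤ
      recursion N N<B = begin
        Σ (λ p → (+ 5 * + sq p - + N) * pull N (sq p) D) ≡⟨ sumTo-cong B (λ p → trans (cong (λ s → (+ 5 * + sq p - + N) * s)
          (trans (pull-cong N (sq p) λ n → cong (λ s → four n + s) (sym (neg (divisor-sum n)))) (trans (pull-+ N (sq p) four _) (cong (λ s → pull N (sq p) four + s) (pull-* N (sq p) (- 1ℤ) divisor-sum)))))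
          (distribute (+ 5 * + sq p - + N) (pull N (sq p) four) (pull N (sq p) divisor-sum))) ⟩
        Σ (λ p → (+ 5 * + sq p - + N) * pull N (sq p) four + (- 1ℤ) * ((+ 5 * + sq p - + N) * pull N (sq p) divisor-sum))
          ≡⟨ trans (sumTo-+ B _ _) (cong₂ _+_ (five N) (trans (sumTo-*ˡ B (- 1ℤ) _) (cong (λ s → (- 1ℤ) * s) (five-divisors N N<B)))) ⟩
        0ℤ ∎
        where
        neg : ∀ x → (- 1ℤ) * x ≡ - x
        neg = ℤ-Solver.solve-∀
        distribute : ∀ c x y → c * (x + (- 1ℤ) * y) ≡ c * x + (- 1ℤ) * (c * y)
        distribute = ℤ-Solver.solve-∀
      step : ∀ n → (∀ {n′} → n′ < n → suc n′ < B → D n′ ≡ 0ℤ) → suc n < B → D n ≡ 0ℤ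
      step n ih n<B = [ at-four , (λ e → e) ]′ (ℤₚ.i*j≡0⇒i≡0∨j≡0 (+ 5 - + suc n) {D n} (trans (sym head) (recursion (suc n) n<B)))
        where
        smaller : ∀ n′ p → n′ ℕ.+ sq (suc p) ≡ suc n → n′ < n
        smaller n′ p e = s≤s⁻¹ (≤-trans (≤-reflexive (ℕₚ.+-comm 2 n′)) (≤-trans (ℕₚ.+-monoʳ-≤ n′ (sq-suc≥ p)) (≤-reflexive e)))
        tail : ∀ p → (+ 5 * + sq (suc p) - + suc n) * pull (suc n) (sq (suc p)) D ≡ 0ℤ
        tail p = trans (cong (λ s → (+ 5 * + sq (suc p) - + suc n) * s) (pull-0 (suc n) (sq (suc p)) λ n′ e →
          ih (smaller n′ p e) (ℕₚ.<-trans (s≤s (smaller n′ p e)) n<B))) (ℤₚ.*-zeroʳ (+ 5 * + sq (suc p) - + suc n))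
        head : Σ (λ p → (+ 5 * + sq p - + suc n) * pull (suc n) (sq p) D) ≡ (+ 5 - + suc n) * D n
        head = Σ-first tail
        at-four : + 5 - + suc n ≡ 0ℤ → D n ≡ 0ℤ
        at-four e = subst (λ n → D n ≡ 0ℤ) (ℕₚ.suc-injective (ℤₚ.+-injective (ℤₚ.i-j≡0⇒i≡j (+ 5) (+ suc n) e))) (cong₂ _-_ four-4 divisors-4)

    -- Summation over the squares u = x² of all even integers x.
    E : (ℕ → ℤ) → ℤ
    E F = F 0 + + 2 * Σ (λ j → F (4 ℕ.* (suc j ℕ.* suc j)))

    E-cong : ∀ {F G : ℕ → ℤ} → (∀ u → F u ≡ G u) → E F ≡ E G
    E-cong e = cong₂ (λ x y → x + + 2 * y) (e 0) (sumTo-cong B λ j → e _)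

    Σ-E : ∀ (F : ℕ → ℕ → ℤ) → Σ (λ i → E (F i)) ≡ E (λ u → Σ (λ i → F i u))
    Σ-E F = trans (sumTo-+ B _ _) (cong (λ s → Σ (λ i → F i 0) + s) (trans (sumTo-*ˡ B (+ 2) _) (cong (λ s → + 2 * s) (sumTo-swap B B _))))

    pull-E : ∀ N a (F : ℕ → ℕ → ℤ) → pull N a (λ n → E (F n)) ≡ E (λ u → pull N a (λ n → F n u))
    pull-E N a F = trans (pull-+ N a _ _) (cong (λ s → pull N a (λ n → F n 0) + s) (trans (pull-* N a (+ 2) _) (cong (λ s → + 2 * s) (pull-sum B N a _))))

    -- p² + q² = 2(y² + x²) with y odd and x even.
    odd-pairs : ∀ (H : ℕ → ℤ) → (∀ n → B ≤ n → H n ≡ 0ℤ) → Σ (λ p → Σ (λ q → H (sq p ℕ.+ sq q))) ≡ Σ (λ i → E (λ u → H (2 ℕ.* (sq i ℕ.+ u))))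
    odd-pairs H v = trans lhs (sym rhs)
      where
      K M : ℕ → ℕ → ℤ
      K q t = H (sq (q ℕ.+ suc t) ℕ.+ sq q)
      M j i = H (2 ℕ.* (sq i ℕ.+ 4 ℕ.* (suc j ℕ.* suc j)))
      vˡ : ∀ {p q n} → B ≤ p → n ≡ sq p ℕ.+ q → H n ≡ 0ℤ
      vˡ {p} {q} b refl = v _ (≤-trans b (≤-trans (ℕₚ.<⇒≤ (sq≥ p)) (m≤m+n (sq p) q)))
      diagonal : ℤ
      diagonal = Σ (λ q → H (2 ℕ.* (sq q ℕ.+ 0)))
      lhs : Σ (λ p → Σ (λ q → H (sq p ℕ.+ sq q))) ≡ diagonal + + 2 * Σ (λ q → Σ (K q))
      lhs = begin
        Σ (λ p → Σ (λ q → H (sq p ℕ.+ sq q)))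
          ≡⟨ Σ-split (λ p q → H (sq p ℕ.+ sq q)) (λ q p b → vˡ b refl) (λ p q b → vˡ b (ℕₚ.+-comm (sq p) (sq q))) ⟩
        Σ (λ p → Σ (λ q → H (sq (q ℕ.+ p) ℕ.+ sq q))) + Σ (λ p → Σ (λ q → H (sq p ℕ.+ sq (suc p ℕ.+ q))))
          ≡⟨ cong₂ _+_ (trans (sumTo-swap B B _) (trans (sumTo-cong B λ q → Σ-suc {λ p → H (sq (q ℕ.+ p) ℕ.+ sq q)} λ p b → vˡ (≤-trans b (m≤n+m p q)) refl) (sumTo-+ B _ _)))
               (sumTo-cong B λ p → sumTo-cong B λ q → cong H (trans (ℕₚ.+-comm (sq p) _) (cong (λ n → sq n ℕ.+ sq p) (sym (ℕₚ.+-suc p q))))) ⟩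
        Σ (λ q → H (sq (q ℕ.+ 0) ℕ.+ sq q)) + Σ (λ q → Σ (K q)) + Σ (λ q → Σ (K q))
          ≡⟨ cong (λ s → s + Σ (λ q → Σ (K q)) + Σ (λ q → Σ (K q))) (sumTo-cong B λ q → cong H (double q)) ⟩
        diagonal + Σ (λ q → Σ (K q)) + Σ (λ q → Σ (K q))
          ≡⟨ linear diagonal (Σ (λ q → Σ (K q))) ⟩
        diagonal + + 2 * Σ (λ q → Σ (K q)) ∎
        where
        double : ∀ q → suc (2 ℕ.* (q ℕ.+ 0)) ℕ.* suc (2 ℕ.* (q ℕ.+ 0)) ℕ.+ suc (2 ℕ.* q) ℕ.* suc (2 ℕ.* q) ≡ 2 ℕ.* (suc (2 ℕ.* q) ℕ.* suc (2 ℕ.* q) ℕ.+ 0)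
        double = solve-∀
        linear : ∀ d k → d + k + k ≡ d + + 2 * k
        linear = ℤ-Solver.solve-∀
      rhs : Σ (λ i → E (λ u → H (2 ℕ.* (sq i ℕ.+ u)))) ≡ diagonal + + 2 * Σ (λ q → Σ (K q))
      rhs = trans (sumTo-+ B _ _) (cong (λ s → diagonal + s) (trans (sumTo-*ˡ B (+ 2) _) (cong (λ s → + 2 * s) (begin
        Σ (λ i → Σ (λ j → M j i)) ≡⟨ sumTo-swap B B _ ⟩
        Σ (λ j → Σ (M j))
          ≡⟨ Σ-split M (λ i j b → vˡ {j} (≤-trans b ≤-refl) (large j i)) (λ j i b → vˡ {i} b (twice i _)) ⟩
        Σ (λ j → Σ (λ i → M (i ℕ.+ j) i)) + Σ (λ j → Σ (λ i → M j (suc j ℕ.+ i)))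
          -- For odd `P > Q` with `P − Q = 2(t + 1)`, the half difference `t + 1` and the half sum
          -- differ by `Q`, so exactly one of them is odd. Even `t` makes the half difference the
          -- odd root `y`, odd `t` the even root `x`.
          ≡⟨ cong₂ _+_ (sumTo-cong B λ q → sumTo-cong B λ i → cong H (ev-poly q i)) (trans (sumTo-swap B B _) (sumTo-cong B λ q → sumTo-cong B λ j → cong H (od-poly q j))) ⟩
        Σ (λ q → Σ (λ i → K q (2 ℕ.* i))) + Σ (λ q → Σ (λ j → K q (suc (2 ℕ.* j))))
          ≡⟨ sym (trans (sumTo-cong B λ q → Σ-parity {K q} λ t b → vˡ (≤-trans (m≤n⇒m≤1+n b) (m≤n+m (suc t) q)) refl) (sumTo-+ B _ _)) ⟩
        Σ (λ q → Σ (K q)) ∎))))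
        where
        twice : ∀ i x → 2 ℕ.* (sq i ℕ.+ x) ≡ sq i ℕ.+ (sq i ℕ.+ 2 ℕ.* x)
        twice i x = e (sq i) x
          where e : ∀ s x → 2 ℕ.* (s ℕ.+ x) ≡ s ℕ.+ (s ℕ.+ 2 ℕ.* x)
                e = solve-∀
        large : ∀ j i → 2 ℕ.* (suc (2 ℕ.* i) ℕ.* suc (2 ℕ.* i) ℕ.+ 4 ℕ.* (suc j ℕ.* suc j)) ≡ suc (2 ℕ.* j) ℕ.* suc (2 ℕ.* j) ℕ.+ (2 ℕ.* (suc (2 ℕ.* i) ℕ.* suc (2 ℕ.* i)) ℕ.+ 7 ℕ.+ 12 ℕ.* j ℕ.+ 4 ℕ.* j ℕ.* j)
        large = solve-∀
        ev-poly : ∀ q i → 2 ℕ.* (suc (2 ℕ.* i) ℕ.* suc (2 ℕ.* i) ℕ.+ 4 ℕ.* (suc (i ℕ.+ q) ℕ.* suc (i ℕ.+ q)))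
                ≡ suc (2 ℕ.* (q ℕ.+ suc (2 ℕ.* i))) ℕ.* suc (2 ℕ.* (q ℕ.+ suc (2 ℕ.* i))) ℕ.+ suc (2 ℕ.* q) ℕ.* suc (2 ℕ.* q)
        ev-poly = solve-∀
        od-poly : ∀ q j → 2 ℕ.* (suc (2 ℕ.* (suc j ℕ.+ q)) ℕ.* suc (2 ℕ.* (suc j ℕ.+ q)) ℕ.+ 4 ℕ.* (suc j ℕ.* suc j))
                ≡ suc (2 ℕ.* (q ℕ.+ suc (suc (2 ℕ.* j)))) ℕ.* suc (2 ℕ.* (q ℕ.+ suc (suc (2 ℕ.* j)))) ℕ.+ suc (2 ℕ.* q) ℕ.* suc (2 ℕ.* q)
        od-poly = solve-∀

    E-0 : ∀ {F : ℕ → ℤ} → (∀ u → F u ≡ 0ℤ) → E F ≡ 0ℤ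
    E-0 e = cong₂ (λ x y → x + + 2 * y) (e 0) (sumTo-0 B λ j → e _)

    -- The identity for two odd squares is applied to both pairs among the four; the factor 2 then
    -- cancels.
    even-four : ∀ N → 2 ℕ.* N < B →
      four (2 ℕ.* N) ≡ Σ (λ i → E (λ u → Σ (λ k → E (λ v → at N ((sq i ℕ.+ u) ℕ.+ (sq k ℕ.+ v)) 1ℤ))))
    even-four N 2N<B = begin
      four (2 ℕ.* N)
        ≡⟨ sumTo-cong B (λ i → sumTo-cong B λ j → inner (sq i) (sq j)) ⟩
      Σ (λ i → Σ (λ j → G (sq i ℕ.+ sq j)))
        ≡⟨ odd-pairs G (λ n b → sumTo-0 B λ k → E-0 λ v → large n (2 ℕ.* (sq k ℕ.+ v)) b) ⟩
      Σ (λ i → E (λ u → G (2 ℕ.* (sq i ℕ.+ u))))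
        ≡⟨ sumTo-cong B (λ i → E-cong λ u → sumTo-cong B λ k → E-cong λ v → halve (sq i ℕ.+ u) (sq k ℕ.+ v)) ⟩
      Σ (λ i → E (λ u → Σ (λ k → E (λ v → at N ((sq i ℕ.+ u) ℕ.+ (sq k ℕ.+ v)) 1ℤ)))) ∎
      where
      G : ℕ → ℤ
      G n = Σ (λ k → E (λ v → at (2 ℕ.* N) (n ℕ.+ 2 ℕ.* (sq k ℕ.+ v)) 1ℤ))
      large : ∀ n x → B ≤ n → at (2 ℕ.* N) (n ℕ.+ x) 1ℤ ≡ 0ℤ
      large n x b = at-≢ _ λ e → <-irrefl (sym e) (<-≤-trans 2N<B (≤-trans b (m≤m+n n x)))
      inner : ∀ a b → Σ (λ k → Σ (λ l → at (2 ℕ.* N) (a ℕ.+ b ℕ.+ sq k ℕ.+ sq l) 1ℤ)) ≡ G (a ℕ.+ b)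
      inner a b = trans (sumTo-cong B λ k → sumTo-cong B λ l → cong (λ n → at (2 ℕ.* N) n 1ℤ) (ℕₚ.+-assoc (a ℕ.+ b) (sq k) (sq l)))
        (odd-pairs (λ n → at (2 ℕ.* N) (a ℕ.+ b ℕ.+ n) 1ℤ) λ n le → trans (cong (λ n → at (2 ℕ.* N) n 1ℤ) (ℕₚ.+-comm (a ℕ.+ b) n)) (large n (a ℕ.+ b) le))
      halve : ∀ x y → at (2 ℕ.* N) (2 ℕ.* x ℕ.+ 2 ℕ.* y) 1ℤ ≡ at N (x ℕ.+ y) 1ℤ
      halve x y = trans (cong (λ n → at (2 ℕ.* N) n 1ℤ) (sym (ℕₚ.*-distribˡ-+ 2 x y))) (at-mul 1 N (x ℕ.+ y) 1ℤ)

    σ : ℕ → ℤ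
    σ m = Σ (λ a → Σ (λ e → at m (suc (2 ℕ.* a) ℕ.* suc (2 ℕ.* e)) (+ suc (2 ℕ.* e))))

    four≡σ : ∀ m → suc (4 ℕ.* m) < B → four (4 ℕ.* m) ≡ σ m
    four≡σ m b = trans (four≡divisor-sum (4 ℕ.* m) b) (sumTo-cong B λ a → sumTo-cong B λ e → at-mul 3 m (suc (2 ℕ.* a) ℕ.* suc (2 ℕ.* e)) (+ suc (2 ℕ.* e)))

    pull-ΣΣ : ∀ N a (F : ℕ → ℕ → ℕ → ℤ) → pull N a (λ n → Σ (λ i → Σ (λ j → F n i j))) ≡ Σ (λ i → Σ (λ j → pull N a (λ n → F n i j)))
    pull-ΣΣ N a F = trans (pull-sum B N a _) (sumTo-cong B λ i → pull-sum B N a _)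

    pull-ΣΣΣ : ∀ N a (F : ℕ → ℕ → ℕ → ℕ → ℤ) →
      pull N a (λ n → Σ (λ i → Σ (λ j → Σ (λ k → F n i j k)))) ≡ Σ (λ i → Σ (λ j → Σ (λ k → pull N a (λ n → F n i j k))))
    pull-ΣΣΣ N a F = trans (pull-ΣΣ N a _) (sumTo-cong B λ i → sumTo-cong B λ j → pull-sum B N a _)

    -- R₃, R₁, R₂ count representations of n, n, 2n by three squares in the classes n ≡ 3 mod 8, n ≡ 1 mod 4, 2n ≡ 2 mod 4;
    -- G₃, G₁, G₂ count forms in Kronecker's manner and satisfy the same recursions.
    R₃ R₁ R₂ G₃ G₁ G₂ : ℕ → ℤ
    R₃ n = Σ (λ i → Σ (λ j → Σ (λ k → at n (sq i ℕ.+ sq j ℕ.+ sq k) 1ℤ)))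
    R₁ n = Σ (λ k → E (λ u → E (λ v → at n (sq k ℕ.+ (u ℕ.+ v)) 1ℤ)))
    R₂ n = E (λ v → Σ (λ i → Σ (λ k → at (2 ℕ.* n) (v ℕ.+ (sq i ℕ.+ sq k)) 1ℤ)))
    G₃ n = Σ (λ x → Σ (λ y → Σ (λ z → at n (suc (2 ℕ.* x) ℕ.* suc (2 ℕ.* y) ℕ.+ suc (2 ℕ.* y) ℕ.* suc (2 ℕ.* z) ℕ.+ suc (2 ℕ.* z) ℕ.* suc (2 ℕ.* x)) 1ℤ)))
    G₁ n = Σ (λ i → Σ (λ j → at n (suc (2 ℕ.* i) ℕ.* suc (2 ℕ.* j)) 1ℤ))
         + + 2 * Σ (λ i → Σ (λ j → Σ (λ z → at n (suc (2 ℕ.* i) ℕ.* suc (2 ℕ.* j) ℕ.+ 2 ℕ.* suc z ℕ.* (suc (2 ℕ.* i) ℕ.+ suc (2 ℕ.* j))) 1ℤ)))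
    G₂ n = Σ (λ y → Σ (λ z → at n (suc y ℕ.* suc z) 1ℤ))
         + Σ (λ i → Σ (λ j → Σ (λ z → at n (2 ℕ.* suc i ℕ.* suc j ℕ.+ suc z ℕ.* (suc i ℕ.+ suc j)) 1ℤ)))

    -- Recursions of the three-square counts.

    R₃-recursion : ∀ N → Σ (λ p → pull N (sq p) R₃) ≡ four N
    R₃-recursion N = sumTo-cong B λ p → trans (pull-ΣΣΣ N (sq p) _) (sumTo-cong B λ i → sumTo-cong B λ j → sumTo-cong B λ k →
      trans (sym (at-pull N (sq p) _ 1ℤ)) (cong (λ n → at N n 1ℤ) (assoc (sq p) (sq i) (sq j) (sq k))))
      where
      assoc : ∀ p i j k → p ℕ.+ (i ℕ.+ j ℕ.+ k) ≡ p ℕ.+ i ℕ.+ j ℕ.+ k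
      assoc = solve-∀

    -- One odd square is split off from the four of `even-four`, leaving one odd and two even ones.
    R₁-recursion : ∀ N → 2 ℕ.* N < B → Σ (λ p → pull N (sq p) R₁) ≡ four (2 ℕ.* N)
    R₁-recursion N b = trans (sumTo-cong B λ p → trans (pull-sum B N (sq p) _) (trans (sumTo-cong B λ k →
        trans (pull-E N (sq p) (λ n u → E (λ v → at n (sq k ℕ.+ (u ℕ.+ v)) 1ℤ))) (E-cong λ u → trans (pull-E N (sq p) (λ n v → at n (sq k ℕ.+ (u ℕ.+ v)) 1ℤ)) (E-cong λ v →
          trans (sym (at-pull N (sq p) _ 1ℤ)) (cong (λ n → at N n 1ℤ) (assoc (sq p) (sq k) u v))))) (Σ-E λ k u → E (λ v → at N ((sq p ℕ.+ u) ℕ.+ (sq k ℕ.+ v)) 1ℤ))))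
      (sym (even-four N b))
      where
      assoc : ∀ p k u v → p ℕ.+ (k ℕ.+ (u ℕ.+ v)) ≡ (p ℕ.+ u) ℕ.+ (k ℕ.+ v)
      assoc = solve-∀

    at-pull-double : ∀ N a b x → at (2 ℕ.* N) (2 ℕ.* a ℕ.+ b) x ≡ pull N a (λ n → at (2 ℕ.* n) b x)
    at-pull-double N       zero    b x = refl
    at-pull-double zero    (suc a) b x = at-≢ x λ ()
    at-pull-double (suc N) (suc a) b x = trans (cong₂ (λ N n → at N n x) (2*suc N) (cong (ℕ._+ b) (2*suc a)))
      (trans (at-suc _ _ x) (trans (at-suc _ _ x) (at-pull-double N a b x)))

    -- Here an even square is split off from the four of `even-four`. The zero square gives the
    -- leading term; a square `4p²` lowers `2m`, hence lowers the argument `m` of `R₂` by `2p²`.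
    R₂-recursion : ∀ m → 2 ℕ.* (2 ℕ.* m) < B → R₂ m + + 2 * Σ (λ p → pull m (2 ℕ.* (suc p ℕ.* suc p)) R₂) ≡ four (2 ℕ.* (2 ℕ.* m))
    R₂-recursion m b = sym (begin
      four (2 ℕ.* (2 ℕ.* m))
        ≡⟨ even-four (2 ℕ.* m) b ⟩
      Σ (λ i → E (λ u → Σ (λ k → E (λ v → at (2 ℕ.* m) ((sq i ℕ.+ u) ℕ.+ (sq k ℕ.+ v)) 1ℤ))))
        ≡⟨ Σ-E (λ i u → Σ (λ k → E (λ v → X u i k v))) ⟩
      E (λ u → Σ (λ i → Σ (λ k → E (λ v → at (2 ℕ.* m) ((sq i ℕ.+ u) ℕ.+ (sq k ℕ.+ v)) 1ℤ))))
        ≡⟨ E-cong (λ u → trans (sumTo-cong B λ i → Σ-E (λ k v → X u i k v)) (trans (Σ-E (λ i v → Σ (λ k → X u i k v))) (E-cong λ v → sumTo-cong B λ i → sumTo-cong B λ k →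
             cong (λ n → at (2 ℕ.* m) n 1ℤ) (assoc u v (sq i) (sq k))))) ⟩
      E (λ u → E (λ v → Σ (λ i → Σ (λ k → at (2 ℕ.* m) (u ℕ.+ (v ℕ.+ (sq i ℕ.+ sq k))) 1ℤ))))
        ≡⟨ cong (λ s → R₂ m + + 2 * s) (sumTo-cong B λ p → sym (unpull p)) ⟩
      R₂ m + + 2 * Σ (λ p → pull m (2 ℕ.* (suc p ℕ.* suc p)) R₂) ∎)
      where
      X : ℕ → ℕ → ℕ → ℕ → ℤ
      X u i k v = at (2 ℕ.* m) ((sq i ℕ.+ u) ℕ.+ (sq k ℕ.+ v)) 1ℤ
      assoc : ∀ u v i k → (i ℕ.+ u) ℕ.+ (k ℕ.+ v) ≡ u ℕ.+ (v ℕ.+ (i ℕ.+ k))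
      assoc = solve-∀
      unpull : ∀ p → pull m (2 ℕ.* (suc p ℕ.* suc p)) R₂ ≡ E (λ v → Σ (λ i → Σ (λ k → at (2 ℕ.* m) (4 ℕ.* (suc p ℕ.* suc p) ℕ.+ (v ℕ.+ (sq i ℕ.+ sq k))) 1ℤ)))
      unpull p = trans (pull-E m (2 ℕ.* (suc p ℕ.* suc p)) (λ n v → Σ (λ i → Σ (λ k → at (2 ℕ.* n) (v ℕ.+ (sq i ℕ.+ sq k)) 1ℤ)))) (E-cong λ v → trans (pull-ΣΣ m (2 ℕ.* (suc p ℕ.* suc p)) _) (sumTo-cong B λ i → sumTo-cong B λ k →
        trans (sym (at-pull-double m (2 ℕ.* (suc p ℕ.* suc p)) (v ℕ.+ (sq i ℕ.+ sq k)) 1ℤ)) (cong (λ n → at (2 ℕ.* m) (n ℕ.+ (v ℕ.+ (sq i ℕ.+ sq k))) 1ℤ) (sym (ℕₚ.*-assoc 2 2 (suc p ℕ.* suc p))))))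

    pull-- : ∀ N a (F G : ℕ → ℤ) → pull N a (λ n → F n - G n) ≡ pull N a F - pull N a G
    pull-- N       zero    F G = refl
    pull-- zero    (suc a) F G = refl
    pull-- (suc N) (suc a) F G = pull-- N a F G

    Σ-- : ∀ (F G : ℕ → ℤ) → Σ (λ i → F i - G i) ≡ Σ F - Σ G
    Σ-- F G = trans (sumTo-cong B λ i → neg (F i) (G i)) (trans (sumTo-+ B F _) (trans (cong (λ s → Σ F + s) (sumTo-*ˡ B (- 1ℤ) G)) (sym (neg (Σ F) (Σ G)))))
      where
      neg : ∀ x y → x - y ≡ x + (- 1ℤ) * y
      neg = ℤ-Solver.solve-∀

    -- Odd squares are 1 modulo 8, which keeps the descent within its residue class.
    sq-suc : ∀ p → ∃ λ t → sq (suc p) ≡ suc (8 ℕ.* t)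
    sq-suc zero    = 1 , refl
    sq-suc (suc p) with sq-suc p
    ... | t , e = t ℕ.+ (2 ℕ.+ p) , trans (next p) (trans (cong (ℕ._+ 8 ℕ.* (2 ℕ.+ p)) e) (cong suc (sym (ℕₚ.*-distribˡ-+ 8 t (2 ℕ.+ p)))))
      where
      next : ∀ p → suc (2 ℕ.* (suc (suc p))) ℕ.* suc (2 ℕ.* (suc (suc p))) ≡ suc (2 ℕ.* (suc p)) ℕ.* suc (2 ℕ.* (suc p)) ℕ.+ 8 ℕ.* (2 ℕ.+ p)
      next = solve-∀

    -- Descent: equal recursions have equal solutions.

    module _ (F G : ℕ → ℤ) where

      -- For `suc n = c m` the square 1 gives the term at `n`. A square `1 + 8t` gives the term at
      -- `n′` with `suc n′ = c (m − 2qt)`, since `cq = 4`; the cofactor stays odd, so the induction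
      -- closes. The value `c = 4` is the class `n ≡ 3` modulo 8 and `c = 2` the class `n ≡ 1`
      -- modulo 4.
      descent : ∀ c′ q → suc c′ ℕ.* q ≡ 4 →
        (∀ m → par m ≡ true → 2 ℕ.+ 2 ℕ.* (suc c′ ℕ.* m) ≤ B → Σ (λ p → pull (suc c′ ℕ.* m) (sq p) F) ≡ Σ (λ p → pull (suc c′ ℕ.* m) (sq p) G)) →
        ∀ n m → par m ≡ true → suc n ≡ suc c′ ℕ.* m → 2 ℕ.+ 2 ℕ.* suc n ≤ B → F n ≡ G n
      descent c′ q cq recursion n m odd-m n≡ b = ℤₚ.i-j≡0⇒i≡j (F n) (G n)
        (<-rec (λ n → ∀ m → par m ≡ true → suc n ≡ suc c′ ℕ.* m → 2 ℕ.+ 2 ℕ.* suc n ≤ B → D n ≡ 0ℤ) step n m odd-m n≡ b)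
        where
        c : ℕ
        c = suc c′
        D : ℕ → ℤ
        D n = F n - G n
        smaller : ∀ {n} n′ p → n′ ℕ.+ sq (suc p) ≡ suc n → n′ < n
        smaller n′ p e = s≤s⁻¹ (≤-trans (≤-reflexive (ℕₚ.+-comm 2 n′)) (≤-trans (ℕₚ.+-monoʳ-≤ n′ (sq-suc≥ p)) (≤-reflexive e)))
        closed : ∀ n′ p m → n′ ℕ.+ sq (suc p) ≡ c ℕ.* m → ∃ λ m′ → par m′ ≡ par m × suc n′ ≡ c ℕ.* m′
        closed n′ p m e = m ℕ.∸ 2 ℕ.* (q ℕ.* t) , parity , ℕₚ.+-cancelʳ-≡ (c ℕ.* (2 ℕ.* (q ℕ.* t))) (suc n′) (c ℕ.* (m ℕ.∸ 2 ℕ.* (q ℕ.* t)))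
            (trans shifted (trans (cong (λ k → c ℕ.* k) (sym (ℕₚ.m∸n+n≡m le))) (ℕₚ.*-distribˡ-+ c (m ℕ.∸ 2 ℕ.* (q ℕ.* t)) (2 ℕ.* (q ℕ.* t)))))
          where
          t : ℕ
          t = proj₁ (sq-suc p)
          rearrange : ∀ c q t → c ℕ.* (2 ℕ.* (q ℕ.* t)) ≡ 2 ℕ.* (c ℕ.* q) ℕ.* t
          rearrange = solve-∀
          shifted : suc n′ ℕ.+ c ℕ.* (2 ℕ.* (q ℕ.* t)) ≡ c ℕ.* m
          shifted = trans (cong (λ k → suc n′ ℕ.+ k) (trans (rearrange c q t) (cong (λ k → 2 ℕ.* k ℕ.* t) cq)))
            (trans (sym (ℕₚ.+-suc n′ (8 ℕ.* t))) (trans (cong (λ k → n′ ℕ.+ k) (sym (proj₂ (sq-suc p)))) e))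
          le : 2 ℕ.* (q ℕ.* t) ≤ m
          le = ℕₚ.*-cancelˡ-≤ c (≤-trans (m≤n+m _ (suc n′)) (≤-reflexive shifted))
          parity : par (m ℕ.∸ 2 ℕ.* (q ℕ.* t)) ≡ par m
          parity = trans (sym (par-2*+ (q ℕ.* t) _)) (cong par (ℕₚ.m+[n∸m]≡n le))
        step : ∀ n → (∀ {n′} → n′ < n → ∀ m → par m ≡ true → suc n′ ≡ c ℕ.* m → 2 ℕ.+ 2 ℕ.* suc n′ ≤ B → D n′ ≡ 0ℤ) →
               ∀ m → par m ≡ true → suc n ≡ c ℕ.* m → 2 ℕ.+ 2 ℕ.* suc n ≤ B → D n ≡ 0ℤ
        step n ih m odd-m n≡ b = trans (sym (Σ-first tail)) (begin
          Σ (λ p → pull (suc n) (sq p) D)                                        ≡⟨ sumTo-cong B (λ p → pull-- (suc n) (sq p) F G) ⟩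
          Σ (λ p → pull (suc n) (sq p) F - pull (suc n) (sq p) G)                ≡⟨ Σ-- _ _ ⟩
          Σ (λ p → pull (suc n) (sq p) F) - Σ (λ p → pull (suc n) (sq p) G)      ≡⟨ ℤₚ.i≡j⇒i-j≡0 at-suc-n ⟩
          0ℤ                                                                     ∎)
          where
          at-suc-n : Σ (λ p → pull (suc n) (sq p) F) ≡ Σ (λ p → pull (suc n) (sq p) G)
          at-suc-n = subst (λ N → Σ (λ p → pull N (sq p) F) ≡ Σ (λ p → pull N (sq p) G)) (sym n≡)
            (recursion m odd-m (subst (λ N → 2 ℕ.+ 2 ℕ.* N ≤ B) n≡ b))
          tail : ∀ p → pull (suc n) (sq (suc p)) D ≡ 0ℤ
          tail p = pull-0 (suc n) (sq (suc p)) λ n′ e → let m′ , parity , n′≡ = closed n′ p m (trans e n≡) in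
            ih (smaller n′ p e) m′ (trans parity odd-m) n′≡ (≤-trans (ℕₚ.+-monoʳ-≤ 2 (ℕₚ.*-monoʳ-≤ 2 (s≤s (ℕₚ.<⇒≤ (smaller n′ p e))))) b)

      -- The zero square now gives the leading term, and subtracting `2p²` keeps the argument odd.
      descent-even : (∀ m → par m ≡ true → 2 ℕ.+ 4 ℕ.* m ≤ B →
          F m + + 2 * Σ (λ p → pull m (2 ℕ.* (suc p ℕ.* suc p)) F) ≡ G m + + 2 * Σ (λ p → pull m (2 ℕ.* (suc p ℕ.* suc p)) G)) →
        ∀ m → par m ≡ true → 2 ℕ.+ 4 ℕ.* m ≤ B → F m ≡ G m
      descent-even recursion m odd-m b = ℤₚ.i-j≡0⇒i≡j (F m) (G m)
        (<-rec (λ m → par m ≡ true → 2 ℕ.+ 4 ℕ.* m ≤ B → D m ≡ 0ℤ) step m odd-m b)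
        where
        D : ℕ → ℤ
        D n = F n - G n
        step : ∀ m → (∀ {m′} → m′ < m → par m′ ≡ true → 2 ℕ.+ 4 ℕ.* m′ ≤ B → D m′ ≡ 0ℤ) → par m ≡ true → 2 ℕ.+ 4 ℕ.* m ≤ B → D m ≡ 0ℤ
        step m ih odd-m b = begin
          D m                                                                   ≡⟨ sym (trans (cong (λ s → D m + + 2 * s) tail) (ℤₚ.+-identityʳ (D m))) ⟩
          D m + + 2 * Σ (λ p → pull m (a p) D)                                  ≡⟨ cong (λ s → D m + + 2 * s) (trans (sumTo-cong B λ p → pull-- m (a p) F G) (Σ-- _ _)) ⟩
          D m + + 2 * (X - Y)                                                   ≡⟨ linear (F m) (G m) X Y ⟩
          (F m + + 2 * X) - (G m + + 2 * Y)                                     ≡⟨ ℤₚ.i≡j⇒i-j≡0 (recursion m odd-m b) ⟩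
          0ℤ                                                                    ∎
          where
          a : ℕ → ℕ
          a p = 2 ℕ.* (suc p ℕ.* suc p)
          X Y : ℤ
          X = Σ (λ p → pull m (a p) F)
          Y = Σ (λ p → pull m (a p) G)
          linear : ∀ f g x y → (f - g) + + 2 * (x - y) ≡ (f + + 2 * x) - (g + + 2 * y)
          linear = ℤ-Solver.solve-∀
          smaller : ∀ p m′ → m′ ℕ.+ a p ≡ m → m′ < m
          smaller p m′ e = ≤-trans (≤-reflexive (ℕₚ.+-comm 1 m′)) (≤-trans (ℕₚ.+-monoʳ-≤ m′ (s≤s z≤n)) (≤-reflexive e))
          tail : Σ (λ p → pull m (a p) D) ≡ 0ℤ
          tail = sumTo-0 B λ p → pull-0 m (a p) λ m′ e → ih (smaller p m′ e)
            (trans (sym (par-2*+ (suc p ℕ.* suc p) m′)) (trans (cong par (trans (ℕₚ.+-comm (a p) m′) e)) odd-m))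
            (≤-trans (ℕₚ.+-monoʳ-≤ 2 (ℕₚ.*-monoʳ-≤ 4 (ℕₚ.<⇒≤ (smaller p m′ e)))) b)

    -- Recursions of Kronecker's counts.

    G₃-recursion : ∀ m → par m ≡ true → 4 ℕ.* m < B → Σ (λ p → pull (4 ℕ.* m) (sq p) G₃) ≡ σ m
    G₃-recursion m odd-m 4m<B = trans
      (trans (sumTo-cong B λ p → trans (pull-ΣΣΣ (4 ℕ.* m) (sq p) _) (sumTo-cong B λ x → sumTo-cong B λ y → sumTo-cong B λ z → sym (at-pull (4 ℕ.* m) (sq p) _ 1ℤ)))
        (ΣΣ-match (₁ ∷ ₂ ∷ ₃ ∷ []) (λ p x y z → at (4 ℕ.* m) (sq p ℕ.+ (suc (2 ℕ.* x) ℕ.* suc (2 ℕ.* y) ℕ.+ suc (2 ℕ.* y) ℕ.* suc (2 ℕ.* z) ℕ.+ suc (2 ℕ.* z) ℕ.* suc (2 ℕ.* x))) 1ℤ) (fn (K 4m<B)) λ p x y z → refl))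
      (kronecker 4m<B)
      where open Bilinear m odd-m B 0<B (ℕₚ.≤-<-trans (m≤m+n m (3 ℕ.* m)) 4m<B) using (K; kronecker)

    G₁-recursion : ∀ m → par m ≡ true → 2 ℕ.* m < B → Σ (λ p → pull (2 ℕ.* m) (sq p) G₁) ≡ σ m
    G₁-recursion m odd-m 2m<B = begin
      Σ (λ p → pull N (sq p) G₁)
        ≡⟨ sumTo-cong B (λ p → trans (pull-+ N (sq p) _ _) (cong₂ _+_ (pull-ΣΣ N (sq p) _) (trans (pull-* N (sq p) (+ 2) _) (cong (λ s → + 2 * s) (pull-ΣΣΣ N (sq p) _))))) ⟩
      Σ (λ p → Σ (λ i → Σ (λ j → pull N (sq p) (λ n → at n (suc (2 ℕ.* i) ℕ.* suc (2 ℕ.* j)) 1ℤ)))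
        + + 2 * Σ (λ i → Σ (λ j → Σ (λ z → pull N (sq p) (λ n → at n (suc (2 ℕ.* i) ℕ.* suc (2 ℕ.* j) ℕ.+ 2 ℕ.* suc z ℕ.* (suc (2 ℕ.* i) ℕ.+ suc (2 ℕ.* j))) 1ℤ)))))
        ≡⟨ trans (sumTo-+ B _ _) (cong₂ _+_ (sumTo-cong B λ p → sumTo-cong B λ i → sumTo-cong B λ j → sym (at-pull N (sq p) _ 1ℤ)) (trans (sumTo-*ˡ B (+ 2) _) (cong (λ s → + 2 * s)
             (ΣΣ-match (₁ ∷ ₂ ∷ ₃ ∷ []) (λ p i j z → pull N (sq p) (λ n → at n (suc (2 ℕ.* i) ℕ.* suc (2 ℕ.* j) ℕ.+ 2 ℕ.* suc z ℕ.* (suc (2 ℕ.* i) ℕ.+ suc (2 ℕ.* j))) 1ℤ)) (fn K) λ p i j z →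
               trans (sym (at-pull N (sq p) _ 1ℤ)) (cong (λ n → at N n 1ℤ) (sym (ℕₚ.+-assoc (sq p) (suc (2 ℕ.* i) ℕ.* suc (2 ℕ.* j)) _))))))) ⟩
      K₀ + + 2 * S K
        ≡⟨ kronecker ⟩
      σ m ∎
      where
      open QForm m odd-m B 0<B 2m<B using (module EvenClass)
      open EvenClass using (K; K₀; kronecker)
      N : ℕ
      N = 2 ℕ.* m

    odd-divisors : ∀ m → par m ≡ true → m < B → Σ (λ y → Σ (λ z → at m (suc y ℕ.* suc z) 1ℤ)) ≡ Σ (λ a → Σ (λ e → at m (suc (2 ℕ.* a) ℕ.* suc (2 ℕ.* e)) 1ℤ))
    odd-divisors m odd-m m<B = begin
      Σ (λ y → Σ (λ z → f (suc y) (suc z)))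
        ≡⟨ Σ-parity {λ y → Σ (λ z → f (suc y) (suc z))} (λ y b → sumTo-0 B λ z → large y z b) ⟩
      Σ (λ a → Σ (λ z → f (suc (2 ℕ.* a)) (suc z))) + Σ (λ a → Σ (λ z → f (suc (suc (2 ℕ.* a))) (suc z)))
        ≡⟨ cong₂ _+_ (sumTo-cong B λ a → only-odd-divisors a) (sumTo-0 B λ a → sumTo-0 B λ z → even-0 (suc (suc (2 ℕ.* a))) (suc z) (cong (_∧ par (suc z)) (even a))) ⟩
      Σ (λ a → Σ (λ e → f (suc (2 ℕ.* a)) (suc (2 ℕ.* e)))) + 0ℤ
        ≡⟨ ℤₚ.+-identityʳ _ ⟩
      Σ (λ a → Σ (λ e → f (suc (2 ℕ.* a)) (suc (2 ℕ.* e)))) ∎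
      where
      f : ℕ → ℕ → ℤ
      f a e = at m (a ℕ.* e) 1ℤ
      large : ∀ y z → B ≤ y → f (suc y) (suc z) ≡ 0ℤ
      large y z b = at-≢ _ λ e → <-irrefl (sym e) (<-≤-trans m<B (≤-trans b (≤-trans (n≤1+n y) (ℕₚ.m≤m*n (suc y) (suc z)))))
      even : ∀ k → par (suc (suc (2 ℕ.* k))) ≡ false
      even k = trans (not-involutive _) (par-2* k)
      even-0 : ∀ a e → par a ∧ par e ≡ false → f a e ≡ 0ℤ
      even-0 a e p = at-≢ _ λ eq → true≢false (trans (sym odd-m) (trans (cong par (sym eq)) (trans (par-* a e) p)))
      only-odd-divisors : ∀ a → Σ (λ z → f (suc (2 ℕ.* a)) (suc z)) ≡ Σ (λ e → f (suc (2 ℕ.* a)) (suc (2 ℕ.* e)))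
      only-odd-divisors a = trans (Σ-parity {λ z → f (suc (2 ℕ.* a)) (suc z)} λ z b → trans (cong (λ n → at m n 1ℤ) (ℕₚ.*-comm (suc (2 ℕ.* a)) (suc z))) (large z (2 ℕ.* a) b))
        (trans (cong (λ s → Σ (λ e → f (suc (2 ℕ.* a)) (suc (2 ℕ.* e))) + s) (sumTo-0 B λ e → even-0 (suc (2 ℕ.* a)) (suc (suc (2 ℕ.* e))) (trans (cong (par (suc (2 ℕ.* a)) ∧_) (even e)) (∧-zeroʳ _)))) (ℤₚ.+-identityʳ _))

    G₂-recursion : ∀ m → par m ≡ true → 2 ℕ.* m < B → G₂ m + + 2 * Σ (λ p → pull m (2 ℕ.* (suc p ℕ.* suc p)) G₂) ≡ σ m
    G₂-recursion m odd-m 2m<B = trans (cong₂ (λ x y → x + K₀ + + 2 * y) (trans (odd-divisors m odd-m m<B) (sym (S-dummy₂ λ a e → at m (suc (2 ℕ.* a) ℕ.* suc (2 ℕ.* e)) 1ℤ))) unpull)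
      (trans (linear (S Divisors.N) K₀ (S J) (S K)) kronecker)
      where
      open QForm m odd-m B 0<B 2m<B using (module Divisors; module OddClass)
      open OddClass using (K; J; K₀; kronecker)
      m<B : m < B
      m<B = ℕₚ.≤-<-trans (m≤m+n m (1 ℕ.* m)) 2m<B
      a : ℕ → ℕ
      a p = 2 ℕ.* (suc p ℕ.* suc p)
      linear : ∀ n k₀ j k → n + k₀ + + 2 * (j + k) ≡ n + k₀ + + 2 * j + + 2 * k
      linear = ℤ-Solver.solve-∀
      swapped : ∀ p n x → at m (a p ℕ.+ n) x ≡ at m (n ℕ.+ 2 ℕ.* suc p ℕ.* suc p) x
      swapped p n x = cong (λ k → at m k x) (trans (ℕₚ.+-comm (a p) n) (cong (λ k → n ℕ.+ k) (sym (ℕₚ.*-assoc 2 (suc p) (suc p)))))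
      J≡ : Σ (λ p → Σ (λ y → Σ (λ z → pull m (a p) (λ n → at n (suc y ℕ.* suc z) 1ℤ)))) ≡ S J
      J≡ = trans (sym (S-dummy λ p y z → pull m (a p) (λ n → at n (suc y ℕ.* suc z) 1ℤ)))
        (ΣΣ-match (₂ ∷ ₃ ∷ []) (λ d p y z → ⟦=0⟧ d (pull m (a p) (λ n → at n (suc y ℕ.* suc z) 1ℤ))) (fn J) λ d p y z →
          cong (⟦=0⟧ d) (trans (sym (at-pull m (a p) _ 1ℤ)) (swapped p (suc y ℕ.* suc z) 1ℤ)))
      K≡ : ΣΣ (λ p i j z → pull m (a p) (λ n → at n (2 ℕ.* suc i ℕ.* suc j ℕ.+ suc z ℕ.* (suc i ℕ.+ suc j)) 1ℤ)) ≡ S K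
      K≡ = ΣΣ-match (₁ ∷ ₂ ∷ ₃ ∷ []) (λ p i j z → pull m (a p) (λ n → at n (2 ℕ.* suc i ℕ.* suc j ℕ.+ suc z ℕ.* (suc i ℕ.+ suc j)) 1ℤ)) (fn K) λ p i j z →
        trans (sym (at-pull m (a p) _ 1ℤ)) (swapped p (2 ℕ.* suc i ℕ.* suc j ℕ.+ suc z ℕ.* (suc i ℕ.+ suc j)) 1ℤ)
      unpull : Σ (λ p → pull m (a p) G₂) ≡ S J + S K
      unpull = trans (sumTo-cong B λ p → trans (pull-+ m (a p) _ _) (cong₂ _+_ (pull-ΣΣ m (a p) _) (pull-ΣΣΣ m (a p) _))) (trans (sumTo-+ B _ _) (cong₂ _+_ J≡ K≡))

    -- Positivity of Kronecker's counts and representations from nonzero counts.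

    E-witness : ∀ {F : ℕ → ℤ} → E F ≢ 0ℤ → ∃ λ x → F (x ℕ.* x) ≢ 0ℤ
    E-witness {F} ne with F 0 ℤₚ.≟ 0ℤ
    ... | no ne₀ = 0 , ne₀
    ... | yes z with sumTo-witness B {λ j → F (4 ℕ.* (suc j ℕ.* suc j))} (λ e → ne (cong₂ (λ x y → x + + 2 * y) z e))
    ... | j , nej = 2 ℕ.* suc j , λ e → nej (trans (cong F (double (suc j))) e)
      where
      double : ∀ k → 4 ℕ.* (k ℕ.* k) ≡ 2 ℕ.* k ℕ.* (2 ℕ.* k)
      double = solve-∀

    Σ-nonneg : ∀ {f : ℕ → ℤ} → (∀ i → 0ℤ ℤ.≤ f i) → 0ℤ ℤ.≤ Σ f
    Σ-nonneg = sumTo-nonneg B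

    Σ³-nonneg : ∀ n (f : ℕ → ℕ → ℕ → ℕ) → 0ℤ ℤ.≤ Σ (λ i → Σ (λ j → Σ (λ k → at n (f i j k) 1ℤ)))
    Σ³-nonneg n f = Σ-nonneg λ i → Σ-nonneg λ j → Σ-nonneg λ k → at-nonneg n (f i j k)

    Σ²-positive : ∀ n (f : ℕ → ℕ → ℕ) j → j < B → f 0 j ≡ n → 0ℤ ℤ.< Σ (λ i → Σ (λ j → at n (f i j) 1ℤ))
    Σ²-positive n f j b e = sumTo-positive (λ i → Σ-nonneg λ j → at-nonneg n (f i j)) 0<B
      (sumTo-positive (λ j → at-nonneg n (f 0 j)) b (at-positive e))

    G₃-positive : ∀ n z → z < B → 1 ℕ.* 1 ℕ.+ 1 ℕ.* suc (2 ℕ.* z) ℕ.+ suc (2 ℕ.* z) ℕ.* 1 ≡ n → 0ℤ ℤ.< G₃ n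
    G₃-positive n z b e = sumTo-positive (λ x → Σ-nonneg λ y → Σ-nonneg λ z → at-nonneg n (f x y z)) 0<B (Σ²-positive n (f 0) z b e)
      where
      f : ℕ → ℕ → ℕ → ℕ
      f x y z = suc (2 ℕ.* x) ℕ.* suc (2 ℕ.* y) ℕ.+ suc (2 ℕ.* y) ℕ.* suc (2 ℕ.* z) ℕ.+ suc (2 ℕ.* z) ℕ.* suc (2 ℕ.* x)

    G₁-positive : ∀ n j → j < B → 1 ℕ.* suc (2 ℕ.* j) ≡ n → 0ℤ ℤ.< G₁ n
    G₁-positive n j b e = ℤₚ.+-mono-<-≤ (Σ²-positive n (λ i j → suc (2 ℕ.* i) ℕ.* suc (2 ℕ.* j)) j b e)
      (ℤₚ.*-monoˡ-≤-nonNeg (+ 2) (Σ³-nonneg n λ i j z → suc (2 ℕ.* i) ℕ.* suc (2 ℕ.* j) ℕ.+ 2 ℕ.* suc z ℕ.* (suc (2 ℕ.* i) ℕ.+ suc (2 ℕ.* j))))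

    G₂-positive : ∀ n z → z < B → 1 ℕ.* suc z ≡ n → 0ℤ ℤ.< G₂ n
    G₂-positive n z b e = ℤₚ.+-mono-<-≤ (Σ²-positive n (λ y z → suc y ℕ.* suc z) z b e)
      (Σ³-nonneg n λ i j z → 2 ℕ.* suc i ℕ.* suc j ℕ.+ suc z ℕ.* (suc i ℕ.+ suc j))

    R₃-witness : ∀ n → R₃ n ≢ 0ℤ → SumOfThreeSquares n
    R₃-witness n ne with sumTo-witness B ne
    ... | i , neᵢ with sumTo-witness B neᵢ
    ... | j , neⱼ with sumTo-witness B neⱼ
    ... | k , neₖ = suc (2 ℕ.* i) , suc (2 ℕ.* j) , suc (2 ℕ.* k) , sym (at-hit neₖ)

    R₁-witness : ∀ n → R₁ n ≢ 0ℤ → SumOfThreeSquares n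
    R₁-witness n ne with sumTo-witness B ne
    ... | k , neₖ with E-witness {λ u → E (λ v → at n (sq k ℕ.+ (u ℕ.+ v)) 1ℤ)} neₖ
    ... | x , neₓ with E-witness {λ v → at n (sq k ℕ.+ (x ℕ.* x ℕ.+ v)) 1ℤ} neₓ
    ... | y , ne-y = suc (2 ℕ.* k) , x , y , trans (sym (at-hit ne-y)) (sym (ℕₚ.+-assoc (sq k) (x ℕ.* x) (y ℕ.* y)))

    R₂-witness : ∀ n → R₂ n ≢ 0ℤ → SumOfThreeSquares (2 ℕ.* n)
    R₂-witness n ne with E-witness {λ v → Σ (λ i → Σ (λ k → at (2 ℕ.* n) (v ℕ.+ (sq i ℕ.+ sq k)) 1ℤ))} ne
    ... | x , neₓ with sumTo-witness B neₓ
    ... | i , neᵢ with sumTo-witness B neᵢ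
    ... | k , neₖ = x , suc (2 ℕ.* i) , suc (2 ℕ.* k) , trans (sym (at-hit neₖ)) (sym (ℕₚ.+-assoc (x ℕ.* x) (sq i) (sq k)))

  -- Legendre's three-square theorem

  positive⇒≢0 : ∀ {x y} → x ≡ y → 0ℤ ℤ.< y → x ≢ 0ℤ
  positive⇒≢0 refl p e = ℤₚ.<-irrefl (sym e) p

  three-mod-eight : ∀ t → SumOfThreeSquares (3 ℕ.+ 8 ℕ.* t)
  -- The form `xy + yz + zx` takes the value `8t + 3` at `x = y = 1`, `z = 4t + 1`; the index of
  -- this `z` is `2t`.
  three-mod-eight t = R₃-witness n (positive⇒≢0 R≡G (G₃-positive n (2 ℕ.* t) small (one t)))
    where
    n B : ℕ
    n = 3 ℕ.+ 8 ℕ.* t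
    B = 2 ℕ.+ 2 ℕ.* suc n
    open Squares B (s≤s z≤n)
    open Sums B (s≤s z≤n) using (Σ)
    recursion : ∀ m → par m ≡ true → 2 ℕ.+ 2 ℕ.* (4 ℕ.* m) ≤ B → Σ (λ p → pull (4 ℕ.* m) (sq p) R₃) ≡ Σ (λ p → pull (4 ℕ.* m) (sq p) G₃)
    recursion m odd-m b = trans (R₃-recursion (4 ℕ.* m)) (trans (four≡σ m b′) (sym (G₃-recursion m odd-m (ℕₚ.<-trans (ℕₚ.n<1+n _) b′))))
      where
      b′ : suc (4 ℕ.* m) < B
      b′ = ≤-trans (s≤s (s≤s (m≤m+n (4 ℕ.* m) _))) b
    R≡G : R₃ n ≡ G₃ n
    R≡G = descent R₃ G₃ 3 1 refl recursion n (suc (2 ℕ.* t)) (par-odd t) (e t) ≤-refl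
      where
      e : ∀ t → suc (3 ℕ.+ 8 ℕ.* t) ≡ 4 ℕ.* suc (2 ℕ.* t)
      e = solve-∀
    small : 2 ℕ.* t < B
    small = grow {a = suc (2 ℕ.* t)} ≤-refl (9 ℕ.+ 14 ℕ.* t) (e t)
      where
      e : ∀ t → suc (2 ℕ.* t) ℕ.+ (9 ℕ.+ 14 ℕ.* t) ≡ 2 ℕ.+ 2 ℕ.* suc (3 ℕ.+ 8 ℕ.* t)
      e = solve-∀
    one : ∀ t → 1 ℕ.* 1 ℕ.+ 1 ℕ.* suc (2 ℕ.* (2 ℕ.* t)) ℕ.+ suc (2 ℕ.* (2 ℕ.* t)) ℕ.* 1 ≡ 3 ℕ.+ 8 ℕ.* t
    one = solve-∀

  one-mod-four : ∀ t → SumOfThreeSquares (1 ℕ.+ 4 ℕ.* t)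
  one-mod-four t = R₁-witness n (positive⇒≢0 R≡G (G₁-positive n (2 ℕ.* t) small (one t)))
    where
    n B : ℕ
    n = 1 ℕ.+ 4 ℕ.* t
    -- The recursion for `R₁` evaluates `four` at `2 * suc n`, and `four≡divisor-sum` needs one more
    -- than this argument below `B`.
    B = 2 ℕ.+ 2 ℕ.* suc n
    open Squares B (s≤s z≤n)
    open Sums B (s≤s z≤n) using (Σ)
    recursion : ∀ m → par m ≡ true → 2 ℕ.+ 2 ℕ.* (2 ℕ.* m) ≤ B → Σ (λ p → pull (2 ℕ.* m) (sq p) R₁) ≡ Σ (λ p → pull (2 ℕ.* m) (sq p) G₁)
    recursion m odd-m b = trans (R₁-recursion (2 ℕ.* m) (ℕₚ.<-trans (ℕₚ.n<1+n _) b)) (trans (cong four 4m≡) (trans (four≡σ m (subst (λ k → suc k < B) 4m≡ b))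
        (sym (G₁-recursion m odd-m (≤-trans (s≤s (≤-trans (m≤m+n (2 ℕ.* m) _) (n≤1+n _))) b)))))
      where
      4m≡ : 2 ℕ.* (2 ℕ.* m) ≡ 4 ℕ.* m
      4m≡ = sym (ℕₚ.*-assoc 2 2 m)
    R≡G : R₁ n ≡ G₁ n
    R≡G = descent R₁ G₁ 1 2 refl recursion n (suc (2 ℕ.* t)) (par-odd t) (e t) ≤-refl
      where
      e : ∀ t → suc (1 ℕ.+ 4 ℕ.* t) ≡ 2 ℕ.* suc (2 ℕ.* t)
      e = solve-∀
    small : 2 ℕ.* t < B
    small = grow {a = suc (2 ℕ.* t)} ≤-refl (5 ℕ.+ 6 ℕ.* t) (e t)
      where
      e : ∀ t → suc (2 ℕ.* t) ℕ.+ (5 ℕ.+ 6 ℕ.* t) ≡ 2 ℕ.+ 2 ℕ.* suc (1 ℕ.+ 4 ℕ.* t)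
      e = solve-∀
    one : ∀ t → 1 ℕ.* suc (2 ℕ.* (2 ℕ.* t)) ≡ 1 ℕ.+ 4 ℕ.* t
    one = solve-∀

  two-mod-four : ∀ t → SumOfThreeSquares (2 ℕ.* suc (2 ℕ.* t))
  two-mod-four t = R₂-witness m (positive⇒≢0 R≡G (G₂-positive m (2 ℕ.* t) small (ℕₚ.*-identityˡ m)))
    where
    m B : ℕ
    m = suc (2 ℕ.* t)
    B = 2 ℕ.+ 4 ℕ.* m
    open Squares B (s≤s z≤n)
    open Sums B (s≤s z≤n) using (Σ)
    recursion : ∀ m → par m ≡ true → 2 ℕ.+ 4 ℕ.* m ≤ B →
      R₂ m + + 2 * Σ (λ p → pull m (2 ℕ.* (suc p ℕ.* suc p)) R₂) ≡ G₂ m + + 2 * Σ (λ p → pull m (2 ℕ.* (suc p ℕ.* suc p)) G₂)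
    recursion m odd-m b = trans (R₂-recursion m (subst (_< B) 4m≡ (ℕₚ.<-trans (ℕₚ.n<1+n _) b))) (trans (cong four (sym 4m≡)) (trans (four≡σ m b)
        (sym (G₂-recursion m odd-m (≤-trans (s≤s (≤-trans (ℕₚ.*-monoˡ-≤ m {2} {4} (s≤s (s≤s z≤n))) (n≤1+n _))) b)))))
      where
      4m≡ : 4 ℕ.* m ≡ 2 ℕ.* (2 ℕ.* m)
      4m≡ = ℕₚ.*-assoc 2 2 m
    R≡G : R₂ m ≡ G₂ m
    R≡G = descent-even R₂ G₂ recursion m (par-odd t) ≤-refl
    small : 2 ℕ.* t < B
    small = ≤-trans (m≤m+n m (3 ℕ.* m)) (m≤n+m (4 ℕ.* m) 2)

  three-squares : ∀ n → (∀ s t → n ≢ 4 ℕ.^ s ℕ.* (8 ℕ.* t ℕ.+ 7)) → SumOfThreeSquares n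
  three-squares = <-rec (λ n → (∀ s t → n ≢ 4 ℕ.^ s ℕ.* (8 ℕ.* t ℕ.+ 7)) → SumOfThreeSquares n) step
    where
    quadruple : ∀ k → SumOfThreeSquares k → SumOfThreeSquares (4 ℕ.* k)
    quadruple k (x , y , z , refl) = 2 ℕ.* x , 2 ℕ.* y , 2 ℕ.* z , e x y z
      where
      e : ∀ x y z → 4 ℕ.* (x ℕ.* x ℕ.+ y ℕ.* y ℕ.+ z ℕ.* z) ≡ 2 ℕ.* x ℕ.* (2 ℕ.* x) ℕ.+ 2 ℕ.* y ℕ.* (2 ℕ.* y) ℕ.+ 2 ℕ.* z ℕ.* (2 ℕ.* z)
      e = solve-∀
    multiple : ∀ {n} k → n ≡ 4 ℕ.* k → (∀ {n′} → n′ < n → (∀ s t → n′ ≢ 4 ℕ.^ s ℕ.* (8 ℕ.* t ℕ.+ 7)) → SumOfThreeSquares n′) →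
               (∀ s t → n ≢ 4 ℕ.^ s ℕ.* (8 ℕ.* t ℕ.+ 7)) → SumOfThreeSquares n
    multiple zero    refl ih h = 0 , 0 , 0 , refl
    multiple (suc k) refl ih h = quadruple (suc k) (ih (ℕₚ.m<m+n (suc k) (s≤s z≤n))
      -- A forbidden form of the quotient with exponent `s` would give one of its fourfold with
      -- exponent `suc s`.
      λ s t e → h (suc s) t (trans (cong (4 ℕ.*_) e) (sym (ℕₚ.*-assoc 4 (4 ℕ.^ s) _))))
    step : ∀ n → (∀ {n′} → n′ < n → (∀ s t → n′ ≢ 4 ℕ.^ s ℕ.* (8 ℕ.* t ℕ.+ 7)) → SumOfThreeSquares n′) →
           (∀ s t → n ≢ 4 ℕ.^ s ℕ.* (8 ℕ.* t ℕ.+ 7)) → SumOfThreeSquares n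
    step n ih h with n divMod 8
    ... | result q 0F e = multiple (2 ℕ.* q) (trans e (arr q)) ih h
      where arr : ∀ q → q ℕ.* 8 ≡ 4 ℕ.* (2 ℕ.* q)
            arr = solve-∀
    ... | result q 1F e = subst SumOfThreeSquares (trans (arr q) (sym e)) (one-mod-four (2 ℕ.* q))
      where arr : ∀ q → 1 ℕ.+ 4 ℕ.* (2 ℕ.* q) ≡ 1 ℕ.+ q ℕ.* 8
            arr = solve-∀
    ... | result q 2F e = subst SumOfThreeSquares (trans (arr q) (sym e)) (two-mod-four (2 ℕ.* q))
      where arr : ∀ q → 2 ℕ.* suc (2 ℕ.* (2 ℕ.* q)) ≡ 2 ℕ.+ q ℕ.* 8
            arr = solve-∀
    ... | result q 3F e = subst SumOfThreeSquares (trans (cong (3 ℕ.+_) (ℕₚ.*-comm 8 q)) (sym e)) (three-mod-eight q)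
    ... | result q 4F e = multiple (suc (2 ℕ.* q)) (trans e (arr q)) ih h
      where arr : ∀ q → 4 ℕ.+ q ℕ.* 8 ≡ 4 ℕ.* suc (2 ℕ.* q)
            arr = solve-∀
    ... | result q 5F e = subst SumOfThreeSquares (trans (arr q) (sym e)) (one-mod-four (suc (2 ℕ.* q)))
      where arr : ∀ q → 1 ℕ.+ 4 ℕ.* suc (2 ℕ.* q) ≡ 5 ℕ.+ q ℕ.* 8
            arr = solve-∀
    ... | result q 6F e = subst SumOfThreeSquares (trans (arr q) (sym e)) (two-mod-four (suc (2 ℕ.* q)))
      where arr : ∀ q → 2 ℕ.* suc (2 ℕ.* (suc (2 ℕ.* q))) ≡ 6 ℕ.+ q ℕ.* 8
            arr = solve-∀
    ... | result q 7F e = ⊥-elim (h 0 q (trans e (arr q)))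
      where arr : ∀ q → 7 ℕ.+ q ℕ.* 8 ≡ 1 ℕ.* (8 ℕ.* q ℕ.+ 7)
            arr = solve-∀

-- Reduction of the theorem to three squares.

open import Defs
open import Data.Nat using (ℕ; _+_; _*_; _^_; NonZero)
open import Data.Nat.DivMod using (_/_)
open import Data.Product using (Σ; _×_; ∃-syntax)
open import Relation.Binary.PropositionalEquality using (_≡_; _≢_)
open import Data.Nat using (zero; suc; _<_; z<s)
open import Data.Nat.DivMod using (_%_; m%n<n; m%n%n≡m%n; [m+kn]%n≡m%n; m≡m%n+[m/n]*n)
open import Data.Nat.Properties using (+-comm; *-comm; +-cancelʳ-≡; *-cancelˡ-≡)
open import Data.Nat.Tactic.RingSolver using (solve-∀)
open import Data.Product using (_,_)
open import Data.Sum using (inj₁; inj₂)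
open import Relation.Binary.PropositionalEquality using (refl; sym; trans; cong; cong₂; subst)
open ThreeSquares using (three-squares)

-- `QR` contains positive residues only, so a square divisible by `a` has to take the other
-- alternative of `QR₀`.
QR₀-square : ∀ a .{{_ : NonZero a}} x φ → φ ≡ (x * x) % a → QR₀ a φ
QR₀-square a x zero    e = inj₁ refl
QR₀-square a x (suc φ) e = inj₂ (z<s , subst (_< a) (sym e) (m%n<n (x * x) a) , x , trans (cong (_% a) e) (m%n%n≡m%n (x * x) a))

theorem1 : (a : ℕ) → .{{_ : NonZero a}} →
    (∀ (k : ℕ) → ∃[ r ] (InR a r × (∀ (s t : ℕ) → a * k + r ≢ 4 ^ s * (8 * t + 7)))) →
    ∀ (N : ℕ) → ∃[ A ] ∃[ B ] ∃[ C ] (N ≡ (A * A) / a + (B * B) / a + (C * C) / a)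
theorem1 a h N with h N
... | r , (_ , unique) , avoid with three-squares (a * N + r) avoid
... | x , y , z , e = x , y , z , *-cancelˡ-≡ N Q a (+-cancelʳ-≡ r (a * N) (a * Q) quotients)
  where
  s Q : ℕ
  s = (x * x) % a + (y * y) % a + (z * z) % a
  Q = (x * x) / a + (y * y) / a + (z * z) / a
  collect : ∀ a u v w u′ v′ w′ → (u + u′ * a) + (v + v′ * a) + (w + w′ * a) ≡ (u + v + w) + (u′ + v′ + w′) * a
  collect = solve-∀
  expand : a * N + r ≡ s + Q * a
  expand = trans e (trans (cong₂ _+_ (cong₂ _+_ (m≡m%n+[m/n]*n (x * x) a) (m≡m%n+[m/n]*n (y * y) a)) (m≡m%n+[m/n]*n (z * z) a))
    (collect a ((x * x) % a) ((y * y) % a) ((z * z) % a) ((x * x) / a) ((y * y) / a) ((z * z) / a)))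
  r≡s : r ≡ s
  r≡s = unique s (_ , _ , _ , QR₀-square a x _ refl , QR₀-square a y _ refl , QR₀-square a z _ refl , refl)
    (trans (sym ([m+kn]%n≡m%n r N a)) (trans (cong (_% a) (trans (trans (cong (r +_) (*-comm N a)) (+-comm r (a * N))) expand)) ([m+kn]%n≡m%n s Q a)))
  quotients : a * N + r ≡ a * Q + r
  quotients = trans expand (trans (+-comm s (Q * a)) (cong₂ _+_ (*-comm Q a) (sym r≡s)))
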